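{- Let $m\ge2$ and let $\mathcal{H}\in\mathcal{P}(\mathcal{H})$ be a connected bicyclic linear $m$-uniform hypergraph with $k\ge8$ edges such that $\mathcal{H}\ne B_2C(k-6,0)$. Suppose $(k-12)(m-1)\ge56$. Then $\lambda_1(\mathcal{H})\le\lambda_1(B_2C(k-7,1))$, and equality holds only when $\mathcal{H}=B_2C(k-7,1)$.
   Context: A hypergraph has a finite vertex set and an edge set of non-empty subsets of the vertex set; it is $m$-uniform if all edges have cardinality $m$, and linear if two distinct edges share at most one vertex. The adjacency matrix of a linear $m$-uniform hypergraph has $(i,j)$ entry $\frac{1}{m-1}$ if $i\ne j$ lie in a common edge, and $0$ otherwise; $\lambda_1$ denotes the spectral radius of this matrix. The degree of a vertex is the number of edges containing it. The $m$-th power hypergraph of a graph $G(V,E)$ is the $m$-uniform hypergraph obtained by adding to each edge $e\in E$ $m-2$ new vertices $v_{e,1},\dots,v_{e,m-2}$ (distinct for distinct edges). $\mathcal{P}(\mathcal{H})$ denotes the set of $m$-th power hypergraphs of graphs (a fixed notation for the set, not depending on the particular hypergraph $\mathcal{H}$). A loose cycle of length $l\ge3$, $v_1e_1v_2e_2\dots v_le_lv_1$, is the $m$-uniform hypergraph with edges $e_1,\dots,e_l$ in which $e_{i-1}\cap e_i=\{v_i\}$ (indices mod $l$, the $v_i$ distinct) and non-consecutive edges are disjoint; $v_1,\dots,v_l$ are its core vertices. A linear hypergraph is bicyclic if it contains exactly two loose cycles. Attaching a pendant edge at a vertex $v$ means adding a new edge consisting of $v$ and $m-1$ new vertices. $BC(l_1)$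 is the linear hypergraph obtained by joining two loose cycles of length $3$ by identifying one core vertex of each, and attaching $l_1$ pendant edges at the identified vertex. $B_2C(l_1,l_2)$ is obtained from $BC(l_1)$ by attaching $l_2$ pendant edges at one vertex of degree $2$ of $BC(l_1)$ (i.e. at one of the four non-identified core vertices of the two cycles). Equality of hypergraphs means isomorphism. -}

module Defs where

open import Data.Bool using (if_then_else_) renaming (_≟_ to _≟ᵇ_)
open import Data.Empty using (⊥-elim)
open import Data.Fin.Base using (Fin; zero; suc; toℕ; splitAt; join; _↑ˡ_)
open import Data.Fin.Patterns using (0F; 1F; 2F; 3F; 4F; 5F)
open import Data.Fin.Properties using (all?; any?; join-splitAt) renaming (_≟_ to _≟ᶠ_)
open import Data.Fin.Subset using (Subset; _∈_; _∩_; ∣_∣; ⁅_⁆; ⊥; ⊤; _∪_; Empty; Nonempty; outside)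
open import Data.Fin.Subset.Properties using (_∈?_; x∈⁅x⁆; nonempty?)
open import Data.Integer.Base using (+_)
open import Data.Nat.Base as ℕ using (ℕ; zero; suc; NonZero; NonTrivial)
import Data.Nat.Properties as ℕₚ
open import Data.Nat.DivMod using (_mod_)
open import Data.Product using (Σ; ∃-syntax; _×_; _,_)
open import Data.Rational.Base as ℚ using (ℚ; 0ℚ; 1ℚ; ½)
import Data.Rational.Properties as ℚₚ
open import Data.Rational.Solver using (module +-*-Solver)
open import Data.Sum.Base using (_⊎_; inj₁; inj₂)
open import Data.Vec.Base using (_++_; concat; replicate; _[_]≔_; _∷_; here; there)
open import Data.Vec.Functional using (Vector; foldr)
open import Data.Vec.Properties using (++-injectiveˡ; ++-injectiveʳ; ≡-dec)
open import Function.Bundles using (_↔_; _⇔_; Inverse)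
open import Function.Definitions using (Injective)
open import Relation.Binary.Construct.Closure.ReflexiveTransitive using (Star)
open import Relation.Binary.PropositionalEquality
open import Relation.Nullary using (¬_; Dec; does)
open import Relation.Nullary.Decidable using (_×-dec_; _→-dec_; ¬?; from-yes)

-- Real numbers: Cauchy sequences of rationals, up to _≈_

record ℝ : Set where
  constructor mkℝ
  field
    seq    : ℕ → ℚ
    cauchy : ∀ ε → 0ℚ ℚ.< ε → ∃[ N ] ∀ m n → N ℕ.≤ m → N ℕ.≤ n →
             ℚ.∣ seq m ℚ.- seq n ∣ ℚ.< ε
open ℝ public

infix 4 _≈_ _≤_

_≈_ : ℝ → ℝ → Set
x ≈ y = ∀ ε → 0ℚ ℚ.< ε → ∃[ N ] ∀ n → N ℕ.≤ n → ℚ.∣ seq x n ℚ.- seq y n ∣ ℚ.< ε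

_≤_ : ℝ → ℝ → Set
x ≤ y = ∀ ε → 0ℚ ℚ.< ε → ∃[ N ] ∀ n → N ℕ.≤ n → seq x n ℚ.< seq y n ℚ.+ ε

fromℚ : ℚ → ℝ
fromℚ q = mkℝ (λ _ → q) λ ε 0<ε → 0 , λ _ _ _ _ →
  subst (ℚ._< ε) (sym (cong ℚ.∣_∣ (ℚₚ.+-inverseʳ q))) 0<ε

0ℝ : ℝ
0ℝ = fromℚ 0ℚ

½* : ∀ {ε} → 0ℚ ℚ.< ε → 0ℚ ℚ.< ½ ℚ.* ε
½* {ε} 0<ε = subst (ℚ._< ½ ℚ.* ε) (ℚₚ.*-zeroʳ ½) (ℚₚ.*-monoʳ-<-pos ½ 0<ε)

halves : ∀ ε → ½ ℚ.* ε ℚ.+ ½ ℚ.* ε ≡ ε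
halves ε = trans (sym (ℚₚ.*-distribʳ-+ ε ½ ½)) (ℚₚ.*-identityˡ ε)

+-swap : ∀ a b c d → (a ℚ.+ b) ℚ.- (c ℚ.+ d) ≡ (a ℚ.- c) ℚ.+ (b ℚ.- d)
+-swap = solve 4 (λ a b c d → (a :+ b) :- (c :+ d) := (a :- c) :+ (b :- d)) refl
  where open +-*-Solver

*-swap : ∀ a b c d → (a ℚ.* b) ℚ.- (c ℚ.* d) ≡ a ℚ.* (b ℚ.- d) ℚ.+ d ℚ.* (a ℚ.- c)
*-swap = solve 4 (λ a b c d → (a :* b) :- (c :* d) := a :* (b :- d) :+ d :* (a :- c)) refl
  where open +-*-Solver

neg-swap : ∀ a b → (ℚ.- a) ℚ.- (ℚ.- b) ≡ ℚ.- (a ℚ.- b)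
neg-swap = solve 2 (λ a b → (:- a) :- (:- b) := :- (a :- b)) refl
  where open +-*-Solver

add-sub : ∀ a b → a ≡ b ℚ.+ (a ℚ.- b)
add-sub = solve 2 (λ a b → a := b :+ (a :- b)) refl
  where open +-*-Solver

bound : (x : ℝ) → ∃[ B ] ∃[ N ] 0ℚ ℚ.< B × (∀ n → N ℕ.≤ n → ℚ.∣ seq x n ∣ ℚ.≤ B)
bound x with cauchy x 1ℚ (ℚₚ.positive⁻¹ 1ℚ)
... | N , close = ℚ.∣ seq x N ∣ ℚ.+ 1ℚ , N , 0<B , λ n N≤n → begin
    ℚ.∣ seq x n ∣                                  ≡⟨ cong ℚ.∣_∣ (add-sub (seq x n) (seq x N)) ⟩
    ℚ.∣ seq x N ℚ.+ (seq x n ℚ.- seq x N) ∣        ≤⟨ ℚₚ.∣p+q∣≤∣p∣+∣q∣ (seq x N) _ ⟩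
    ℚ.∣ seq x N ∣ ℚ.+ ℚ.∣ seq x n ℚ.- seq x N ∣    ≤⟨ ℚₚ.+-monoʳ-≤ ℚ.∣ seq x N ∣ (ℚₚ.<⇒≤ (close n N N≤n ℕₚ.≤-refl)) ⟩
    ℚ.∣ seq x N ∣ ℚ.+ 1ℚ                           ∎
  where
  open ℚₚ.≤-Reasoning
  0<B : 0ℚ ℚ.< ℚ.∣ seq x N ∣ ℚ.+ 1ℚ
  0<B = ℚₚ.+-mono-≤-< (ℚₚ.0≤∣p∣ (seq x N)) (ℚₚ.positive⁻¹ 1ℚ)

quotient : ∀ B ε → 0ℚ ℚ.< B → 0ℚ ℚ.< ε → ∃[ δ ] 0ℚ ℚ.< δ × B ℚ.* δ ≡ ε
quotient B ε 0<B 0<ε = (ℚ.1/ B) ℚ.* ε , 0<δ , B*δ≡ε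
  where
  instance
    B>0 : ℚ.Positive B
    B>0 = ℚ.positive 0<B
    B≢0 : ℚ.NonZero B
    B≢0 = ℚ.>-nonZero 0<B
    1/B>0 : ℚ.Positive (ℚ.1/ B)
    1/B>0 = ℚₚ.1/pos⇒pos B
  0<δ : 0ℚ ℚ.< (ℚ.1/ B) ℚ.* ε
  0<δ = subst (ℚ._< (ℚ.1/ B) ℚ.* ε) (ℚₚ.*-zeroʳ (ℚ.1/ B)) (ℚₚ.*-monoʳ-<-pos (ℚ.1/ B) 0<ε)
  B*δ≡ε : B ℚ.* ((ℚ.1/ B) ℚ.* ε) ≡ ε
  B*δ≡ε = trans (sym (ℚₚ.*-assoc B (ℚ.1/ B) ε))
            (trans (cong (ℚ._* ε) (ℚₚ.*-inverseʳ B)) (ℚₚ.*-identityˡ ε))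

scaled : ∀ {a d B δ} → 0ℚ ℚ.< B → ℚ.∣ a ∣ ℚ.≤ B → ℚ.∣ d ∣ ℚ.< δ → ℚ.∣ a ℚ.* d ∣ ℚ.< B ℚ.* δ
scaled {a} {d} {B} {δ} 0<B a≤B d<δ = begin-strict
  ℚ.∣ a ℚ.* d ∣         ≡⟨ ℚₚ.∣p*q∣≡∣p∣*∣q∣ a d ⟩
  ℚ.∣ a ∣ ℚ.* ℚ.∣ d ∣   ≤⟨ ℚₚ.*-monoʳ-≤-nonNeg ℚ.∣ d ∣ {{ℚₚ.∣-∣-nonNeg d}} a≤B ⟩
  B ℚ.* ℚ.∣ d ∣         <⟨ ℚₚ.*-monoʳ-<-pos B {{ℚ.positive 0<B}} d<δ ⟩
  B ℚ.* δ               ∎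
  where open ℚₚ.≤-Reasoning

infixl 6 _+_ _-_
infixl 7 _*_
infix  8 -_

_+_ : ℝ → ℝ → ℝ
seq    (x + y) n = seq x n ℚ.+ seq y n
cauchy (x + y) ε 0<ε with cauchy x _ (½* 0<ε) | cauchy y _ (½* 0<ε)
... | M , closeˣ | N , closeʸ = M ℕ.⊔ N , λ m n p q → begin-strict
    ℚ.∣ (seq x m ℚ.+ seq y m) ℚ.- (seq x n ℚ.+ seq y n) ∣
      ≡⟨ cong ℚ.∣_∣ (+-swap (seq x m) (seq y m) (seq x n) (seq y n)) ⟩
    ℚ.∣ (seq x m ℚ.- seq x n) ℚ.+ (seq y m ℚ.- seq y n) ∣
      ≤⟨ ℚₚ.∣p+q∣≤∣p∣+∣q∣ (seq x m ℚ.- seq x n) _ ⟩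
    ℚ.∣ seq x m ℚ.- seq x n ∣ ℚ.+ ℚ.∣ seq y m ℚ.- seq y n ∣
      <⟨ ℚₚ.+-mono-< (closeˣ m n (ℕₚ.m⊔n≤o⇒m≤o M N p) (ℕₚ.m⊔n≤o⇒m≤o M N q))
                     (closeʸ m n (ℕₚ.m⊔n≤o⇒n≤o M N p) (ℕₚ.m⊔n≤o⇒n≤o M N q)) ⟩
    ½ ℚ.* ε ℚ.+ ½ ℚ.* ε
      ≡⟨ halves ε ⟩
    ε ∎
  where open ℚₚ.≤-Reasoning

-_ : ℝ → ℝ
seq    (- x) n = ℚ.- seq x n
cauchy (- x) ε 0<ε with cauchy x ε 0<ε
... | N , close = N , λ m n p q →
  subst (ℚ._< ε) (sym (trans (cong ℚ.∣_∣ (neg-swap (seq x m) (seq x n)))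
                             (ℚₚ.∣-p∣≡∣p∣ (seq x m ℚ.- seq x n))))
        (close m n p q)

_-_ : ℝ → ℝ → ℝ
x - y = x + (- y)

product-close : ∀ {a b c d B C δ η ε} → 0ℚ ℚ.< B → 0ℚ ℚ.< C →
  ℚ.∣ a ∣ ℚ.≤ B → ℚ.∣ d ∣ ℚ.≤ C → B ℚ.* δ ≡ ½ ℚ.* ε → C ℚ.* η ≡ ½ ℚ.* ε →
  ℚ.∣ b ℚ.- d ∣ ℚ.< δ → ℚ.∣ a ℚ.- c ∣ ℚ.< η → ℚ.∣ a ℚ.* b ℚ.- c ℚ.* d ∣ ℚ.< ε
product-close {a} {b} {c} {d} {B} {C} {δ} {η} {ε} 0<B 0<C a≤B d≤C Bδ≡ Cη≡ b-d<δ a-c<η = begin-strict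
  ℚ.∣ a ℚ.* b ℚ.- c ℚ.* d ∣                                 ≡⟨ cong ℚ.∣_∣ (*-swap a b c d) ⟩
  ℚ.∣ a ℚ.* (b ℚ.- d) ℚ.+ d ℚ.* (a ℚ.- c) ∣                 ≤⟨ ℚₚ.∣p+q∣≤∣p∣+∣q∣ (a ℚ.* (b ℚ.- d)) _ ⟩
  ℚ.∣ a ℚ.* (b ℚ.- d) ∣ ℚ.+ ℚ.∣ d ℚ.* (a ℚ.- c) ∣           <⟨ ℚₚ.+-mono-< (scaled {a} 0<B a≤B b-d<δ) (scaled {d} 0<C d≤C a-c<η) ⟩
  B ℚ.* δ ℚ.+ C ℚ.* η                                       ≡⟨ cong₂ ℚ._+_ Bδ≡ Cη≡ ⟩
  ½ ℚ.* ε ℚ.+ ½ ℚ.* ε                                       ≡⟨ halves ε ⟩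
  ε                                                         ∎
  where open ℚₚ.≤-Reasoning

*-cauchy : ∀ x y ε → 0ℚ ℚ.< ε → ∃[ N ] ∀ m n → N ℕ.≤ m → N ℕ.≤ n →
           ℚ.∣ seq x m ℚ.* seq y m ℚ.- seq x n ℚ.* seq y n ∣ ℚ.< ε
*-cauchy x y ε 0<ε =
  let B , K , 0<B , x≤B = bound x
      C , L , 0<C , y≤C = bound y
      δ , 0<δ , Bδ≡     = quotient B (½ ℚ.* ε) 0<B (½* 0<ε)
      η , 0<η , Cη≡     = quotient C (½ ℚ.* ε) 0<C (½* 0<ε)
      M , y-close       = cauchy y δ 0<δ
      N , x-close       = cauchy x η 0<η
  in (K ℕ.⊔ L) ℕ.⊔ (M ℕ.⊔ N) , λ m n p q →
     let p₁ = ℕₚ.m⊔n≤o⇒m≤o (K ℕ.⊔ L) (M ℕ.⊔ N) p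
         p₂ = ℕₚ.m⊔n≤o⇒n≤o (K ℕ.⊔ L) (M ℕ.⊔ N) p
         q₁ = ℕₚ.m⊔n≤o⇒m≤o (K ℕ.⊔ L) (M ℕ.⊔ N) q
         q₂ = ℕₚ.m⊔n≤o⇒n≤o (K ℕ.⊔ L) (M ℕ.⊔ N) q
     in product-close {seq x m} {seq y m} {seq x n} {seq y n} {B} {C} {δ} {η} {ε} 0<B 0<C
          (x≤B m (ℕₚ.m⊔n≤o⇒m≤o K L p₁)) (y≤C n (ℕₚ.m⊔n≤o⇒n≤o K L q₁)) Bδ≡ Cη≡
          (y-close m n (ℕₚ.m⊔n≤o⇒m≤o M N p₂) (ℕₚ.m⊔n≤o⇒m≤o M N q₂))
          (x-close m n (ℕₚ.m⊔n≤o⇒n≤o M N p₂) (ℕₚ.m⊔n≤o⇒n≤o M N q₂))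

_*_ : ℝ → ℝ → ℝ
seq    (x * y) n = seq x n ℚ.* seq y n
cauchy (x * y)   = *-cauchy x y

record ℂ : Set where
  constructor _+i_
  field
    re im : ℝ
open ℂ public

infix 4 _≈ᶜ_
_≈ᶜ_ : ℂ → ℂ → Set
z ≈ᶜ w = re z ≈ re w × im z ≈ im w

fromℝ : ℝ → ℂ
fromℝ x = x +i 0ℝ

0ᶜ : ℂ
0ᶜ = fromℝ 0ℝ

infixl 6 _+ᶜ_
infixl 7 _*ᶜ_

_+ᶜ_ : ℂ → ℂ → ℂ
z +ᶜ w = (re z + re w) +i (im z + im w)

_*ᶜ_ : ℂ → ℂ → ℂ
z *ᶜ w = (re z * re w - im z * im w) +i (re z * im w + im z * re w)

∣_∣² : ℂ → ℝ
∣ z ∣² = re z * re z + im z * im z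

sumᶜ : ∀ {n} → Vector ℂ n → ℂ
sumᶜ = foldr _+ᶜ_ 0ᶜ

Matrix : ℕ → Set
Matrix n = Fin n → Fin n → ℝ

IsEigenvalue : ∀ {n} → Matrix n → ℂ → Set
IsEigenvalue {n} A z = Σ (Vector ℂ n) λ x →
  ¬ (∀ i → x i ≈ᶜ 0ᶜ) ×
  (∀ i → sumᶜ (λ j → fromℝ (A i j) *ᶜ x j) ≈ᶜ z *ᶜ x i)

-- ρ is the maximum of ∣z∣ over the complex eigenvalues z; the moduli are
-- compared through their squares, which is harmless because 0 ≤ ρ.
record IsSpectralRadius {n} (A : Matrix n) (ρ : ℝ) : Set where
  field
    nonneg   : 0ℝ ≤ ρ
    attained : ∃[ z ] IsEigenvalue A z × ∣ z ∣² ≈ ρ * ρ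
    maximal  : ∀ z → IsEigenvalue A z → ∣ z ∣² ≤ ρ * ρ

-- Injectivity of edge makes the edges a set rather than a multiset.
record Hypergraph : Set where
  field
    order          : ℕ
    size           : ℕ
    edge           : Fin size → Subset order
    edge-injective : Injective _≡_ _≡_ edge
    edge-nonempty  : ∀ e → Nonempty (edge e)
open Hypergraph public

infix 4 _≅_
record _≅_ (G H : Hypergraph) : Set where
  field
    onVertices : Fin (order G) ↔ Fin (order H)
    onEdges    : Fin (size G) ↔ Fin (size H)
    incidence  : ∀ v e → v ∈ edge G e ⇔ Inverse.to onVertices v ∈ edge H (Inverse.to onEdges e)

Uniform : ℕ → Hypergraph → Set
Uniform m H = ∀ e → ∣ edge H e ∣ ≡ m

Linear : Hypergraph → Set
Linear H = ∀ e f → e ≢ f → ∣ edge H e ∩ edge H f ∣ ℕ.≤ 1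

InCommonEdge : (H : Hypergraph) → Fin (order H) → Fin (order H) → Set
InCommonEdge H u v = ∃[ e ] u ∈ edge H e × v ∈ edge H e

inCommonEdge? : ∀ H u v → Dec (InCommonEdge H u v)
inCommonEdge? H u v = any? λ e → (u ∈? edge H e) ×-dec (v ∈? edge H e)

Connected : Hypergraph → Set
Connected H = ∀ u v → Star (InCommonEdge H) u v

pred-nonZero : ∀ m → .{{NonTrivial m}} → NonZero (m ℕ.∸ 1)
pred-nonZero (suc (suc m)) = _

adjacency : ∀ m → .{{NonTrivial m}} → (H : Hypergraph) → Matrix (order H)
adjacency m H i j =
  if does (¬? (i ≟ᶠ j) ×-dec inCommonEdge? H i j)
  then fromℚ ((+ 1 ℚ./ (m ℕ.∸ 1)) {{pred-nonZero m}})
  else 0ℝ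

next : ∀ {l} → Fin (suc l) → Fin (suc l)
next {l} i = suc (toℕ i) mod suc l

-- A loose cycle, of length 3 + p, is identified with its set of edges, so that
-- rotations and the reversal of v₁e₁v₂e₂…v₁ are the same cycle.
record IsLooseCycle (H : Hypergraph) (C : Subset (size H)) : Set where
  field
    p          : ℕ
    core       : Fin (3 ℕ.+ p) → Fin (order H)
    cycleEdge  : Fin (3 ℕ.+ p) → Fin (size H)
    edges      : ∀ e → e ∈ C ⇔ (∃[ i ] cycleEdge i ≡ e)
    core-inj   : Injective _≡_ _≡_ core
    edge-inj   : Injective _≡_ _≡_ cycleEdge
    consecutive : ∀ i → edge H (cycleEdge i) ∩ edge H (cycleEdge (next i)) ≡ ⁅ core (next i) ⁆
    disjoint   : ∀ i j → i ≢ j → j ≢ next i → i ≢ next j →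
                 Empty (edge H (cycleEdge i) ∩ edge H (cycleEdge j))

Bicyclic : Hypergraph → Set
Bicyclic H = ∃[ C ] ∃[ D ] C ≢ D × IsLooseCycle H C × IsLooseCycle H D ×
             (∀ E → IsLooseCycle H E → E ≡ C ⊎ E ≡ D)

-- block i is the i-th of k consecutive runs of q elements.
block : ∀ {k q} → Fin k → Subset (k ℕ.* q)
block {k} i = concat (replicate k ⊥ [ i ]≔ ⊤)

inˡ : ∀ {a b} {p : Subset a} {q : Subset b} → Nonempty p → Nonempty (p ++ q)
inˡ (_ , v∈p) = _ , go v∈p
  where
  go : ∀ {a b} {p : Subset a} {q : Subset b} {v} → v ∈ p → (v ↑ˡ b) ∈ (p ++ q)
  go here        = here
  go (there v∈p) = there (go v∈p)

block≢⊥ : ∀ {k q} → .{{NonZero q}} → (i : Fin k) → block {k} {q} i ≢ ⊥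
block≢⊥ {suc k} {suc q} zero    ()
block≢⊥ {suc k} {suc q} (suc i) eq =
  block≢⊥ {k} {suc q} i (++-injectiveʳ (⊥ {suc q}) ⊥ (trans eq (⊥-++ (suc q) _)))
  where
  ⊥-++ : ∀ a b → ⊥ {a ℕ.+ b} ≡ ⊥ {a} ++ ⊥ {b}
  ⊥-++ zero    b = refl
  ⊥-++ (suc a) b = cong (outside ∷_) (⊥-++ a b)

block-injective : ∀ {k q} → .{{NonZero q}} → Injective _≡_ _≡_ (block {k} {q})
block-injective {suc k} {suc q} {zero}  {zero}  eq = refl
block-injective {suc k} {suc q} {zero}  {suc j} ()
block-injective {suc k} {suc q} {suc i} {zero}  ()
block-injective {suc k} {suc q} {suc i} {suc j} eq =
  cong suc (block-injective {k} {suc q} (++-injectiveʳ (⊥ {suc q}) ⊥ eq))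

power : ℕ → Hypergraph → Hypergraph
power m G = record
  { order          = order G ℕ.+ size G ℕ.* (m ℕ.∸ 2)
  ; size           = size G
  ; edge           = λ e → edge G e ++ block e
  ; edge-injective = λ {e} {f} eq → edge-injective G (++-injectiveˡ (edge G e) (edge G f) eq)
  ; edge-nonempty  = λ e → inˡ (edge-nonempty G e)
  }

-- A graph is a 2-uniform hypergraph.
IsPowerHypergraph : ℕ → Hypergraph → Set
IsPowerHypergraph m H = ∃[ G ] Uniform 2 G × (H ≅ power m G)

attachPendant : ∀ m → .{{NonTrivial m}} → (H : Hypergraph) → Fin (order H) → ℕ → Hypergraph
attachPendant m H v l = record
  { order          = order H ℕ.+ l ℕ.* (m ℕ.∸ 1)
  ; size           = size H ℕ.+ l
  ; edge           = λ e → newEdge (splitAt (size H) e)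
  ; edge-injective = λ {e} {f} eq → splitAt-inj e f (newEdge-inj _ _ eq)
  ; edge-nonempty  = λ e → newEdge-nonempty (splitAt (size H) e)
  }
  where
  instance
    m-1≢0 : NonZero (m ℕ.∸ 1)
    m-1≢0 = pred-nonZero m
  newEdge : Fin (size H) ⊎ Fin l → Subset (order H ℕ.+ l ℕ.* (m ℕ.∸ 1))
  newEdge (inj₁ e) = edge H e ++ ⊥
  newEdge (inj₂ i) = ⁅ v ⁆ ++ block i
  newEdge-inj : ∀ e f → newEdge e ≡ newEdge f → e ≡ f
  newEdge-inj (inj₁ e) (inj₁ f) eq = cong inj₁ (edge-injective H (++-injectiveˡ (edge H e) (edge H f) eq))
  newEdge-inj (inj₁ e) (inj₂ j) eq = ⊥-elim (block≢⊥ j (sym (++-injectiveʳ (edge H e) ⁅ v ⁆ eq)))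
  newEdge-inj (inj₂ i) (inj₁ f) eq = ⊥-elim (block≢⊥ i (++-injectiveʳ ⁅ v ⁆ (edge H f) eq))
  newEdge-inj (inj₂ i) (inj₂ j) eq = cong inj₂ (block-injective (++-injectiveʳ ⁅ v ⁆ ⁅ v ⁆ eq))
  newEdge-nonempty : ∀ e → Nonempty (newEdge e)
  newEdge-nonempty (inj₁ e) = inˡ (edge-nonempty H e)
  newEdge-nonempty (inj₂ i) = inˡ (v , x∈⁅x⁆ v)
  splitAt-inj : ∀ e f → splitAt (size H) e ≡ splitAt (size H) f → e ≡ f
  splitAt-inj e f eq = trans (sym (join-splitAt (size H) l e))
    (trans (cong (join (size H) l) eq) (join-splitAt (size H) l f))

bowtieEdge : Fin 6 → Subset 5
bowtieEdge 0F = ⁅ 0F ⁆ ∪ ⁅ 1F ⁆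
bowtieEdge 1F = ⁅ 1F ⁆ ∪ ⁅ 2F ⁆
bowtieEdge 2F = ⁅ 2F ⁆ ∪ ⁅ 0F ⁆
bowtieEdge 3F = ⁅ 0F ⁆ ∪ ⁅ 3F ⁆
bowtieEdge 4F = ⁅ 3F ⁆ ∪ ⁅ 4F ⁆
bowtieEdge 5F = ⁅ 4F ⁆ ∪ ⁅ 0F ⁆

bowtieEdge-injective : ∀ e f → bowtieEdge e ≡ bowtieEdge f → e ≡ f
bowtieEdge-injective = from-yes (all? λ e → all? λ f →
  ≡-dec _≟ᵇ_ (bowtieEdge e) (bowtieEdge f) →-dec (e ≟ᶠ f))

bowtie : Hypergraph
bowtie = record
  { order          = 5
  ; size           = 6
  ; edge           = bowtieEdge
  ; edge-injective = λ {e} {f} → bowtieEdge-injective e f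
  ; edge-nonempty  = from-yes (all? λ e → nonempty? (bowtieEdge e))
  }

-- power m bowtie consists of two loose cycles of length 3, with core vertices
-- 0, 1, 2 and 0, 3, 4, sharing only the core vertex 0.
BC : ∀ m → .{{NonTrivial m}} → ℕ → Hypergraph
BC m l₁ = attachPendant m (power m bowtie) 0F l₁

B₂C : ∀ m → .{{NonTrivial m}} → ℕ → ℕ → Hypergraph
B₂C m l₁ l₂ = attachPendant m (BC m l₁) 1F l₂

{-# OPTIONS --safe #-}
module Submission where

-- Only quadratic forms at one fixed vector are compared. Let y > 0 be an approximate Perron
-- vector of H, and root the underlying graph at the vertex where y is largest. In a
-- breadth-first tree exactly two edges, the chords, are not tree edges; they are disjoint and
-- avoid the root, since otherwise there would be a third cycle. Moving the upper end of a tree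
-- edge to the root does not decrease the form Σ Aᵢⱼyᵢyⱼ, and doing this for all vertices but one,
-- followed by one more such exchange, leads to a copy of B₂C(k − 7, 1), unless H is B₂C(k − 6, 0).
-- If anything was moved, some coordinate of A y increases by a definite amount, so that the
-- largest Rayleigh quotient of B₂C(k − 7, 1) exceeds that of H by a constant that does not depend on
-- the quality of the approximation. To pass to spectral radii, Rayleigh quotients are lower
-- bounds because iterating I + A, which contracts ratios of positive vectors, converges to an
-- exact eigenvector, and the Collatz–Wielandt quotients of y are upper bounds.

-- Choosing the root and the direction of each move means comparing coordinates, and Cauchy reals
-- cannot be compared effectively. The combinatorial argument is therefore run on one rational stage
-- of a sequence that converges to the Perron vector. Each rewiring must instead exhibit a
-- coordinate of the product that grows by at least one entry of `y` times the matrix weight.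
-- Raising `y` slightly at that coordinate gives the strict increase, of a size computed before the
-- stage is chosen.
--
-- The approximate vector need not be constant on the vertices added to an edge, nor equal on
-- similar edges. In the graph, edge e therefore carries a load N e, the sum of `y` over its added
-- vertices, and rewiring changes the ends of e but not its label or load. Two edges of the same
-- shape are not interchangeable: this is why the edges of H and of its rewirings are numbered
-- alike, by the vertices of a tree, and why some moves exchange two labels.

open import Data.Empty using (⊥; ⊥-elim)
open import Data.Fin.Base using (Fin; zero; suc; _↑ˡ_; _↑ʳ_; combine; inject₁; fromℕ; toℕ; fromℕ<)
open import Data.Fin.Patterns using (0F; 1F; 2F; 3F; 4F; 5F)
open import Data.Fin.Properties using (+↔⊎; *↔×; suc-injective; splitAt-↑ˡ; splitAt-↑ʳ; any?; all?; injective⇒≤; toℕ-injective; toℕ-fromℕ<; toℕ-inject₁; toℕ-fromℕ; toℕ<n) renaming (_≟_ to _≟ᶠ_)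
open import Data.Nat.Base as ℕ using (ℕ; zero; suc; z≤n; s≤s; NonTrivial; _∸_) renaming (_≥_ to _≥ⁿ_; _*_ to _*ⁿ_)
import Data.Nat.Properties as ℕₚ
open import Data.Product using (∃-syntax; _×_; _,_; proj₁; proj₂; Σ)
open import Data.Sum.Base as Sum using (_⊎_; inj₁; inj₂; [_,_]′)
open import Function.Bundles using (_↔_; _⇔_; Inverse; Equivalence; mk⇔; mk↔ₛ′)
open import Function.Construct.Composition using (_↔-∘_; _⇔-∘_)
open import Function.Construct.Identity using (↔-id)
open import Function.Construct.Symmetry using (↔-sym; ⇔-sym)
open import Function.Definitions using (Injective)
open import Relation.Binary.PropositionalEquality
open import Relation.Nullary using (¬_; does; Dec; yes; no)
open import Relation.Nullary.Decidable using (_×-dec_; ¬?; dec-true; dec-false; decidable-stable; _⊎-dec_)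

-- Order, powers, limits and finite sums of rationals

module RationalArithmetic where

  open import Algebra.Bundles using (CommutativeRing)
  import Algebra.Properties.Semiring.Sum as SemiringSum
  open import Data.Fin.Permutation using (Permutation; _⟨$⟩ʳ_)
  import Data.Integer.Base as ℤ
  import Data.Integer.Properties as ℤₚ
  open import Data.Rational.Base
  open import Data.Rational.Properties
  import Data.Rational.Unnormalised.Base as ℚᵘ
  import Data.Rational.Unnormalised.Properties as ℚᵘₚ
  open import Data.Rational.Solver using (module +-*-Solver)

  module S = SemiringSum (CommutativeRing.semiring +-*-commutativeRing)

  open +-*-Solver

  private variable
    n k : ℕ
    a b c d p q : ℚ

  0≤1 : 0ℚ ≤ 1ℚ
  0≤1 = nonNegative⁻¹ 1ℚ

  0<1 : 0ℚ < 1ℚ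
  0<1 = positive⁻¹ 1ℚ

  ≤⇒0≤- : a ≤ b → 0ℚ ≤ b - a
  ≤⇒0≤- {a} {b} a≤b = subst (_≤ b - a) (+-inverseʳ a) (+-monoˡ-≤ (- a) a≤b)

  0≤-⇒≤ : 0ℚ ≤ b - a → a ≤ b
  0≤-⇒≤ {b} {a} h = subst₂ _≤_ (+-identityˡ a) (solve 2 (λ b a → b :- a :+ a := b) refl b a) (+-monoˡ-≤ a h)

  <⇒0<- : a < b → 0ℚ < b - a
  <⇒0<- {a} {b} a<b = subst (_< b - a) (+-inverseʳ a) (+-monoˡ-< (- a) a<b)

  0<-⇒< : 0ℚ < b - a → a < b
  0<-⇒< {b} {a} h = subst₂ _<_ (+-identityˡ a) (solve 2 (λ b a → b :- a :+ a := b) refl b a) (+-monoˡ-< a h)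

  <⇒≱ : a < b → ¬ (b ≤ a)
  <⇒≱ a<b b≤a = <-irrefl refl (<-≤-trans a<b b≤a)

  +-nonneg : 0ℚ ≤ a → 0ℚ ≤ b → 0ℚ ≤ a + b
  +-nonneg = +-mono-≤

  +-pos-nonneg : 0ℚ < a → 0ℚ ≤ b → 0ℚ < a + b
  +-pos-nonneg = +-mono-<-≤

  +-pos : 0ℚ < a → 0ℚ < b → 0ℚ < a + b
  +-pos = +-mono-<

  *-monoˡ : 0ℚ ≤ c → a ≤ b → c * a ≤ c * b
  *-monoˡ {c} 0≤c = *-monoˡ-≤-nonNeg c {{nonNegative 0≤c}}

  *-monoʳ : 0ℚ ≤ c → a ≤ b → a * c ≤ b * c
  *-monoʳ {c} 0≤c = *-monoʳ-≤-nonNeg c {{nonNegative 0≤c}}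

  *-nonneg : 0ℚ ≤ a → 0ℚ ≤ b → 0ℚ ≤ a * b
  *-nonneg {a} {b} 0≤a 0≤b = subst (_≤ a * b) (*-zeroʳ a) (*-monoˡ 0≤a 0≤b)

  *-mono : 0ℚ ≤ a → a ≤ b → 0ℚ ≤ c → c ≤ d → a * c ≤ b * d
  *-mono 0≤a a≤b 0≤c c≤d = ≤-trans (*-monoʳ 0≤c a≤b) (*-monoˡ (≤-trans 0≤a a≤b) c≤d)

  *-pos : 0ℚ < a → 0ℚ < b → 0ℚ < a * b
  *-pos {a} {b} 0<a 0<b = subst (_< a * b) (*-zeroʳ a) (*-monoʳ-<-pos a {{positive 0<a}} 0<b)

  sq-nonneg : ∀ a → 0ℚ ≤ a * a
  sq-nonneg a with ≤-total 0ℚ a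
  ... | inj₁ 0≤a = *-nonneg 0≤a 0≤a
  ... | inj₂ a≤0 = subst (0ℚ ≤_) (solve 1 (λ a → (:- a) :* (:- a) := a :* a) refl a)
    (*-nonneg (neg-antimono-≤ a≤0) (neg-antimono-≤ a≤0))

  *-cancelˡ : 0ℚ < c → c * a ≤ c * b → a ≤ b
  *-cancelˡ {c} 0<c = *-cancelˡ-≤-pos c {{positive 0<c}}

  abstract
    inverse : 0ℚ < a → ∃[ b ] 0ℚ < b × a * b ≡ 1ℚ
    inverse {a} 0<a = 1/ a , positive⁻¹ (1/ a) {{1/pos⇒pos a}} , *-inverseʳ a
      where instance
        a>0 : Positive a
        a>0 = positive 0<a
        a≢0 : NonZero a
        a≢0 = pos⇒nonZero a

  ∣∣≤ : a ≤ b → - b ≤ a → ∣ a ∣ ≤ b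
  ∣∣≤ {a} {b} a≤b -b≤a with ∣p∣≡p∨∣p∣≡-p a
  ... | inj₁ eq = subst (_≤ b) (sym eq) a≤b
  ... | inj₂ eq = subst₂ _≤_ (sym eq) (solve 1 (λ b → :- (:- b) := b) refl b) (neg-antimono-≤ -b≤a)

  ≤∣∣ : ∀ a → a ≤ ∣ a ∣
  ≤∣∣ a with ≤-total 0ℚ a
  ... | inj₁ 0≤a = ≤-reflexive (sym (0≤p⇒∣p∣≡p 0≤a))
  ... | inj₂ a≤0 = ≤-trans a≤0 (0≤∣p∣ a)

  ∣-∣-sym : ∀ a b → ∣ a - b ∣ ≡ ∣ b - a ∣
  ∣-∣-sym a b = trans (cong ∣_∣ (solve 2 (λ a b → a :- b := :- (b :- a)) refl a b)) (∣-p∣≡∣p∣ (b - a))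

  ∣-∣<⇒< : ∣ a - b ∣ < c → a < b + c
  ∣-∣<⇒< {a} {b} {c} h = subst (_< b + c) (solve 2 (λ a b → b :+ (a :- b) := a) refl a b)
    (+-monoʳ-< b (≤-<-trans (≤∣∣ (a - b)) h))

  -- By recursion, so that `ι (suc n)` unfolds to `1ℚ + ι n` and the ring solver sees a polynomial.
  ι : ℕ → ℚ
  ι zero    = 0ℚ
  ι (suc n) = 1ℚ + ι n

  ι-nonneg : ∀ n → 0ℚ ≤ ι n
  ι-nonneg zero    = ≤-refl
  ι-nonneg (suc n) = +-nonneg 0≤1 (ι-nonneg n)

  ι-mono : ∀ {m n} → m ℕ.≤ n → ι m ≤ ι n
  ι-mono {n = n} z≤n = ι-nonneg n
  ι-mono (s≤s m≤n)   = +-monoʳ-≤ 1ℚ (ι-mono m≤n)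

  ι-toℚᵘ : ∀ n → toℚᵘ (ι n) ℚᵘ.≃ ℚᵘ.mkℚᵘ (ℤ.+ n) 0
  ι-toℚᵘ zero    = ℚᵘₚ.≃-refl
  ι-toℚᵘ (suc n) = ℚᵘₚ.≃-trans (toℚᵘ-homo-+ 1ℚ (ι n))
    (ℚᵘₚ.≃-trans (ℚᵘₚ.+-congʳ (toℚᵘ 1ℚ) (ι-toℚᵘ n))
      (ℚᵘ.*≡* (cong (λ z → z ℤ.* ℤ.+ 1) (cong (λ z → ℤ.+ 1 ℤ.+ z) (ℤₚ.*-identityʳ (ℤ.+ n))))))

  abstract
    archimedean : ∀ p → ∃[ N ] p ≤ ι N
    -- The absolute value of the numerator suffices, since the denominator is at least 1.
    archimedean (mkℚ i d _) = ℤ.∣ i ∣ , toℚᵘ-cancel-≤ (ℚᵘₚ.≤-respʳ-≃ (ℚᵘₚ.≃-sym (ι-toℚᵘ ℤ.∣ i ∣)) (ℚᵘ.*≤* (abs-≤ i d)))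
      where
      abs-≤ : ∀ i d → i ℤ.* ℤ.+ 1 ℤ.≤ ℤ.+ ℤ.∣ i ∣ ℤ.* ℤ.+ suc d
      abs-≤ (ℤ.+ n) d = subst₂ ℤ._≤_ (ℤₚ.pos-* n 1) (ℤₚ.pos-* n (suc d))
        (ℤ.+≤+ (ℕₚ.*-monoʳ-≤ n (s≤s z≤n)))
      abs-≤ ℤ.-[1+ n ] d = ℤ.-≤+

    exceed : ∀ C → 0ℚ < p → ∃[ N ] ∀ s → N ℕ.≤ s → C < ι s * p
    exceed {p} C 0<p with inverse 0<p
    ... | r , 0<r , pr≡1 with archimedean (C * r)
    ...   | N , Cr≤N = suc N , λ s N<s → begin-strict
      C              ≡⟨ +-identityˡ C ⟨
      0ℚ + C         <⟨ +-monoˡ-< C 0<p ⟩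
      p + C          ≡⟨ cong (p +_) (*-identityʳ C) ⟨
      p + C * 1ℚ     ≡⟨ cong (λ z → p + C * z) pr≡1 ⟨
      p + C * (p * r) ≡⟨ solve 3 (λ C p r → p :+ C :* (p :* r) := p :+ (C :* r) :* p) refl C p r ⟩
      p + C * r * p  ≤⟨ +-monoʳ-≤ p (*-monoʳ (<⇒≤ 0<p) Cr≤N) ⟩
      p + ι N * p    ≡⟨ solve 2 (λ y p → p :+ y :* p := (con 1ℚ :+ y) :* p) refl (ι N) p ⟩
      ι (suc N) * p  ≤⟨ *-monoʳ (<⇒≤ 0<p) (ι-mono N<s) ⟩
      ι s * p        ∎
      where open ≤-Reasoning

  infixr 8 _^_
  _^_ : ℚ → ℕ → ℚ
  a ^ zero    = 1ℚ
  a ^ (suc s) = a * a ^ s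

  ^-nonneg : 0ℚ ≤ a → ∀ s → 0ℚ ≤ a ^ s
  ^-nonneg 0≤a zero    = 0≤1
  ^-nonneg 0≤a (suc s) = *-nonneg 0≤a (^-nonneg 0≤a s)

  ^-pos : 0ℚ < a → ∀ s → 0ℚ < a ^ s
  ^-pos 0<a zero    = 0<1
  ^-pos 0<a (suc s) = *-pos 0<a (^-pos 0<a s)

  ^-≤1 : 0ℚ ≤ a → a ≤ 1ℚ → ∀ s → a ^ s ≤ 1ℚ
  ^-≤1 0≤a a≤1 zero    = ≤-refl
  ^-≤1 0≤a a≤1 (suc s) = *-mono 0≤a a≤1 (^-nonneg 0≤a s) (^-≤1 0≤a a≤1 s)

  -- (1 − 1/L)ˢ (L + s) ≤ L, hence (1 − 1/L)ˢ tends to 0.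
  bernoulli : ∀ {L η} → 0ℚ ≤ η → 0ℚ ≤ 1ℚ - η → η * L ≡ 1ℚ → ∀ s →
              (1ℚ - η) ^ s * (L + ι s) ≤ L
  bernoulli {L} {η} 0≤η 0≤θ ηL zero    = ≤-reflexive (solve 1 (λ L → con 1ℚ :* (L :+ con 0ℚ) := L) refl L)
  bernoulli {L} {η} 0≤η 0≤θ ηL (suc s) = ≤-trans
    (subst (_≤ (1ℚ - η) ^ s * (L + ι s))
      (solve 3 (λ θ t u → t :* (θ :* u) := θ :* t :* u) refl (1ℚ - η) ((1ℚ - η) ^ s) (L + ι (suc s)))
      (*-monoˡ (^-nonneg 0≤θ s)
        (0≤-⇒≤ (subst (0ℚ ≤_) eq (*-nonneg 0≤η (ι-nonneg (suc s)))))))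
    (bernoulli 0≤η 0≤θ ηL s)
    where
    eq : η * ι (suc s) ≡ (L + ι s) - (1ℚ - η) * (L + ι (suc s))
    eq = trans (solve 3 (λ η L t → η :* (con 1ℚ :+ t) := (L :+ t) :- (con 1ℚ :- η) :* (L :+ (con 1ℚ :+ t)) :+ (con 1ℚ :- η :* L)) refl η L (ι s))
      (trans (cong (λ z → (L + ι s) - (1ℚ - η) * (L + ι (suc s)) + (1ℚ - z)) ηL)
        (solve 1 (λ u → u :+ (con 1ℚ :- con 1ℚ) := u) refl _))

  -- `bernoulli` with `L + ι s` weakened to `ι s`: the powers decay like 1 / s, which the
  -- Archimedean property turns into a limit without logarithms.
  decay-bound : ∀ {L η} → 0ℚ < L → 0ℚ ≤ η → 0ℚ ≤ 1ℚ - η → η * L ≡ 1ℚ → 0ℚ ≤ c → ∀ s →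
                ι s * ((1ℚ - η) ^ s * c) ≤ L * c
  decay-bound {c} {L} {η} 0<L 0≤η 0≤θ ηL 0≤c s = begin
    ι s * (t * c)      ≡⟨ solve 3 (λ i t c → i :* (t :* c) := (t :* i) :* c) refl (ι s) t c ⟩
    t * ι s * c        ≤⟨ *-monoʳ 0≤c (*-monoˡ (^-nonneg 0≤θ s) ιs≤) ⟩
    t * (L + ι s) * c  ≤⟨ *-monoʳ 0≤c (bernoulli 0≤η 0≤θ ηL s) ⟩
    L * c              ∎
    where
    open ≤-Reasoning
    t = (1ℚ - η) ^ s
    ιs≤ : ι s ≤ L + ι s
    ιs≤ = subst (_≤ L + ι s) (+-identityˡ (ι s)) (+-monoˡ-≤ (ι s) (<⇒≤ 0<L))

  abstract
    decay : ∀ {L η} → 0ℚ < L → 0ℚ ≤ η → 0ℚ ≤ 1ℚ - η → η * L ≡ 1ℚ → 0ℚ ≤ c → 0ℚ < p →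
            ∃[ N ] ∀ s → N ℕ.≤ s → (1ℚ - η) ^ s * c < p
    decay {c} {p} {L} {η} 0<L 0≤η 0≤θ ηL 0≤c 0<p =
      let N , big = exceed (L * c) 0<p in
      N , λ s N≤s → ≰⇒> λ p≤ → <⇒≱ (big s N≤s)
        (≤-trans (*-monoˡ (ι-nonneg s) p≤) (decay-bound 0<L 0≤η 0≤θ ηL 0≤c s))

  ∑ : (Fin n → ℚ) → ℚ
  ∑ = S.sum

  ∑-cong : {f g : Fin n → ℚ} → (∀ i → f i ≡ g i) → ∑ f ≡ ∑ g
  ∑-cong = S.sum-cong-≗

  ∑-mono : {f g : Fin n → ℚ} → (∀ i → f i ≤ g i) → ∑ f ≤ ∑ g
  ∑-mono {zero}  f≤g = ≤-refl
  ∑-mono {suc n} f≤g = +-mono-≤ (f≤g zero) (∑-mono (λ i → f≤g (suc i)))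

  ∑-zero : ∀ n → ∑ {n} (λ _ → 0ℚ) ≡ 0ℚ
  ∑-zero = S.sum-replicate-zero

  ∑-nonneg : {f : Fin n → ℚ} → (∀ i → 0ℚ ≤ f i) → 0ℚ ≤ ∑ f
  ∑-nonneg {n} {f} 0≤f = subst (_≤ ∑ f) (∑-zero n) (∑-mono 0≤f)

  term≤∑ : {f : Fin n → ℚ} → (∀ i → 0ℚ ≤ f i) → ∀ i → f i ≤ ∑ f
  term≤∑ {f = f} 0≤f zero    = subst (_≤ ∑ f) (+-identityʳ (f zero)) (+-monoʳ-≤ (f zero) (∑-nonneg (λ i → 0≤f (suc i))))
  term≤∑ {f = f} 0≤f (suc i) = subst (_≤ ∑ f) (+-identityˡ (f (suc i))) (+-mono-≤ (0≤f zero) (term≤∑ (λ i → 0≤f (suc i)) i))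

  ∑-+ : (f g : Fin n → ℚ) → ∑ (λ i → f i + g i) ≡ ∑ f + ∑ g
  ∑-+ = S.∑-distrib-+

  *-∑ : ∀ c (f : Fin n → ℚ) → c * ∑ f ≡ ∑ (λ i → c * f i)
  *-∑ = S.*-distribˡ-sum

  ∑-* : ∀ (f : Fin n → ℚ) c → ∑ f * c ≡ ∑ (λ i → f i * c)
  ∑-* f c = S.*-distribʳ-sum c f

  ∑-- : (f g : Fin n → ℚ) → ∑ (λ i → f i - g i) ≡ ∑ f - ∑ g
  ∑-- f g = trans (∑-+ f (λ i → - g i)) (cong (λ z → ∑ f + z) (trans
    (∑-cong (λ i → solve 1 (λ x → :- x := con (- 1ℚ) :* x) refl (g i)))
    (trans (sym (*-∑ (- 1ℚ) g)) (solve 1 (λ x → con (- 1ℚ) :* x := :- x) refl (∑ g)))))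

  ∑-swap : (f : Fin n → Fin k → ℚ) → ∑ (λ i → ∑ (f i)) ≡ ∑ (λ j → ∑ (λ i → f i j))
  ∑-swap = S.∑-comm

  ∑-permute : (f : Fin k → ℚ) (π : Permutation n k) → ∑ f ≡ ∑ (λ i → f (π ⟨$⟩ʳ i))
  ∑-permute = S.sum-permute

  ∑-const : ∀ n c → ∑ {n} (λ _ → c) ≡ ι n * c
  ∑-const zero    c = sym (*-zeroˡ c)
  ∑-const (suc n) c = trans (cong (c +_) (∑-const n c)) (solve 2 (λ c x → c :+ x :* c := (con 1ℚ :+ x) :* c) refl c (ι n))

  ∑-++ : ∀ m (f : Fin (m ℕ.+ n) → ℚ) →
         ∑ f ≡ ∑ (λ i → f (i ↑ˡ n)) + ∑ (λ j → f (m ↑ʳ j))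
  ∑-++ zero    f = sym (+-identityˡ _)
  ∑-++ (suc m) f = trans (cong (f zero +_) (∑-++ m (λ i → f (suc i)))) (sym (+-assoc (f zero) _ _))

  ∑-combine : ∀ m (f : Fin (m ℕ.* k) → ℚ) →
              ∑ f ≡ ∑ {m} (λ i → ∑ (λ j → f (combine i j)))
  ∑-combine zero            f = refl
  ∑-combine {k = k} (suc m) f = trans (∑-++ k f)
    (cong (∑ (λ j → f (j ↑ˡ (m ℕ.* k))) +_) (∑-combine m (λ j → f (k ↑ʳ j))))

  maximum⁺ : (f : Fin (suc n) → ℚ) → ∃[ i ] ∀ j → f j ≤ f i
  maximum⁺ {zero}  f = zero , λ { zero → ≤-refl }
  maximum⁺ {suc n} f =
    let i , max = maximum⁺ (λ i → f (suc i)) in choose i max (≤-total (f (suc i)) (f zero))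
    where
    choose : ∀ i → (∀ j → f (suc j) ≤ f (suc i)) → f (suc i) ≤ f zero ⊎ f zero ≤ f (suc i) →
             ∃[ i ] ∀ j → f j ≤ f i
    choose i max (inj₁ i≤0) = zero , λ { zero → ≤-refl ; (suc j) → ≤-trans (max j) i≤0 }
    choose i max (inj₂ 0≤i) = suc i , λ { zero → 0≤i ; (suc j) → max j }

  abstract
    maximum : Fin n → (f : Fin n → ℚ) → ∃[ i ] ∀ j → f j ≤ f i
    maximum {suc n} _ f = maximum⁺ f

    minimum : Fin n → (f : Fin n → ℚ) → ∃[ i ] ∀ j → f i ≤ f j
    minimum o f =
      let i , max = maximum o (λ i → - f i)
      in i , λ j → subst₂ _≤_ (neg-involutive (f i)) (neg-involutive (f j)) (neg-antimono-≤ (max j))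
      where
      neg-involutive : ∀ a → - (- a) ≡ a
      neg-involutive = solve 1 (λ a → :- (:- a) := a) refl

    fraction : ∀ {K ε} → 0ℚ ≤ K → 0ℚ < ε → ∃[ δ ] 0ℚ < δ × K * δ < ε
    fraction {K} {ε} 0≤K 0<ε =
      -- The witness is ε / (1 + K); the added 1 covers K = 0 and makes the inequality strict.
      let r , 0<r , eq = inverse (+-pos-nonneg 0<1 0≤K)
          0<εr = *-pos 0<ε 0<r
      in ε * r , 0<εr , 0<-⇒< (subst (0ℚ <_)
           (trans (solve 3 (λ e k r → e :* r := e :* ((con 1ℚ :+ k) :* r) :- k :* (e :* r)) refl ε K r)
             (trans (cong (λ z → ε * z - K * (ε * r)) eq) (cong (_- K * (ε * r)) (*-identityʳ ε)))) 0<εr)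

-- Power iteration and the contraction of positive vectors

module PowerIteration where

  open RationalArithmetic
  open import Data.Rational.Base
  open import Data.Rational.Properties
  open import Data.Rational.Solver using (module +-*-Solver)
  open import Relation.Binary.Construct.Closure.ReflexiveTransitive using (Star; ε; _◅_)
  open +-*-Solver

  Vec : ℕ → Set
  Vec n = Fin n → ℚ

  Mat : ℕ → Set
  Mat n = Fin n → Fin n → ℚ

  infixr 7 _∙_
  _∙_ : ∀ {n} → Mat n → Vec n → Vec n
  (A ∙ v) i = ∑ (λ j → A i j * v j)

  module Iteration {n} (A : Mat n) (0≤A : ∀ i j → 0ℚ ≤ A i j) (A≤1 : ∀ i j → A i j ≤ 1ℚ) where

    -- The identity is added because every power of A may have vanishing entries, as on a bipartite
    -- graph. With it the iterates increase, and every walk of length at most N contributes to step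
    -- N.
    T : Vec n → Vec n
    T v i = v i + (A ∙ v) i

    iter : ℕ → Vec n → Vec n
    iter zero    v = v
    iter (suc N) v = T (iter N v)

    comb : ℚ → ℚ → Vec n → Vec n → Vec n
    comb a b x y i = a * x i + b * y i

    A-comb : ∀ a b x y i → (A ∙ comb a b x y) i ≡ a * (A ∙ x) i + b * (A ∙ y) i
    A-comb a b x y i = begin
      ∑ (λ j → A i j * (a * x j + b * y j))
        ≡⟨ ∑-cong (λ j → solve 5 (λ A a x b y → A :* (a :* x :+ b :* y) := a :* (A :* x) :+ b :* (A :* y)) refl (A i j) a (x j) b (y j)) ⟩
      ∑ (λ j → a * (A i j * x j) + b * (A i j * y j))
        ≡⟨ ∑-+ (λ j → a * (A i j * x j)) (λ j → b * (A i j * y j)) ⟩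
      ∑ (λ j → a * (A i j * x j)) + ∑ (λ j → b * (A i j * y j))
        ≡⟨ cong₂ _+_ (*-∑ a (λ j → A i j * x j)) (*-∑ b (λ j → A i j * y j)) ⟨
      a * (A ∙ x) i + b * (A ∙ y) i ∎
      where open ≡-Reasoning

    A-cong : ∀ {x y} → (∀ i → x i ≡ y i) → ∀ i → (A ∙ x) i ≡ (A ∙ y) i
    A-cong x≡y i = ∑-cong (λ j → cong (A i j *_) (x≡y j))

    iter-cong : ∀ N {x y} → (∀ i → x i ≡ y i) → ∀ i → iter N x i ≡ iter N y i
    iter-cong zero    x≡y i = x≡y i
    iter-cong (suc N) x≡y i = cong₂ _+_ (iter-cong N x≡y i) (A-cong (iter-cong N x≡y) i)

    iter-comb : ∀ N a b x y i → iter N (comb a b x y) i ≡ a * iter N x i + b * iter N y i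
    iter-comb zero    a b x y i = refl
    iter-comb (suc N) a b x y i = begin
      iter N (comb a b x y) i + (A ∙ iter N (comb a b x y)) i
        ≡⟨ cong₂ _+_ (iter-comb N a b x y i) (trans (A-cong (iter-comb N a b x y) i) (A-comb a b (iter N x) (iter N y) i)) ⟩
      (a * iter N x i + b * iter N y i) + (a * (A ∙ iter N x) i + b * (A ∙ iter N y) i)
        ≡⟨ solve 6 (λ a b x y x' y' → (a :* x :+ b :* y) :+ (a :* x' :+ b :* y') := a :* (x :+ x') :+ b :* (y :+ y')) refl
             a b (iter N x i) (iter N y i) ((A ∙ iter N x) i) ((A ∙ iter N y) i) ⟩
      a * iter (suc N) x i + b * iter (suc N) y i ∎
      where open ≡-Reasoning

    -- Iteration is a polynomial in A. A comparison of the iterates of v and of A v thus tells how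
    -- far an iterate of v is from being an eigenvector.
    iter-A : ∀ N v i → iter N (A ∙ v) i ≡ (A ∙ iter N v) i
    iter-A zero    v i = refl
    iter-A (suc N) v i = begin
      iter N (A ∙ v) i + (A ∙ iter N (A ∙ v)) i
        ≡⟨ cong₂ _+_ (iter-A N v i) (A-cong (iter-A N v) i) ⟩
      (A ∙ iter N v) i + (A ∙ (A ∙ iter N v)) i
        ≡⟨ solve 2 (λ x y → x :+ y := con 1ℚ :* x :+ con 1ℚ :* y) refl ((A ∙ iter N v) i) ((A ∙ (A ∙ iter N v)) i) ⟩
      1ℚ * (A ∙ iter N v) i + 1ℚ * (A ∙ (A ∙ iter N v)) i
        ≡⟨ A-comb 1ℚ 1ℚ (iter N v) (A ∙ iter N v) i ⟨
      (A ∙ comb 1ℚ 1ℚ (iter N v) (A ∙ iter N v)) i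
        ≡⟨ A-cong (λ j → cong₂ _+_ (*-identityˡ (iter N v j)) (*-identityˡ ((A ∙ iter N v) j))) i ⟩
      (A ∙ iter (suc N) v) i ∎
      where open ≡-Reasoning

    A-nonneg : ∀ {v} → (∀ i → 0ℚ ≤ v i) → ∀ i → 0ℚ ≤ (A ∙ v) i
    A-nonneg 0≤v i = ∑-nonneg (λ j → *-nonneg (0≤A i j) (0≤v j))

    iter-nonneg : ∀ N {v} → (∀ i → 0ℚ ≤ v i) → ∀ i → 0ℚ ≤ iter N v i
    iter-nonneg zero    0≤v i = 0≤v i
    iter-nonneg (suc N) 0≤v i = +-nonneg (iter-nonneg N 0≤v i) (A-nonneg (iter-nonneg N 0≤v) i)

    iter-grows : ∀ N {v} → (∀ i → 0ℚ ≤ v i) → ∀ i → v i ≤ iter N v i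
    iter-grows zero    0≤v i = ≤-refl
    iter-grows (suc N) {v} 0≤v i = subst (_≤ iter (suc N) v i) (+-identityʳ (v i))
      (+-mono-≤ (iter-grows N 0≤v i) (A-nonneg (iter-nonneg N 0≤v) i))

    T≤∑ : ∀ {v} → (∀ i → 0ℚ ≤ v i) → ∀ i → T v i ≤ (1ℚ + 1ℚ) * ∑ v
    T≤∑ {v} 0≤v i = subst (T v i ≤_) (solve 1 (λ s → s :+ s := (con 1ℚ :+ con 1ℚ) :* s) refl (∑ v))
      (+-mono-≤ (term≤∑ 0≤v i) (∑-mono (λ j → subst (A i j * v j ≤_) (*-identityˡ (v j)) (*-monoʳ (0≤v j) (A≤1 i j)))))

    iter≤∑ : ∀ N → ∃[ κ ] 0ℚ ≤ κ × (∀ {v} → (∀ i → 0ℚ ≤ v i) → ∀ i → iter N v i ≤ κ * ∑ v)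
    iter≤∑ zero    = 1ℚ , 0≤1 , λ {v} 0≤v i → subst (v i ≤_) (sym (*-identityˡ (∑ v))) (term≤∑ 0≤v i)
    iter≤∑ (suc N) with iter≤∑ N
    ... | κ , 0≤κ , le = (1ℚ + 1ℚ) * (ι n * κ) , *-nonneg (+-nonneg 0≤1 0≤1) (*-nonneg (ι-nonneg n) 0≤κ) , λ {v} 0≤v i → begin
        T (iter N v) i                  ≤⟨ T≤∑ (iter-nonneg N 0≤v) i ⟩
        (1ℚ + 1ℚ) * ∑ (iter N v)        ≤⟨ *-monoˡ (+-nonneg 0≤1 0≤1) (∑-mono (le 0≤v)) ⟩
        (1ℚ + 1ℚ) * ∑ {n} (λ _ → κ * ∑ v) ≡⟨ cong ((1ℚ + 1ℚ) *_) (∑-const n (κ * ∑ v)) ⟩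
        (1ℚ + 1ℚ) * (ι n * (κ * ∑ v))   ≡⟨ solve 4 (λ t i κ s → t :* (i :* (κ :* s)) := t :* (i :* κ) :* s) refl (1ℚ + 1ℚ) (ι n) κ (∑ v) ⟩
        (1ℚ + 1ℚ) * (ι n * κ) * ∑ v     ∎
      where open ≤-Reasoning

    module _ {c} (0≤c : 0ℚ ≤ c) (c≤1 : c ≤ 1ℚ) where

      Adjacent : Fin n → Fin n → Set
      Adjacent i j = c ≤ A i j

      length : ∀ {i j} → Star Adjacent i j → ℕ
      length ε       = 0
      length (_ ◅ p) = suc (length p)

      -- A walk shorter than N is padded by waiting, which the identity in `T` permits. Each step
      -- taken costs a factor c, and c ≤ 1 covers the waiting.
      reach : ∀ {i j} (p : Star Adjacent i j) N → length p ℕ.≤ N →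
              ∀ {v} → (∀ i → 0ℚ ≤ v i) → c ^ N * v j ≤ iter N v i
      reach {i} ε N _ {v} 0≤v = ≤-trans
        (subst (c ^ N * v i ≤_) (*-identityˡ (v i)) (*-monoʳ (0≤v i) (^-≤1 0≤c c≤1 N)))
        (iter-grows N 0≤v i)
      reach {i} {j} (_◅_ {j = k} c≤A p) (suc N) (s≤s le) {v} 0≤v = begin
        c * c ^ N * v j            ≡⟨ *-assoc c (c ^ N) (v j) ⟩
        c * (c ^ N * v j)          ≤⟨ *-mono 0≤c c≤A (*-nonneg (^-nonneg 0≤c N) (0≤v j)) (reach p N le 0≤v) ⟩
        A i k * iter N v k         ≤⟨ term≤∑ (λ l → *-nonneg (0≤A i l) (iter-nonneg N 0≤v l)) k ⟩
        (A ∙ iter N v) i           ≡⟨ +-identityˡ ((A ∙ iter N v) i) ⟨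
        0ℚ + (A ∙ iter N v) i      ≤⟨ +-monoˡ-≤ ((A ∙ iter N v) i) (iter-nonneg N 0≤v i) ⟩
        iter (suc N) v i           ∎
        where open ≤-Reasoning

  -- A Perron vector in rational terms: a Cauchy sequence of positive vectors equal to 1 at o, with
  -- ratios of coordinates bounded uniformly by K. In `eigen` the number α depends on the stage; α
  -- and α + ε enclose all quotients of A w by w.
  record PerronVectors {n} (A : Mat n) (o : Fin n) : Set where
    field
      w       : ℕ → Vec n
      K       : ℚ
      w-pos   : ∀ s i → 0ℚ < w s i
      w-first : ∀ s → w s o ≡ 1ℚ
      w-ratio : ∀ s i j → w s i ≤ K * w s j
      eigen   : ∀ {ε} → 0ℚ < ε → ∃[ N ] ∀ s → N ℕ.≤ s → ∃[ α ] ∀ i →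
                α * w s i ≤ (A ∙ w s) i × (A ∙ w s) i ≤ (α + ε) * w s i
      w-cauchy : ∀ {ε} → 0ℚ < ε → ∃[ N ] ∀ s t → N ℕ.≤ s → N ℕ.≤ t → ∀ i →
                ∣ w s i - w t i ∣ < ε

  bounded : ∀ {n} (f : Fin n → ℕ) → ∃[ N ] ∀ i → f i ℕ.≤ N
  bounded {zero}  f = 0 , λ ()
  bounded {suc n} f with bounded (λ i → f (suc i))
  ... | N , le = f zero ℕ.⊔ N , λ { zero → ℕₚ.m≤m⊔n (f zero) N
                                  ; (suc i) → ℕₚ.≤-trans (le i) (ℕₚ.m≤n⊔m (f zero) N) }

  -- `hi` and `lo` make every coordinate after N steps comparable with the total mass before them.
  -- Contraction by the factor 1 - η, where η = 1 / L, follows from this alone.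
  module Contraction {n} (A : Mat n) (o : Fin n) (0≤A : ∀ i j → 0ℚ ≤ A i j) (A≤1 : ∀ i j → A i j ≤ 1ℚ)
    (N : ℕ) {κ ν η : ℚ} (0≤κ : 0ℚ ≤ κ) (0≤ν : 0ℚ ≤ ν) (0≤η : 0ℚ ≤ η) (0≤1-η : 0ℚ ≤ 1ℚ - η)
    (Lη≡1 : η * (1ℚ + (1ℚ + 1ℚ) * κ * ν) ≡ 1ℚ)
    (hi : ∀ {v} → (∀ i → 0ℚ ≤ v i) → ∀ i → Iteration.iter A 0≤A A≤1 N v i ≤ κ * ∑ v)
    (lo : ∀ {v} → (∀ i → 0ℚ ≤ v i) → ∀ i → ∑ v ≤ ν * Iteration.iter A 0≤A A≤1 N v i)
    where

    open Iteration A 0≤A A≤1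

    M : Vec n → Vec n
    M = iter N

    -- The ratio y / x oscillates by at most ℓ. Working with ℓ instead of Hilbert's projective
    -- metric keeps the contraction linear and rational.
    Squeeze : ℚ → ℚ → Vec n → Vec n → Set
    Squeeze α ℓ x y = ∀ i → α * x i ≤ y i × y i ≤ (α + ℓ) * x i

    L : ℚ
    L = 1ℚ + (1ℚ + 1ℚ) * κ * ν

    -- ℓ M x ≤ κ ℓ ∑ x ≤ 2κ ∑ z ≤ 2κν M z ≤ L M z. The extra 1 in L makes it at least 1, so that η ≤
    -- 1.
    gain : ∀ {ℓ x z} → 0ℚ ≤ ℓ → (∀ i → 0ℚ ≤ x i) → (∀ i → 0ℚ ≤ z i) →
           ℓ * ∑ x ≤ (1ℚ + 1ℚ) * ∑ z → ∀ i → η * ℓ * M x i ≤ M z i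
    gain {ℓ} {x} {z} 0≤ℓ 0≤x 0≤z large i = begin
      η * ℓ * M x i                       ≡⟨ *-assoc η ℓ (M x i) ⟩
      η * (ℓ * M x i)                     ≤⟨ *-monoˡ 0≤η step ⟩
      η * (L * M z i)                     ≡⟨ *-assoc η L (M z i) ⟨
      η * L * M z i                       ≡⟨ cong (_* M z i) Lη≡1 ⟩
      1ℚ * M z i                          ≡⟨ *-identityˡ (M z i) ⟩
      M z i                               ∎
      where
      open ≤-Reasoning
      step : ℓ * M x i ≤ L * M z i
      step = begin
        ℓ * M x i                         ≤⟨ *-monoˡ 0≤ℓ (hi 0≤x i) ⟩
        ℓ * (κ * ∑ x)                     ≡⟨ solve 3 (λ l k s → l :* (k :* s) := k :* (l :* s)) refl ℓ κ (∑ x) ⟩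
        κ * (ℓ * ∑ x)                     ≤⟨ *-monoˡ 0≤κ large ⟩
        κ * ((1ℚ + 1ℚ) * ∑ z)             ≡⟨ *-assoc κ (1ℚ + 1ℚ) (∑ z) ⟨
        κ * (1ℚ + 1ℚ) * ∑ z               ≤⟨ *-monoˡ (*-nonneg 0≤κ (+-nonneg 0≤1 0≤1)) (lo 0≤z i) ⟩
        κ * (1ℚ + 1ℚ) * (ν * M z i)       ≡⟨ +-identityˡ (κ * (1ℚ + 1ℚ) * (ν * M z i)) ⟨
        0ℚ + κ * (1ℚ + 1ℚ) * (ν * M z i)  ≤⟨ +-monoˡ-≤ (κ * (1ℚ + 1ℚ) * (ν * M z i)) (iter-nonneg N 0≤z i) ⟩
        M z i + κ * (1ℚ + 1ℚ) * (ν * M z i)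
          ≡⟨ solve 4 (λ m k t v → m :+ k :* t :* (v :* m) := (con 1ℚ :+ t :* k :* v) :* m) refl (M z i) κ (1ℚ + 1ℚ) ν ⟩
        L * M z i                         ∎

    halves-total : ∀ a b {c} → a + b ≡ c → c ≤ (1ℚ + 1ℚ) * a ⊎ c ≤ (1ℚ + 1ℚ) * b
    halves-total a b {c} eq with ≤-total b a
    ... | inj₁ b≤a = inj₁ (subst₂ _≤_ eq (solve 1 (λ a → a :+ a := (con 1ℚ :+ con 1ℚ) :* a) refl a) (+-monoʳ-≤ a b≤a))
    ... | inj₂ a≤b = inj₂ (subst₂ _≤_ eq (solve 1 (λ a → a :+ a := (con 1ℚ :+ con 1ℚ) :* a) refl b) (+-monoˡ-≤ b a≤b))

    -- One of y − α x and (α + ℓ) x − y has at least half of the total mass ℓ ∑ x,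
    -- and the positive operator M spreads that mass over all coordinates.
    squeeze-step : ∀ {α ℓ x y} → 0ℚ ≤ ℓ → (∀ i → 0ℚ ≤ x i) → Squeeze α ℓ x y →
                   ∃[ α′ ] α ≤ α′ × Squeeze α′ ((1ℚ - η) * ℓ) (M x) (M y)
    squeeze-step {α} {ℓ} {x} {y} 0≤ℓ 0≤x sq = choose (halves-total (∑ z) (∑ z′) sum-eq)
      where
      z z′ : Vec n
      z  = comb 1ℚ (- α) y x
      z′ = comb (α + ℓ) (- 1ℚ) x y
      z-eq : ∀ a x y → y - a * x ≡ 1ℚ * y + (- a) * x
      z-eq = solve 3 (λ a x y → y :- a :* x := con 1ℚ :* y :+ (:- a) :* x) refl
      z′-eq : ∀ b x y → b * x - y ≡ b * x + (- 1ℚ) * y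
      z′-eq = solve 3 (λ b x y → b :* x :- y := b :* x :+ (:- con 1ℚ) :* y) refl
      0≤z : ∀ i → 0ℚ ≤ z i
      0≤z i = subst (0ℚ ≤_) (z-eq α (x i) (y i)) (≤⇒0≤- (proj₁ (sq i)))
      0≤z′ : ∀ i → 0ℚ ≤ z′ i
      0≤z′ i = subst (0ℚ ≤_) (z′-eq (α + ℓ) (x i) (y i)) (≤⇒0≤- (proj₂ (sq i)))
      sum-eq : ∑ z + ∑ z′ ≡ ℓ * ∑ x
      sum-eq = trans (sym (∑-+ z z′)) (trans
        (∑-cong (λ i → solve 4 (λ a l x y → (con 1ℚ :* y :+ (:- a) :* x) :+ ((a :+ l) :* x :+ (:- con 1ℚ) :* y) := l :* x) refl α ℓ (x i) (y i)))
        (sym (*-∑ ℓ x)))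
      Mz : ∀ i → M y i - α * M x i ≡ M z i
      Mz i = trans (z-eq α (M x i) (M y i)) (sym (iter-comb N 1ℚ (- α) y x i))
      Mz′ : ∀ i → (α + ℓ) * M x i - M y i ≡ M z′ i
      Mz′ i = trans (z′-eq (α + ℓ) (M x i) (M y i)) (sym (iter-comb N (α + ℓ) (- 1ℚ) x y i))
      lower : ∀ i → α * M x i ≤ M y i
      lower i = 0≤-⇒≤ (subst (0ℚ ≤_) (sym (Mz i)) (iter-nonneg N 0≤z i))
      upper : ∀ i → M y i ≤ (α + ℓ) * M x i
      upper i = 0≤-⇒≤ (subst (0ℚ ≤_) (sym (Mz′ i)) (iter-nonneg N 0≤z′ i))
      choose : ℓ * ∑ x ≤ (1ℚ + 1ℚ) * ∑ z ⊎ ℓ * ∑ x ≤ (1ℚ + 1ℚ) * ∑ z′ →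
               ∃[ α′ ] α ≤ α′ × Squeeze α′ ((1ℚ - η) * ℓ) (M x) (M y)
      -- A heavy `z` raises the lower end of the interval by ηℓ; a heavy `z′` lowers the upper end
      -- by as much.
      choose (inj₁ large) = α + η * ℓ ,
        subst (_≤ α + η * ℓ) (+-identityʳ α) (+-monoʳ-≤ α (*-nonneg 0≤η 0≤ℓ)) , λ i →
        0≤-⇒≤ (subst (0ℚ ≤_) (trans (cong (_- η * ℓ * M x i) (sym (Mz i)))
          (solve 5 (λ a e l x y → y :- a :* x :- e :* l :* x := y :- (a :+ e :* l) :* x) refl α η ℓ (M x i) (M y i)))
          (≤⇒0≤- (gain 0≤ℓ 0≤x 0≤z large i))) ,
        subst (M y i ≤_) (cong (_* M x i) (solve 3 (λ a e l → a :+ l := a :+ e :* l :+ (con 1ℚ :- e) :* l) refl α η ℓ)) (upper i)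
      choose (inj₂ large) = α , ≤-refl , λ i → lower i ,
        0≤-⇒≤ (subst (0ℚ ≤_) (trans (cong (_- η * ℓ * M x i) (sym (Mz′ i)))
          (solve 5 (λ a e l x y → (a :+ l) :* x :- y :- e :* l :* x := (a :+ (con 1ℚ :- e) :* l) :* x :- y) refl α η ℓ (M x i) (M y i)))
          (≤⇒0≤- (gain 0≤ℓ 0≤x 0≤z′ large i)))

    it : ℕ → Vec n → Vec n
    it zero    v = v
    it (suc s) v = M (it s v)

    it-+ : ∀ s u v i → it (s ℕ.+ u) v i ≡ it s (it u v) i
    it-+ zero    u v i = refl
    it-+ (suc s) u v i = iter-cong N (it-+ s u v) i

    it-A : ∀ s v i → it s (A ∙ v) i ≡ (A ∙ it s v) i
    it-A zero    v i = refl
    it-A (suc s) v i = trans (iter-cong N (it-A s v) i) (iter-A N (it s v) i)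

    it-grows : ∀ s {v} → (∀ i → 0ℚ ≤ v i) → ∀ i → v i ≤ it s v i
    it-grows zero    0≤v i = ≤-refl
    it-grows (suc s) 0≤v i = ≤-trans (it-grows s 0≤v i) (iter-grows N (λ j → ≤-trans (0≤v j) (it-grows s 0≤v j)) i)

    scale : ℚ → Vec n → Vec n
    scale a v i = v i * a

    A-scale : ∀ a v i → (A ∙ scale a v) i ≡ (A ∙ v) i * a
    A-scale a v i = trans (∑-cong (λ j → sym (*-assoc (A i j) (v j) a))) (sym (∑-* (λ j → A i j * v j) a))

    iter-scale : ∀ k a v i → iter k (scale a v) i ≡ iter k v i * a
    iter-scale zero    a v i = refl
    iter-scale (suc k) a v i = trans
      (cong₂ _+_ (iter-scale k a v i) (trans (A-cong (iter-scale k a v) i) (A-scale a (iter k v) i)))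
      (sym (*-distribʳ-+ a (iter k v i) ((A ∙ iter k v) i)))

    it-scale : ∀ s a v i → it s (scale a v) i ≡ it s v i * a
    it-scale zero    a v i = refl
    it-scale (suc s) a v i = trans (iter-cong N (it-scale s a v) i) (iter-scale N a (it s v) i)

    -- That the lower end never decreases is recorded because `Close` needs it to stay above 1 / K.
    squeeze : ∀ s {α ℓ x y} → 0ℚ ≤ ℓ → (∀ i → 0ℚ ≤ x i) → Squeeze α ℓ x y →
              ∃[ α′ ] α ≤ α′ × Squeeze α′ ((1ℚ - η) ^ s * ℓ) (it s x) (it s y)
    squeeze zero    {α} {ℓ} {x} {y} 0≤ℓ 0≤x sq = α , ≤-refl , λ i →
      proj₁ (sq i) , subst (λ z → y i ≤ (α + z) * x i) (sym (*-identityˡ ℓ)) (proj₂ (sq i))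
    squeeze (suc s) {α} {ℓ} {x} {y} 0≤ℓ 0≤x sq =
      let α₁ , α≤α₁ , sq₁ = squeeze s 0≤ℓ 0≤x sq
          α₂ , α₁≤α₂ , sq₂ = squeeze-step (*-nonneg (^-nonneg 0≤1-η s) 0≤ℓ)
                               (λ i → ≤-trans (0≤x i) (it-grows s 0≤x i)) sq₁
      in α₂ , ≤-trans α≤α₁ α₁≤α₂ , λ i → proj₁ (sq₂ i) ,
         subst (λ z → it (suc s) y i ≤ (α₂ + z) * it (suc s) x i)
           (sym (*-assoc (1ℚ - η) ((1ℚ - η) ^ s) ℓ)) (proj₂ (sq₂ i))

    1⃗ : Vec n
    1⃗ _ = 1ℚ

    X : ℕ → Vec n
    X s = it s 1⃗

    1≤X : ∀ s i → 1ℚ ≤ X s i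
    1≤X s i = it-grows s (λ _ → 0≤1) i

    X-pos : ∀ s i → 0ℚ < X s i
    X-pos s i = <-≤-trans 0<1 (1≤X s i)

    X-nonneg : ∀ s i → 0ℚ ≤ X s i
    X-nonneg s i = <⇒≤ (X-pos s i)

    K : ℚ
    K = 1ℚ + κ * ν

    K-pos : 0ℚ < K
    K-pos = +-pos-nonneg 0<1 (*-nonneg 0≤κ 0≤ν)

    K-nonneg : 0ℚ ≤ K
    K-nonneg = <⇒≤ K-pos

    X-ratio : ∀ s i j → X s i ≤ K * X s j
    X-ratio zero    i j = subst (1ℚ ≤_) (sym (*-identityʳ K))
      (subst (_≤ K) (+-identityʳ 1ℚ) (+-monoʳ-≤ 1ℚ (*-nonneg 0≤κ 0≤ν)))
    X-ratio (suc s) i j = begin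
      M (X s) i                 ≤⟨ hi (X-nonneg s) i ⟩
      κ * ∑ (X s)               ≤⟨ *-monoˡ 0≤κ (lo (X-nonneg s) j) ⟩
      κ * (ν * M (X s) j)       ≡⟨ +-identityˡ (κ * (ν * M (X s) j)) ⟨
      0ℚ + κ * (ν * M (X s) j)  ≤⟨ +-monoˡ-≤ (κ * (ν * M (X s) j)) (X-nonneg (suc s) j) ⟩
      M (X s) j + κ * (ν * M (X s) j)
        ≡⟨ solve 3 (λ m k v → m :+ k :* (v :* m) := (con 1ℚ :+ k :* v) :* m) refl (M (X s) j) κ ν ⟩
      K * M (X s) j             ∎
      where open ≤-Reasoning

    r : ℕ → ℚ
    r s = proj₁ (inverse (X-pos s o))

    r-pos : ∀ s → 0ℚ < r s
    r-pos s = proj₁ (proj₂ (inverse (X-pos s o)))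

    Xr≡1 : ∀ s → X s o * r s ≡ 1ℚ
    Xr≡1 s = proj₂ (proj₂ (inverse (X-pos s o)))

    w : ℕ → Vec n
    w s = scale (r s) (X s)

    w-pos : ∀ s i → 0ℚ < w s i
    w-pos s i = *-pos (X-pos s i) (r-pos s)

    w-nonneg : ∀ s i → 0ℚ ≤ w s i
    w-nonneg s i = <⇒≤ (w-pos s i)

    w-ratio : ∀ s i j → w s i ≤ K * w s j
    w-ratio s i j = subst (w s i ≤_) (*-assoc K (X s j) (r s)) (*-monoʳ (<⇒≤ (r-pos s)) (X-ratio s i j))

    w≤K : ∀ s i → w s i ≤ K
    w≤K s i = subst (w s i ≤_) (trans (cong (K *_) (Xr≡1 s)) (*-identityʳ K)) (w-ratio s i o)

    squeeze-start : Squeeze 0ℚ (ι n) 1⃗ (A ∙ 1⃗)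
    squeeze-start i = subst (_≤ (A ∙ 1⃗) i) (sym (*-zeroˡ 1ℚ)) (A-nonneg (λ _ → 0≤1) i) ,
      subst ((A ∙ 1⃗) i ≤_)
        (trans (∑-const n 1ℚ) (cong (_* 1ℚ) (sym (+-identityˡ (ι n)))))
        (∑-mono (λ j → subst (_≤ 1ℚ) (sym (*-identityʳ (A i j))) (A≤1 i j)))

    -- The squeezed pair starts as the constant vector and its image under A, with quotients between
    -- 0 and n. After s steps it has become `X s` and A `X s`.
    residual : ∀ s → ∃[ α ] ∀ i → α * w s i ≤ (A ∙ w s) i ×
               (A ∙ w s) i ≤ (α + (1ℚ - η) ^ s * ι n) * w s i
    residual s =
      let α , _ , sq = squeeze s (ι-nonneg n) (λ _ → 0≤1) squeeze-start
          eq : ∀ i → it s (A ∙ 1⃗) i * r s ≡ (A ∙ w s) i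
          eq i = trans (cong (_* r s) (it-A s 1⃗ i)) (sym (A-scale (r s) (X s) i))
          b = α + (1ℚ - η) ^ s * ι n
      in α , λ i →
         subst₂ _≤_ (*-assoc α (X s i) (r s)) (eq i) (*-monoʳ (<⇒≤ (r-pos s)) (proj₁ (sq i))) ,
         subst₂ _≤_ (eq i) (*-assoc b (X s i) (r s)) (*-monoʳ (<⇒≤ (r-pos s)) (proj₂ (sq i)))

    module _ {κ₀ : ℚ} (Kκ₀≡1 : K * κ₀ ≡ 1ℚ) (0<κ₀ : 0ℚ < κ₀) where

      squeeze-w : ∀ u → Squeeze κ₀ K 1⃗ (w u)
      squeeze-w u i =
        subst (_≤ w u i) (sym (*-identityʳ κ₀)) (*-cancelˡ K-pos
          (subst (_≤ K * w u i) (trans (Xr≡1 u) (sym Kκ₀≡1)) (w-ratio u o i))) ,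
        subst (w u i ≤_) (sym (*-identityʳ (κ₀ + K)))
          (≤-trans (w≤K u i) (subst (_≤ κ₀ + K) (+-identityˡ K) (+-monoˡ-≤ K (<⇒≤ 0<κ₀))))

      -- X₀ and Y₀ are the o-coordinates of two squeezed vectors, b and a their i-coordinates after
      -- normalisation at o. Eliminating α from the bounds for both coordinates leaves Y₀ ∣a - b∣ ≤
      -- ℓ b X₀, and α ≥ 1 / K bounds X₀ by K Y₀.
      module Close {a b X₀ Y₀ Y α ℓ : ℚ} (0<X₀ : 0ℚ < X₀) (0<Y₀ : 0ℚ < Y₀) (0≤ℓ : 0ℚ ≤ ℓ) (0≤b : 0ℚ ≤ b) (b≤K : b ≤ K)
                   (κ₀≤α : κ₀ ≤ α) (aY₀ : a * Y₀ ≡ Y)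
                   (lowY : α * (b * X₀) ≤ Y) (highY : Y ≤ (α + ℓ) * (b * X₀))
                   (low₀ : α * X₀ ≤ Y₀) (high₀ : Y₀ ≤ (α + ℓ) * X₀) where

        X₀≤KY₀ : X₀ ≤ K * Y₀
        X₀≤KY₀ = begin
          X₀             ≡⟨ *-identityˡ X₀ ⟨
          1ℚ * X₀        ≡⟨ cong (_* X₀) Kκ₀≡1 ⟨
          K * κ₀ * X₀    ≡⟨ *-assoc K κ₀ X₀ ⟩
          K * (κ₀ * X₀)  ≤⟨ *-monoˡ K-nonneg (*-monoʳ (<⇒≤ 0<X₀) κ₀≤α) ⟩
          K * (α * X₀)   ≤⟨ *-monoˡ K-nonneg low₀ ⟩
          K * Y₀         ∎
          where open ≤-Reasoning

        small : ℓ * (b * X₀) ≤ Y₀ * (ℓ * (K * K))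
        small = begin
          ℓ * (b * X₀)          ≤⟨ *-monoˡ 0≤ℓ (*-mono 0≤b b≤K (<⇒≤ 0<X₀) X₀≤KY₀) ⟩
          ℓ * (K * (K * Y₀))    ≡⟨ solve 3 (λ l k y → l :* (k :* (k :* y)) := y :* (l :* (k :* k))) refl ℓ K Y₀ ⟩
          Y₀ * (ℓ * (K * K))    ∎
          where open ≤-Reasoning

        above : a - b ≤ ℓ * (K * K)
        above = *-cancelˡ 0<Y₀ (≤-trans (0≤-⇒≤ (subst (0ℚ ≤_) eq (+-nonneg (≤⇒0≤- highY) (*-nonneg 0≤b (≤⇒0≤- low₀))))) small)
          where
          eq : ((α + ℓ) * (b * X₀) - Y) + b * (Y₀ - α * X₀) ≡ ℓ * (b * X₀) - Y₀ * (a - b)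
          eq = trans (cong (λ z → ((α + ℓ) * (b * X₀) - z) + b * (Y₀ - α * X₀)) (sym aY₀))
            (solve 6 (λ a b x y α l → ((α :+ l) :* (b :* x) :- a :* y) :+ b :* (y :- α :* x) := l :* (b :* x) :- y :* (a :- b)) refl a b X₀ Y₀ α ℓ)

        below : b - a ≤ ℓ * (K * K)
        below = *-cancelˡ 0<Y₀ (≤-trans (0≤-⇒≤ (subst (0ℚ ≤_) eq (+-nonneg (≤⇒0≤- lowY) (*-nonneg 0≤b (≤⇒0≤- high₀))))) small)
          where
          eq : (Y - α * (b * X₀)) + b * ((α + ℓ) * X₀ - Y₀) ≡ ℓ * (b * X₀) - Y₀ * (b - a)
          eq = trans (cong (λ z → (z - α * (b * X₀)) + b * ((α + ℓ) * X₀ - Y₀)) (sym aY₀))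
            (solve 6 (λ a b x y α l → (a :* y :- α :* (b :* x)) :+ b :* ((α :+ l) :* x :- y) := l :* (b :* x) :- y :* (b :- a)) refl a b X₀ Y₀ α ℓ)

        close : ∣ a - b ∣ ≤ ℓ * (K * K)
        close = ∣∣≤ above (subst (- (ℓ * (K * K)) ≤_) (solve 2 (λ a b → :- (b :- a) := a :- b) refl a b) (neg-antimono-≤ below))

      -- X (s + u) and X s are the images under s steps of X u and of the constant vector.
      w-close : ∀ s u i → ∣ w (s ℕ.+ u) i - w s i ∣ ≤ (1ℚ - η) ^ s * K * (K * K)
      w-close s u i =
        let α , κ₀≤α , sq = squeeze s K-nonneg (λ _ → 0≤1) (squeeze-w u)
            Y = it s (w u)
            Y≡ : ∀ j → Y j ≡ X (s ℕ.+ u) j * r u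
            Y≡ j = trans (it-scale s (r u) (X u) j) (cong (_* r u) (sym (it-+ s u 1⃗ j)))
            Xi≡ : w s i * X s o ≡ X s i
            Xi≡ = trans (solve 3 (λ x r z → x :* r :* z := x :* (z :* r)) refl (X s i) (r s) (X s o))
                    (trans (cong (X s i *_) (Xr≡1 s)) (*-identityʳ (X s i)))
            aY₀ : w (s ℕ.+ u) i * Y o ≡ Y i
            aY₀ = trans (cong (w (s ℕ.+ u) i *_) (Y≡ o)) (trans
                    (solve 4 (λ x r z u → x :* r :* (z :* u) := x :* u :* (z :* r)) refl (X (s ℕ.+ u) i) (r (s ℕ.+ u)) (X (s ℕ.+ u) o) (r u))
                    (trans (cong (X (s ℕ.+ u) i * r u *_) (Xr≡1 (s ℕ.+ u)))
                    (trans (*-identityʳ (X (s ℕ.+ u) i * r u)) (sym (Y≡ i)))))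
            ℓ = (1ℚ - η) ^ s * K
        in Close.close {w (s ℕ.+ u) i} {w s i} {X s o} {Y o} {Y i} {α} {ℓ}
             (X-pos s o) (<-≤-trans (w-pos u o) (it-grows s (w-nonneg u) o))
             (*-nonneg (^-nonneg 0≤1-η s) K-nonneg) (w-nonneg s i) (w≤K s i) κ₀≤α aY₀
             (subst (λ z → α * z ≤ Y i) (sym Xi≡) (proj₁ (sq i)))
             (subst (λ z → Y i ≤ (α + ℓ) * z) (sym Xi≡) (proj₂ (sq i)))
             (proj₁ (sq o)) (proj₂ (sq o))

    L-pos : 0ℚ < L
    L-pos = +-pos-nonneg 0<1 (*-nonneg (*-nonneg (+-nonneg 0≤1 0≤1) 0≤κ) 0≤ν)

    perron-vectors : PerronVectors A o
    perron-vectors = record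
      { w       = w
      ; K       = K
      ; w-pos   = w-pos
      ; w-first = Xr≡1
      ; w-ratio = w-ratio
      ; eigen   = λ {ε} 0<ε →
          let N₀ , small = decay L-pos 0≤η 0≤1-η Lη≡1 (ι-nonneg n) 0<ε
          in N₀ , λ s N₀≤s →
             let α , res = residual s in α , λ i → proj₁ (res i) ,
               ≤-trans (proj₂ (res i)) (*-monoʳ (w-nonneg s i) (+-monoʳ-≤ α (<⇒≤ (small s N₀≤s))))
      ; w-cauchy = λ {ε} 0<ε →
          let N₀ , small = decay L-pos 0≤η 0≤1-η Lη≡1 (*-nonneg K-nonneg (*-nonneg K-nonneg K-nonneg)) 0<ε
          in N₀ , λ s t N₀≤s N₀≤t i → order-independent N₀ ε small i s t N₀≤s N₀≤t (ℕₚ.≤-total s t)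
      }
      where
      κ₀-inverse = inverse K-pos
      near : ∀ N₀ δ → (∀ s → N₀ ℕ.≤ s → (1ℚ - η) ^ s * (K * (K * K)) < δ) → ∀ i s t →
             N₀ ℕ.≤ s → s ℕ.≤ t → ∣ w t i - w s i ∣ < δ
      near N₀ δ small i s t N₀≤s s≤t = subst (λ t → ∣ w t i - w s i ∣ < δ) (ℕₚ.m+[n∸m]≡n s≤t)
        (≤-<-trans (w-close (proj₂ (proj₂ κ₀-inverse)) (proj₁ (proj₂ κ₀-inverse)) s (t ℕ.∸ s) i)
          (subst (_< δ) (sym (*-assoc ((1ℚ - η) ^ s) K (K * K))) (small s N₀≤s)))
      order-independent : ∀ N₀ δ → (∀ s → N₀ ℕ.≤ s → (1ℚ - η) ^ s * (K * (K * K)) < δ) → ∀ i s t →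
             N₀ ℕ.≤ s → N₀ ℕ.≤ t → s ℕ.≤ t ⊎ t ℕ.≤ s → ∣ w s i - w t i ∣ < δ
      order-independent N₀ δ small i s t N₀≤s N₀≤t (inj₁ s≤t) =
        subst (_< δ) (∣-∣-sym (w t i) (w s i)) (near N₀ δ small i s t N₀≤s s≤t)
      order-independent N₀ δ small i s t N₀≤s N₀≤t (inj₂ t≤s) = near N₀ δ small i t s N₀≤t t≤s

  abstract
    perron : ∀ {n} (A : Mat n) (o : Fin n) → (∀ i j → 0ℚ ≤ A i j) → (∀ i j → A i j ≤ 1ℚ) →
             ∀ {c} → 0ℚ < c → c ≤ 1ℚ → (∀ i j → Star (λ i j → c ≤ A i j) i j) → PerronVectors A o
    perron {n} A o 0≤A A≤1 {c} 0<c c≤1 conn =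
      -- N is at least the length of one chosen walk for each pair of vertices, so by `reach` all
      -- entries of the N-th power of I + A are at least the N-th power of c.
      let rows = λ i → bounded (λ j → length (<⇒≤ 0<c) c≤1 (conn i j))
          N , N-bound = bounded (λ i → proj₁ (rows i))
          κ , 0≤κ , hi = iter≤∑ N
          μ⁻¹ , 0<μ⁻¹ , μμ⁻¹≡1 = inverse (^-pos 0<c N)
          ν = μ⁻¹ * ι n
          0≤ν = *-nonneg (<⇒≤ 0<μ⁻¹) (ι-nonneg n)
          L = 1ℚ + (1ℚ + 1ℚ) * κ * ν
          0≤rest = *-nonneg (*-nonneg (+-nonneg 0≤1 0≤1) 0≤κ) 0≤ν
          1≤L : 1ℚ ≤ L
          1≤L = subst (_≤ L) (+-identityʳ 1ℚ) (+-monoʳ-≤ 1ℚ 0≤rest)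
          η , 0<η , Lη≡1 = inverse (<-≤-trans 0<1 1≤L)
          η≤1 : η ≤ 1ℚ
          η≤1 = subst₂ _≤_ (*-identityˡ η) Lη≡1 (*-monoʳ (<⇒≤ 0<η) 1≤L)
          lo : ∀ {v} → (∀ i → 0ℚ ≤ v i) → ∀ i → ∑ v ≤ ν * iter N v i
          lo {v} 0≤v i = lower-bound v (iter N v i) μ⁻¹ (c ^ N) (<⇒≤ 0<μ⁻¹) μμ⁻¹≡1
            (λ j → reach (<⇒≤ 0<c) c≤1 (conn i j) N (ℕₚ.≤-trans (proj₂ (rows i) j) (N-bound i)) 0≤v)
      in Contraction.perron-vectors A o 0≤A A≤1 N 0≤κ 0≤ν (<⇒≤ 0<η) (≤⇒0≤- η≤1) (trans (*-comm η L) Lη≡1) hi lo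
      where
      open Iteration A 0≤A A≤1
      lower-bound : ∀ (v : Vec n) a μ⁻¹ μ → 0ℚ ≤ μ⁻¹ → μ * μ⁻¹ ≡ 1ℚ → (∀ j → μ * v j ≤ a) →
                    ∑ v ≤ μ⁻¹ * ι n * a
      lower-bound v a μ⁻¹ μ 0≤μ⁻¹ μμ⁻¹≡1 le = begin
        ∑ v                              ≡⟨ ∑-cong (λ j → *-identityˡ (v j)) ⟨
        ∑ (λ j → 1ℚ * v j)               ≡⟨ ∑-cong (λ j → cong (_* v j) (trans (*-comm μ⁻¹ μ) μμ⁻¹≡1)) ⟨
        ∑ (λ j → μ⁻¹ * μ * v j)          ≤⟨ ∑-mono (λ j → subst (_≤ μ⁻¹ * a) (sym (*-assoc μ⁻¹ μ (v j))) (*-monoˡ 0≤μ⁻¹ (le j))) ⟩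
        ∑ {n} (λ _ → μ⁻¹ * a)        ≡⟨ ∑-const n (μ⁻¹ * a) ⟩
        ι n * (μ⁻¹ * a)            ≡⟨ solve 3 (λ i m a → i :* (m :* a) := m :* i :* a) refl (ι n) μ⁻¹ a ⟩
        μ⁻¹ * ι n * a              ∎
        where open ≤-Reasoning

-- Rayleigh and Collatz-Wielandt bounds for the spectral radius

module SpectralBounds where

  open RationalArithmetic
  open PowerIteration
  open import Defs using (ℝ; seq; cauchy; ℂ; re; im; fromℚ; fromℝ; sumᶜ; _*ᶜ_; Matrix; IsEigenvalue; IsSpectralRadius)
    renaming (_≤_ to _≤ʳ_; _≈_ to _≈ʳ_; _*_ to _*ʳ_; mkℝ to mkℝ′; _≈ᶜ_ to _≈ᶜ′_)
  import Defs
  open import Data.Rational.Base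
  open import Data.Rational.Properties
  open import Data.Rational.Solver using (module +-*-Solver)
  open +-*-Solver

  _⊔₂_ : ∀ {P Q : ℕ → Set} → ∃[ N ] (∀ n → N ℕ.≤ n → P n) → ∃[ N ] (∀ n → N ℕ.≤ n → Q n) →
         ∃[ N ] (∀ n → N ℕ.≤ n → P n × Q n)
  (M , p) ⊔₂ (N , q) = M ℕ.⊔ N , λ n le → p n (ℕₚ.m⊔n≤o⇒m≤o M N le) , q n (ℕₚ.m⊔n≤o⇒n≤o M N le)

  allF : ∀ {k} {P : Fin k → ℕ → Set} → (∀ i → ∃[ N ] (∀ n → N ℕ.≤ n → P i n)) →
         ∃[ N ] (∀ n → N ℕ.≤ n → ∀ i → P i n)
  allF ev = let N , le = bounded (λ i → proj₁ (ev i)) in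
    N , λ n N≤n i → proj₂ (ev i) n (ℕₚ.≤-trans (le i) N≤n)

  part : ∀ {ε} → 0ℚ < ε → ∃[ d ] 0ℚ < d × d + d + d + d ≡ ε
  part {ε} 0<ε = ½ * (½ * ε) , *-pos (positive⁻¹ ½) (*-pos (positive⁻¹ ½) 0<ε) ,
    solve 1 (λ e → con ½ :* (con ½ :* e) :+ con ½ :* (con ½ :* e) :+ con ½ :* (con ½ :* e) :+ con ½ :* (con ½ :* e) := e) refl ε

  0≤₂ : 0ℚ ≤ 1ℚ + 1ℚ
  0≤₂ = +-nonneg 0≤1 0≤1

  by-< : ∀ {a b c} → 0ℚ < c → c ≡ b - a → a < b
  by-< 0<c eq = 0<-⇒< (subst (0ℚ <_) eq 0<c)

  by-≤ : ∀ {a b c} → 0ℚ ≤ c → c ≡ b - a → a ≤ b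
  by-≤ 0≤c eq = 0≤-⇒≤ (subst (0ℚ ≤_) eq 0≤c)

  abstract
    -- Order of reals is decidable up to a tolerance: beyond stage k both sequences vary by less
    -- than d = ε / 16, so a comparison at k with margin 3d settles all later stages.
    separate : ∀ x y {ε} → 0ℚ < ε →
               (∃[ N ] (∀ n → N ℕ.≤ n → seq x n < seq y n + ε)) ⊎
               (∃[ d ] 0ℚ < d × ∃[ N ] (∀ n → N ℕ.≤ n → seq y n + d < seq x n))
    separate x y {ε} 0<ε =
      let e , 0<e , 4e≡ε = part 0<ε
          d , 0<d , 4d≡e = part 0<e
          M , cx = cauchy x d 0<d
          N , cy = cauchy y d 0<d
          k = M ℕ.⊔ N
          M≤k = ℕₚ.m≤m⊔n M N
          N≤k = ℕₚ.m≤n⊔m M N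
          near-x : ∀ n → k ℕ.≤ n → seq x n < seq x k + d
          near-x n k≤n = ∣-∣<⇒< (cx n k (ℕₚ.≤-trans M≤k k≤n) M≤k)
          near-x′ : ∀ n → k ℕ.≤ n → seq x k < seq x n + d
          near-x′ n k≤n = ∣-∣<⇒< (cx k n M≤k (ℕₚ.≤-trans M≤k k≤n))
          near-y : ∀ n → k ℕ.≤ n → seq y n < seq y k + d
          near-y n k≤n = ∣-∣<⇒< (cy n k (ℕₚ.≤-trans N≤k k≤n) N≤k)
          near-y′ : ∀ n → k ℕ.≤ n → seq y k < seq y n + d
          near-y′ n k≤n = ∣-∣<⇒< (cy k n N≤k (ℕₚ.≤-trans N≤k k≤n))
          5d<ε : d + d + d + d + d < ε
          5d<ε = by-< {c = (e + e + e + e - (e + e)) + (e - d)} (+-pos-nonneg (by-pos e 0<e) (≤⇒0≤- (d≤e d e 0<d 4d≡e)))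
                   (trans (cong₂ (λ p q → (p - (e + e)) + (q - d)) 4e≡ε (sym 4d≡e))
                     (trans (cong (λ q → (ε - (q + q)) + (d + d + d + d - d)) (sym 4d≡e)) (five d ε)))
      in [ (λ le → inj₁ (k , λ n k≤n → up {seq x n} {seq x k} {seq y k} {seq y n} (near-x n k≤n) le (near-y′ n k≤n) 5d<ε))
         , (λ le → inj₂ (d , 0<d , k , λ n k≤n → down {seq x n} {seq x k} {seq y k} {seq y n} (near-x′ n k≤n) le (near-y n k≤n))) ]′
         (≤-total (seq x k) (seq y k + d + d + d))
      where
      by-pos : ∀ e → 0ℚ < e → 0ℚ < e + e + e + e - (e + e)
      by-pos e 0<e = subst (0ℚ <_) (solve 1 (λ e → e :+ e := e :+ e :+ e :+ e :- (e :+ e)) refl e) (+-pos 0<e 0<e)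
      d≤e : ∀ d e → 0ℚ < d → d + d + d + d ≡ e → d ≤ e
      d≤e d e 0<d eq = by-≤ (<⇒≤ (+-pos (+-pos 0<d 0<d) 0<d))
        (trans (solve 1 (λ d → d :+ d :+ d := d :+ d :+ d :+ d :- d) refl d) (cong (_- d) eq))
      five : ∀ d ε → (ε - ((d + d + d + d) + (d + d + d + d))) + (d + d + d + d - d) ≡ ε - (d + d + d + d + d)
      five = solve 2 (λ d e → (e :- ((d :+ d :+ d :+ d) :+ (d :+ d :+ d :+ d))) :+ (d :+ d :+ d :+ d :- d) := e :- (d :+ d :+ d :+ d :+ d)) refl
      up : ∀ {xn xk yk yn d ε} → xn < xk + d → xk ≤ yk + d + d + d → yk < yn + d → d + d + d + d + d < ε → xn < yn + ε
      up {xn} {xk} {yk} {yn} {d} {ε} p q r s = by-< (+-pos (+-pos-nonneg (+-pos (<⇒0<- p) (<⇒0<- r)) (≤⇒0≤- q)) (<⇒0<- s))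
        (solve 6 (λ xn xk yk yn d e → (((xk :+ d :- xn) :+ (yn :+ d :- yk)) :+ (yk :+ d :+ d :+ d :- xk)) :+ (e :- (d :+ d :+ d :+ d :+ d)) := yn :+ e :- xn) refl xn xk yk yn d ε)
      down : ∀ {xn xk yk yn d} → xk < xn + d → yk + d + d + d ≤ xk → yn < yk + d → yn + d < xn
      down {xn} {xk} {yk} {yn} {d} p q r = by-< (+-pos-nonneg (+-pos (<⇒0<- p) (<⇒0<- r)) (≤⇒0≤- q))
        (solve 5 (λ xn xk yk yn d → ((xn :+ d :- xk) :+ (yk :+ d :- yn)) :+ (xk :- (yk :+ d :+ d :+ d)) := xn :- (yn :+ d)) refl xn xk yk yn d)

  -- The second alternative of `separate` is a positive gap, which refutes x ≤ y. Hence inequalities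
  -- between reals may be proved by contradiction.
  ≤ʳ-stable : ∀ {x y} → ¬ ¬ (x ≤ʳ y) → x ≤ʳ y
  ≤ʳ-stable {x} {y} nn ε 0<ε = [ (λ le → le) , (λ { (d , 0<d , N , gap) → ⊥-elim (nn λ x≤y →
    let M , le = x≤y d 0<d
        n = M ℕ.⊔ N
    in <-irrefl refl (<-trans (le n (ℕₚ.m≤m⊔n M N)) (gap n (ℕₚ.m≤n⊔m M N)))) }) ]′ (separate x y 0<ε)

  ≰ʳ⇒≥ʳ : ∀ {x y} → ¬ (x ≤ʳ y) → y ≤ʳ x
  ≰ʳ⇒≥ʳ {x} {y} x≰y ε 0<ε = [ (λ le → le) , (λ { (d , 0<d , N , gap) → ⊥-elim (x≰y λ ε′ 0<ε′ →
    N , λ n N≤n → <-trans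
      (<-trans (subst (_< seq x n + d) (+-identityʳ (seq x n)) (+-monoʳ-< (seq x n) 0<d)) (gap n N≤n))
      (subst (_< seq y n + ε′) (+-identityʳ (seq y n)) (+-monoʳ-< (seq y n) 0<ε′))) }) ]′ (separate y x 0<ε)

  ≤ʳ-trans : ∀ {x y z} → x ≤ʳ y → y ≤ʳ z → x ≤ʳ z
  ≤ʳ-trans {x} {y} {z} x≤y y≤z ε 0<ε =
    let d , 0<d , 4d≡ε = part 0<ε
        N , both = x≤y (d + d) (+-pos 0<d 0<d) ⊔₂ y≤z (d + d) (+-pos 0<d 0<d)
    in N , λ n N≤n → by-< (+-pos (<⇒0<- (proj₁ (both n N≤n))) (<⇒0<- (proj₂ (both n N≤n))))
         (trans (solve 4 (λ x y z d → (y :+ (d :+ d) :- x) :+ (z :+ (d :+ d) :- y) := z :+ (d :+ d :+ d :+ d) :- x) refl (seq x n) (seq y n) (seq z n) d)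
           (cong (λ e → seq z n + e - seq x n) 4d≡ε))

  ≈ʳ⇒≥ʳ : ∀ {x y} → x ≈ʳ y → y ≤ʳ x
  ≈ʳ⇒≥ʳ {x} {y} x≈y ε 0<ε = let N , close = x≈y ε 0<ε in
    N , λ n N≤n → ∣-∣<⇒< (subst (_< ε) (∣-∣-sym (seq x n) (seq y n)) (close n N≤n))

  -- The real entries are constant sequences, so an equation between reals built from them can be
  -- read at each stage as an approximate equation over ℚ.
  Represents : ∀ {n} → Matrix n → Mat n → Set
  Represents 𝔸 A = ∀ i j t → seq (𝔸 i j) t ≡ A i j

  seq-re-sumᶜ : ∀ {n} (f : Fin n → ℂ) t → seq (re (sumᶜ f)) t ≡ ∑ (λ j → seq (re (f j)) t)
  seq-re-sumᶜ {zero}  f t = refl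
  seq-re-sumᶜ {suc n} f t = cong (seq (re (f zero)) t +_) (seq-re-sumᶜ (λ j → f (suc j)) t)

  seq-im-sumᶜ : ∀ {n} (f : Fin n → ℂ) t → seq (im (sumᶜ f)) t ≡ ∑ (λ j → seq (im (f j)) t)
  seq-im-sumᶜ {zero}  f t = refl
  seq-im-sumᶜ {suc n} f t = cong (seq (im (f zero)) t +_) (seq-im-sumᶜ (λ j → f (suc j)) t)

  re-scalar : ∀ x y z → x * y - 0ℚ * z ≡ x * y
  re-scalar = solve 3 (λ x y z → x :* y :- con 0ℚ :* z := x :* y) refl

  im-scalar : ∀ x y z → x * z + 0ℚ * y ≡ x * z
  im-scalar = solve 3 (λ x y z → x :* z :+ con 0ℚ :* y := x :* z) refl

  seq-re-row : ∀ {n} {𝔸 : Matrix n} {A : Mat n} → Represents 𝔸 A → (x : Fin n → ℂ) → ∀ i t →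
               seq (re (sumᶜ (λ j → fromℝ (𝔸 i j) *ᶜ x j))) t ≡ (A ∙ (λ j → seq (re (x j)) t)) i
  seq-re-row {𝔸 = 𝔸} {A} rep x i t = trans (seq-re-sumᶜ (λ j → fromℝ (𝔸 i j) *ᶜ x j) t)
    (∑-cong λ j → trans (re-scalar (seq (𝔸 i j) t) (seq (re (x j)) t) (seq (im (x j)) t))
      (cong (_* seq (re (x j)) t) (rep i j t)))

  seq-im-row : ∀ {n} {𝔸 : Matrix n} {A : Mat n} → Represents 𝔸 A → (x : Fin n → ℂ) → ∀ i t →
               seq (im (sumᶜ (λ j → fromℝ (𝔸 i j) *ᶜ x j))) t ≡ (A ∙ (λ j → seq (im (x j)) t)) i
  seq-im-row {𝔸 = 𝔸} {A} rep x i t = trans (seq-im-sumᶜ (λ j → fromℝ (𝔸 i j) *ᶜ x j) t)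
    (∑-cong λ j → trans (im-scalar (seq (𝔸 i j) t) (seq (re (x j)) t) (seq (im (x j)) t))
      (cong (_* seq (im (x j)) t) (rep i j t)))

  form : ∀ {n} → Mat n → Vec n → ℚ
  form A y = ∑ (λ i → y i * (A ∙ y) i)

  norm : ∀ {n} → Vec n → ℚ
  norm y = ∑ (λ i → y i * y i)

  Symmetric : ∀ {n} → Mat n → Set
  Symmetric A = ∀ i j → A i j ≡ A j i

  -- With u = y / w, the inequality 2 uᵢuⱼ ≤ uᵢ² + uⱼ² bounds each term of the form. By symmetry
  -- only the row sums of A against w remain, and these are at most β w.
  rayleigh : ∀ {n} (A : Mat n) → (∀ i j → 0ℚ ≤ A i j) → Symmetric A → ∀ {w β} →
             (∀ i → 0ℚ < w i) → (∀ i → (A ∙ w) i ≤ β * w i) → ∀ y → form A y ≤ β * norm y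
  rayleigh A 0≤A sym-A {w} {β} 0<w Aw≤βw y = *-cancelˡ (+-pos 0<1 0<1) (begin
    (1ℚ + 1ℚ) * form A y
      ≡⟨ cong ((1ℚ + 1ℚ) *_) (∑-cong λ i → *-∑ (y i) (λ j → A i j * y j)) ⟩
    (1ℚ + 1ℚ) * ∑ (λ i → ∑ (λ j → y i * (A i j * y j)))
      ≡⟨ trans (*-∑ (1ℚ + 1ℚ) (λ i → ∑ (λ j → y i * (A i j * y j)))) (∑-cong λ i → *-∑ (1ℚ + 1ℚ) (λ j → y i * (A i j * y j))) ⟩
    ∑ (λ i → ∑ (λ j → (1ℚ + 1ℚ) * (y i * (A i j * y j))))
      ≤⟨ ∑-mono (λ i → ∑-mono (λ j → amgm i j)) ⟩
    ∑ (λ i → ∑ (λ j → half i j + half j i))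
      ≡⟨ trans (∑-cong λ i → ∑-+ (half i) (λ j → half j i)) (∑-+ (λ i → ∑ (half i)) (λ i → ∑ (λ j → half j i))) ⟩
    ∑ (λ i → ∑ (half i)) + ∑ (λ i → ∑ (λ j → half j i))
      ≡⟨ cong (∑ (λ i → ∑ (half i)) +_) (∑-swap half) ⟨
    ∑ (λ i → ∑ (half i)) + ∑ (λ i → ∑ (half i))
      ≤⟨ +-mono-≤ one-side one-side ⟩
    β * norm y + β * norm y
      ≡⟨ solve 1 (λ b → b :+ b := (con 1ℚ :+ con 1ℚ) :* b) refl (β * norm y) ⟩
    (1ℚ + 1ℚ) * (β * norm y) ∎)
    where
    open ≤-Reasoning
    w⁻¹ : Fin _ → ℚ
    w⁻¹ i = proj₁ (inverse (0<w i))
    u : Fin _ → ℚ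
    u i = y i * w⁻¹ i
    y≡wu : ∀ i → y i ≡ w i * u i
    y≡wu i = trans (sym (*-identityʳ (y i))) (trans (cong (y i *_) (sym (proj₂ (proj₂ (inverse (0<w i))))))
      (solve 3 (λ y w r → y :* (w :* r) := w :* (y :* r)) refl (y i) (w i) (w⁻¹ i)))
    half : Fin _ → Fin _ → ℚ
    half i j = w i * (u i * u i) * (A i j * w j)
    amgm : ∀ i j → (1ℚ + 1ℚ) * (y i * (A i j * y j)) ≤ half i j + half j i
    amgm i j = subst₂ _≤_ (cong₂ (λ p q → (1ℚ + 1ℚ) * (p * (A i j * q))) (sym (y≡wu i)) (sym (y≡wu j)))
      (cong (λ a → half i j + w j * (u j * u j) * (a * w i)) (sym-A i j))
      (by-≤ (*-nonneg (*-nonneg (*-nonneg (<⇒≤ (0<w i)) (<⇒≤ (0<w j))) (0≤A i j)) (sq-nonneg (u i - u j)))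
        (solve 5 (λ wi wj ui uj a → wi :* wj :* a :* ((ui :- uj) :* (ui :- uj)) :=
           wi :* (ui :* ui) :* (a :* wj) :+ wj :* (uj :* uj) :* (a :* wi) :- (con 1ℚ :+ con 1ℚ) :* (wi :* ui :* (a :* (wj :* uj)))) refl
           (w i) (w j) (u i) (u j) (A i j)))
    one-side : ∑ (λ i → ∑ (half i)) ≤ β * norm y
    one-side = begin
      ∑ (λ i → ∑ (half i))
        ≡⟨ ∑-cong (λ i → sym (*-∑ (w i * (u i * u i)) (λ j → A i j * w j))) ⟩
      ∑ (λ i → w i * (u i * u i) * (A ∙ w) i)
        ≤⟨ ∑-mono (λ i → *-monoˡ (*-nonneg (<⇒≤ (0<w i)) (sq-nonneg (u i))) (Aw≤βw i)) ⟩
      ∑ (λ i → w i * (u i * u i) * (β * w i))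
        ≡⟨ ∑-cong (λ i → trans (solve 3 (λ w u b → w :* (u :* u) :* (b :* w) := b :* (w :* u :* (w :* u))) refl (w i) (u i) β)
             (cong (λ p → β * (p * p)) (sym (y≡wu i)))) ⟩
      ∑ (λ i → β * (y i * y i))
        ≡⟨ *-∑ β (λ i → y i * y i) ⟨
      β * norm y ∎

  module Eigenpair {n} {𝔸 : Matrix n} {A : Mat n} (rep : Represents 𝔸 A) (o : Fin n) (P : PerronVectors A o) where
    open PerronVectors P

    wʳ : Fin n → ℝ
    wʳ i = mkℝ′ (λ s → w s i) (λ ε 0<ε → let N , c = w-cauchy 0<ε in N , λ s t N≤s N≤t → c s t N≤s N≤t i)

    x : Fin n → ℂ
    x i = fromℝ (wʳ i)

    -- Since w is 1 at o, the eigenvalue is the o-th coordinate of A w; taken as such, it is a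
    -- Cauchy sequence by the arithmetic of reals.
    λʳ : ℝ
    λʳ = re (sumᶜ (λ j → fromℝ (𝔸 o j) *ᶜ x j))

    seq-λʳ : ∀ s → seq λʳ s ≡ (A ∙ w s) o
    seq-λʳ = seq-re-row {𝔸 = 𝔸} rep x o

    K-nonneg : 0ℚ ≤ K
    K-nonneg = subst (0ℚ ≤_) (trans (cong (K *_) (w-first 0)) (*-identityʳ K))
      (≤-trans (<⇒≤ (w-pos 0 o)) (w-ratio 0 o o))

    w≤K : ∀ s i → w s i ≤ K
    w≤K s i = subst (w s i ≤_) (trans (cong (K *_) (w-first s)) (*-identityʳ K)) (w-ratio s i o)

    between : ∀ {δ α} s → (∀ i → α * w s i ≤ (A ∙ w s) i × (A ∙ w s) i ≤ (α + δ) * w s i) →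
              α ≤ (A ∙ w s) o × (A ∙ w s) o ≤ α + δ
    between {δ} {α} s b =
      subst (_≤ (A ∙ w s) o) (trans (cong (α *_) (w-first s)) (*-identityʳ α)) (proj₁ (b o)) ,
      subst ((A ∙ w s) o ≤_) (trans (cong ((α + δ) *_) (w-first s)) (*-identityʳ (α + δ))) (proj₂ (b o))

    residual : ∀ {δ α wi ai μ} → 0ℚ ≤ δ → 0ℚ ≤ wi → wi ≤ K → α ≤ μ → μ ≤ α + δ → α * wi ≤ ai → ai ≤ (α + δ) * wi →
               ∣ ai - μ * wi ∣ ≤ K * δ
    residual {δ} {α} {wi} {ai} {μ} 0≤δ 0≤wi wi≤K α≤μ μ≤ lo hi = ∣∣≤
      (≤-trans (by-≤ (+-nonneg (≤⇒0≤- hi) (*-nonneg 0≤wi (≤⇒0≤- α≤μ)))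
        (solve 5 (λ d a w x m → ((a :+ d) :* w :- x) :+ w :* (m :- a) := w :* d :- (x :- m :* w)) refl δ α wi ai μ))
        (*-monoʳ 0≤δ wi≤K))
      (≤-trans (neg-antimono-≤ (*-monoʳ 0≤δ wi≤K)) (by-≤ (+-nonneg (≤⇒0≤- lo) (*-nonneg 0≤wi (≤⇒0≤- μ≤)))
        (solve 5 (λ d a w x m → (x :- a :* w) :+ w :* ((a :+ d) :- m) := (x :- m :* w) :- (:- (w :* d))) refl δ α wi ai μ)))

    -- At stage s both (A w) i and μ w i, with μ = (A w) o, lie between α w i and (α + δ) w i, so
    -- they differ by at most Kδ.
    is-eigenvalue : IsEigenvalue 𝔸 (fromℝ λʳ)
    is-eigenvalue = x , nonzero , λ i → real-part i , imaginary-part i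
      where
      nonzero : ¬ (∀ i → x i ≈ᶜ′ Defs.0ᶜ)
      nonzero all-zero = let N , close = proj₁ (all-zero o) 1ℚ 0<1 in
        <-irrefl refl (subst (λ z → ∣ z - 0ℚ ∣ < 1ℚ) (w-first N) (close N ℕₚ.≤-refl))
      real-part : ∀ i → re (sumᶜ (λ j → fromℝ (𝔸 i j) *ᶜ x j)) ≈ʳ re (fromℝ λʳ *ᶜ x i)
      real-part i ε 0<ε =
        let δ , 0<δ , Kδ<ε = fraction K-nonneg 0<ε
            N , eig = eigen 0<δ
        in N , λ s N≤s →
           let α , b = eig s N≤s
               α≤μ , μ≤ = between s b
           in subst (λ z → ∣ z ∣ < ε)
                (cong₂ _-_ (sym (seq-re-row {𝔸 = 𝔸} rep x i s))
                  (trans (cong (_* w s i) (sym (seq-λʳ s))) (sym (re-scalar (seq λʳ s) (w s i) 0ℚ))))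
                (≤-<-trans (residual {δ} {α} {w s i} {(A ∙ w s) i} {(A ∙ w s) o} (<⇒≤ 0<δ) (<⇒≤ (w-pos s i)) (w≤K s i)
                   α≤μ μ≤ (proj₁ (b i)) (proj₂ (b i))) Kδ<ε)
      imaginary-part : ∀ i → im (sumᶜ (λ j → fromℝ (𝔸 i j) *ᶜ x j)) ≈ʳ im (fromℝ λʳ *ᶜ x i)
      imaginary-part i ε 0<ε = 0 , λ s _ → subst (λ z → ∣ z ∣ < ε)
        (sym (trans (cong₂ _-_
          (trans (seq-im-row {𝔸 = 𝔸} rep x i s) (trans (∑-cong λ j → *-zeroʳ (A i j)) (∑-zero n)))
          (solve 2 (λ l w → l :* con 0ℚ :+ con 0ℚ :* w := con 0ℚ) refl (seq λʳ s) (w s i))) (+-inverseʳ 0ℚ)))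
        0<ε

    -- The eigenvalue λʳ of the limiting vector dominates every Rayleigh quotient, because
    -- the positive vectors w s do, up to an error that tends to 0.
    rayleigh≤radius : (∀ i j → 0ℚ ≤ A i j) → Symmetric A → ∀ {ρ} → IsSpectralRadius 𝔸 ρ →
                      ∀ y {q} → 0ℚ < norm y → q * norm y ≤ form A y → fromℚ q ≤ʳ ρ
    rayleigh≤radius 0≤A sym-A {ρ} isρ y {q} 0<y qy≤ ε 0<ε =
      [ (λ le → le) , (λ { (D , 0<D , gap) → ⊥-elim (absurd 0<D gap) }) ]′ (separate (fromℚ q) ρ 0<ε)
      where
      open IsSpectralRadius isρ
      q≤λ : ∀ {δ} → 0ℚ < δ → ∃[ N ] (∀ s → N ℕ.≤ s → q ≤ seq λʳ s + δ)
      q≤λ {δ} 0<δ = let N , eig = eigen 0<δ in N , λ s N≤s →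
        let α , b = eig s N≤s
            q≤α+δ : q ≤ α + δ
            q≤α+δ = *-cancelˡ 0<y (subst₂ _≤_ (*-comm q (norm y)) (*-comm (α + δ) (norm y))
                      (≤-trans qy≤ (rayleigh A 0≤A sym-A {β = α + δ} (w-pos s) (λ i → proj₂ (b i)) y)))
        in ≤-trans q≤α+δ (+-monoˡ-≤ δ (subst (α ≤_) (sym (seq-λʳ s)) (proj₁ (between s b))))
      -- The hypotheses give l > r + 3d. At a finite stage the nonnegativity of ρ yields only r + d
      -- > 0, and the slack of 3d makes up for a slightly negative r when squares are compared.
      too-large : ∀ {d D l r} → 0ℚ < d → d + d + d + d ≡ D → q ≤ l + d → r + D < q → 0ℚ < r + d →
                  l * l + 0ℚ * 0ℚ < r * r + d * d → ⊥
      too-large {d} {D} {l} {r} 0<d 4d≡D q≤ r< 0<r+d sq = <⇒≱ sq (by-≤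
        (<⇒≤ (+-pos (+-pos (*-pos p₁ (+-pos p₂ 0<d)) (*-pos (+-pos (+-pos 0<d 0<d) 0<d) p₂)) (+-pos (*-pos 0<d 0<d) (*-pos 0<d 0<d))))
        (solve 3 (λ d l r → ((l :- (r :+ d :+ d :+ d)) :* ((l :+ r :- d) :+ d) :+ (d :+ d :+ d) :* (l :+ r :- d)) :+ (d :* d :+ d :* d)
           := l :* l :+ con 0ℚ :* con 0ℚ :- (r :* r :+ d :* d)) refl d l r))
        where
        p₁ : 0ℚ < l - (r + d + d + d)
        p₁ = subst (0ℚ <_) (trans (cong (λ D → (q - (r + D)) + (l + d - q)) (sym 4d≡D))
          (solve 4 (λ q r d l → (q :- (r :+ (d :+ d :+ d :+ d))) :+ (l :+ d :- q) := l :- (r :+ d :+ d :+ d)) refl q r d l))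
          (+-pos-nonneg (<⇒0<- r<) (≤⇒0≤- q≤))
        p₂ : 0ℚ < l + r - d
        p₂ = subst (0ℚ <_) (solve 3 (λ l r d → (l :- (r :+ d :+ d :+ d)) :+ ((r :+ d) :+ (r :+ d)) := l :+ r :- d) refl l r d)
          (+-pos p₁ (+-pos 0<r+d 0<r+d))
      absurd : ∀ {D} → 0ℚ < D → ∃[ N ] (∀ n → N ℕ.≤ n → seq ρ n + D < q) → ⊥
      absurd {D} 0<D gap =
        let d , 0<d , 4d≡D = part 0<D
            N , ev = (gap ⊔₂ nonneg d 0<d) ⊔₂ (q≤λ 0<d ⊔₂ maximal (fromℝ λʳ) is-eigenvalue (d * d) (*-pos 0<d 0<d))
            (gapₙ , nonnegₙ) , (q≤ₙ , maxₙ) = ev N ℕₚ.≤-refl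
        in too-large {l = seq λʳ N} {seq ρ N} 0<d 4d≡D q≤ₙ gapₙ nonnegₙ maxₙ

  -- The triangle inequality for ∑ pⱼzⱼ with zⱼ = cⱼ + i dⱼ, squared to avoid roots. Expanded into
  -- double sums it holds entry by entry, because the real part of zⱼ times the conjugate of zₖ is
  -- at most (∣zⱼ∣² + ∣zₖ∣²) / 2.
  squared-sums : ∀ {n} (p c d : Fin n → ℚ) {M} → (∀ j → 0ℚ ≤ p j) → (∀ j → c j * c j + d j * d j ≤ M) →
                 ∑ (λ j → p j * c j) * ∑ (λ j → p j * c j) + ∑ (λ j → p j * d j) * ∑ (λ j → p j * d j) ≤ M * (∑ p * ∑ p)
  squared-sums p c d {M} 0≤p bound = begin
    ∑ (λ j → p j * c j) * ∑ (λ j → p j * c j) + ∑ (λ j → p j * d j) * ∑ (λ j → p j * d j)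
      ≡⟨ cong₂ _+_ (product c) (product d) ⟩
    ∑ (λ j → ∑ (λ k → p j * c j * (p k * c k))) + ∑ (λ j → ∑ (λ k → p j * d j * (p k * d k)))
      ≡⟨ trans (∑-cong λ j → ∑-+ (λ k → p j * c j * (p k * c k)) (λ k → p j * d j * (p k * d k)))
           (∑-+ (λ j → ∑ (λ k → p j * c j * (p k * c k))) (λ j → ∑ (λ k → p j * d j * (p k * d k)))) ⟨
    ∑ (λ j → ∑ (λ k → p j * c j * (p k * c k) + p j * d j * (p k * d k)))
      ≤⟨ ∑-mono (λ j → ∑-mono (λ k → entry j k)) ⟩
    ∑ (λ j → ∑ (λ k → M * (p j * p k)))
      ≡⟨ trans (∑-cong λ j → sym (*-∑ M (λ k → p j * p k))) (sym (*-∑ M (λ j → ∑ (λ k → p j * p k)))) ⟩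
    M * ∑ (λ j → ∑ (λ k → p j * p k))
      ≡⟨ cong (M *_) (trans (∑-* p (∑ p)) (∑-cong λ j → *-∑ (p j) p)) ⟨
    M * (∑ p * ∑ p) ∎
    where
    open ≤-Reasoning
    product : ∀ e → ∑ (λ j → p j * e j) * ∑ (λ j → p j * e j) ≡ ∑ (λ j → ∑ (λ k → p j * e j * (p k * e k)))
    product e = trans (∑-* (λ j → p j * e j) (∑ (λ j → p j * e j))) (∑-cong λ j → *-∑ (p j * e j) (λ k → p k * e k))
    entry : ∀ j k → p j * c j * (p k * c k) + p j * d j * (p k * d k) ≤ M * (p j * p k)
    entry j k = *-cancelˡ (+-pos 0<1 0<1) (by-≤
      (*-nonneg (*-nonneg (0≤p j) (0≤p k)) (+-nonneg (+-nonneg (≤⇒0≤- (bound j)) (≤⇒0≤- (bound k)))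
        (+-nonneg (sq-nonneg (c j - c k)) (sq-nonneg (d j - d k)))))
      (solve 7 (λ pj pk cj ck dj dk M → pj :* pk :* (((M :- (cj :* cj :+ dj :* dj)) :+ (M :- (ck :* ck :+ dk :* dk))) :+ ((cj :- ck) :* (cj :- ck) :+ (dj :- dk) :* (dj :- dk)))
        := (con 1ℚ :+ con 1ℚ) :* (M :* (pj :* pk)) :- (con 1ℚ :+ con 1ℚ) :* (pj :* cj :* (pk :* ck) :+ pj :* dj :* (pk :* dk))) refl (p j) (p k) (c j) (c k) (d j) (d k) M))

  -- P² ≤ (1 + 1/k) u² + (1 + k)(u - P)², cleared of the denominator. A large k makes the loss in
  -- the main term small at the expense of the error term.
  perturbed-square : ∀ k {P u e} → 0ℚ ≤ k → 0ℚ ≤ e → ∣ u - P ∣ < e →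
                     k * (P * P) ≤ (k + 1ℚ) * (u * u) + k * (k + 1ℚ) * (e * e)
  perturbed-square k {P} {u} {e} 0≤k 0≤e near = ≤-trans
    (by-≤ (sq-nonneg (u + k * (u - P)))
      (solve 3 (λ k P u → (u :+ k :* (u :- P)) :* (u :+ k :* (u :- P)) := (k :+ con 1ℚ) :* (u :* u) :+ k :* (k :+ con 1ℚ) :* ((u :- P) :* (u :- P)) :- k :* (P :* P)) refl k P u))
    (+-monoʳ-≤ ((k + 1ℚ) * (u * u)) (*-monoˡ (*-nonneg 0≤k (+-nonneg 0≤k 0≤1)) D²≤e²))
    where
    D²≤e² : (u - P) * (u - P) ≤ e * e
    D²≤e² = subst (_≤ e * e) (trans (sym (∣p*q∣≡∣p∣*∣q∣ (u - P) (u - P))) (0≤p⇒∣p∣≡p (sq-nonneg (u - P))))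
      (*-mono (0≤∣p∣ (u - P)) (<⇒≤ near) (0≤∣p∣ (u - P)) (<⇒≤ near))

  -- Collatz–Wielandt: A W ≤ r W bounds every eigenvalue by r, by looking at an index where
  -- ∣x i∣ / W i is maximal. At a finite stage of the Cauchy sequences the eigenvalue equation
  -- holds only approximately, so the conclusion is that an eigenvector for a larger
  -- eigenvalue tends to 0.
  module Collatz {n} {A : Mat n} (0≤A : ∀ i j → 0ℚ ≤ A i j) {W : Vec n} (0<W : ∀ i → 0ℚ < W i) {r : ℚ}
                 (AW≤rW : ∀ i → (A ∙ W) i ≤ r * W i) where

    W⁻¹ : Fin n → ℚ
    W⁻¹ i = proj₁ (inverse (0<W i))

    unscale : ∀ (a : Vec n) i → a i ≡ W i * (a i * W⁻¹ i)
    unscale a i = trans (sym (*-identityʳ (a i))) (trans (cong (a i *_) (sym (proj₂ (proj₂ (inverse (0<W i))))))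
      (solve 3 (λ y w r → y :* (w :* r) := w :* (y :* r)) refl (a i) (W i) (W⁻¹ i)))

    -- `gap` asks that k∣z∣² exceed (k + 1) r² by 1. The factors k and k + 1 absorb the loss in
    -- `perturbed-square`, and the 1 left over bounds ∣xᵢ∣² itself by the error.
    module Approximate (a b : Vec n) {zr zi k e : ℚ} (0≤k : 0ℚ ≤ k) (0≤e : 0ℚ ≤ e)
      (re-close : ∀ i → ∣ (A ∙ a) i - (zr * a i - zi * b i) ∣ < e)
      (im-close : ∀ i → ∣ (A ∙ b) i - (zr * b i + zi * a i) ∣ < e)
      (gap : (k + 1ℚ) * (r * r) + 1ℚ ≤ k * (zr * zr + zi * zi)) where

      ratio : Fin n → ℚ
      ratio i = (a i * W⁻¹ i) * (a i * W⁻¹ i) + (b i * W⁻¹ i) * (b i * W⁻¹ i)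

      ratio-nonneg : ∀ i → 0ℚ ≤ ratio i
      ratio-nonneg i = +-nonneg (sq-nonneg (a i * W⁻¹ i)) (sq-nonneg (b i * W⁻¹ i))

      modulus : ∀ i → a i * a i + b i * b i ≡ ratio i * (W i * W i)
      modulus i = trans (cong₂ _+_ (cong₂ _*_ (unscale a i) (unscale a i)) (cong₂ _*_ (unscale b i) (unscale b i)))
        (solve 3 (λ w c d → (w :* c) :* (w :* c) :+ (w :* d) :* (w :* d) := (c :* c :+ d :* d) :* (w :* w)) refl (W i) (a i * W⁻¹ i) (b i * W⁻¹ i))

      row-bound : ∀ {M} → (∀ j → ratio j ≤ M) → ∀ i →
                  (A ∙ a) i * (A ∙ a) i + (A ∙ b) i * (A ∙ b) i ≤ M * (r * r * (W i * W i))
      row-bound {M} max i = begin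
        (A ∙ a) i * (A ∙ a) i + (A ∙ b) i * (A ∙ b) i
          ≡⟨ cong₂ (λ p q → p * p + q * q) (rescale a) (rescale b) ⟩
        _ ≤⟨ squared-sums (λ j → A i j * W j) (λ j → a j * W⁻¹ j) (λ j → b j * W⁻¹ j)
              (λ j → *-nonneg (0≤A i j) (<⇒≤ (0<W j))) max ⟩
        M * ((A ∙ W) i * (A ∙ W) i)
          ≤⟨ *-monoˡ (≤-trans (ratio-nonneg i) (max i)) (*-mono 0≤AW (AW≤rW i) 0≤AW (AW≤rW i)) ⟩
        M * (r * W i * (r * W i))
          ≡⟨ cong (M *_) (solve 2 (λ r w → r :* w :* (r :* w) := r :* r :* (w :* w)) refl r (W i)) ⟩
        M * (r * r * (W i * W i)) ∎
        where
        open ≤-Reasoning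
        0≤AW : 0ℚ ≤ (A ∙ W) i
        0≤AW = ∑-nonneg (λ j → *-nonneg (0≤A i j) (<⇒≤ (0<W j)))
        rescale : ∀ a → (A ∙ a) i ≡ ∑ (λ j → A i j * W j * (a j * W⁻¹ j))
        rescale a = ∑-cong λ j → trans (cong (A i j *_) (unscale a j)) (sym (*-assoc (A i j) (W j) (a j * W⁻¹ j)))

      E : ℚ
      E = k * (k + 1ℚ) * (e * e) + k * (k + 1ℚ) * (e * e)

      ratio-bound : ∀ i → (∀ j → ratio j ≤ ratio i) → ratio i * (W i * W i) ≤ E
      ratio-bound i max = begin
        m                                                     ≡⟨ solve 2 (λ m s → m := s :* m :+ con 1ℚ :* m :- s :* m) refl m s ⟩
        s * m + 1ℚ * m - s * m                                ≡⟨ cong (_- s * m) (*-distribʳ-+ m s 1ℚ) ⟨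
        (s + 1ℚ) * m - s * m                                  ≤⟨ +-monoˡ-≤ (- (s * m)) (*-monoʳ 0≤m gap) ⟩
        k * (zr * zr + zi * zi) * m - s * m                   ≡⟨ cong (λ p → k * (zr * zr + zi * zi) * p - s * m) (modulus i) ⟨
        k * (zr * zr + zi * zi) * (a i * a i + b i * b i) - s * m
          ≡⟨ cong (_- s * m) (solve 5 (λ k p q a b → k :* (p :* p :+ q :* q) :* (a :* a :+ b :* b)
               := k :* ((p :* a :- q :* b) :* (p :* a :- q :* b)) :+ k :* ((p :* b :+ q :* a) :* (p :* b :+ q :* a))) refl k zr zi (a i) (b i)) ⟩
        k * (P * P) + k * (Q * Q) - s * m
          ≤⟨ +-monoˡ-≤ (- (s * m)) (+-mono-≤ (perturbed-square k {P} {u} 0≤k 0≤e (re-close i)) (perturbed-square k {Q} {v} 0≤k 0≤e (im-close i))) ⟩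
        ((k + 1ℚ) * (u * u) + T) + ((k + 1ℚ) * (v * v) + T) - s * m
          ≡⟨ cong (_- s * m) (solve 4 (λ k u v T → ((k :+ con 1ℚ) :* (u :* u) :+ T) :+ ((k :+ con 1ℚ) :* (v :* v) :+ T)
               := (k :+ con 1ℚ) :* (u :* u :+ v :* v) :+ (T :+ T)) refl k u v T) ⟩
        (k + 1ℚ) * (u * u + v * v) + E - s * m
          ≤⟨ +-monoˡ-≤ (- (s * m)) (+-monoˡ-≤ E (*-monoˡ (+-nonneg 0≤k 0≤1) (row-bound max i))) ⟩
        (k + 1ℚ) * (ratio i * (r * r * (W i * W i))) + E - s * m
          ≡⟨ solve 5 (λ k q r w E → (k :+ con 1ℚ) :* (q :* (r :* r :* (w :* w))) :+ E :- (k :+ con 1ℚ) :* (r :* r) :* (q :* (w :* w)) := E) refl k (ratio i) r (W i) E ⟩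
        E ∎
        where
        open ≤-Reasoning
        m = ratio i * (W i * W i)
        s = (k + 1ℚ) * (r * r)
        T = k * (k + 1ℚ) * (e * e)
        u = (A ∙ a) i
        v = (A ∙ b) i
        P = zr * a i - zi * b i
        Q = zr * b i + zi * a i
        0≤m : 0ℚ ≤ m
        0≤m = *-nonneg (ratio-nonneg i) (sq-nonneg (W i))

    square-cancel-< : ∀ {a ε ω} → 0ℚ < ω → 0ℚ < ε → a * a * ω < ω * (ε * ε) → ∣ a - 0ℚ ∣ < ε
    square-cancel-< {a} {ε} {ω} 0<ω 0<ε lt = ≰⇒> λ ε≤ → <⇒≱ lt (subst (_≤ a * a * ω) (*-comm (ε * ε) ω)
      (*-monoʳ (<⇒≤ 0<ω) (subst (ε * ε ≤_)
        (trans (sym (∣p*q∣≡∣p∣*∣q∣ (a - 0ℚ) (a - 0ℚ))) (trans (0≤p⇒∣p∣≡p (sq-nonneg (a - 0ℚ)))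
          (solve 1 (λ a → (a :- con 0ℚ) :* (a :- con 0ℚ) := a :* a) refl a)))
        (*-mono (<⇒≤ 0<ε) ε≤ (<⇒≤ 0<ε) ε≤))))

    module Radius {𝔸 : Matrix n} (rep : Represents 𝔸 A) (o : Fin n) {ρ : ℝ} (z : ℂ) (x : Fin n → ℂ)
                  (eigen-equation : ∀ i → sumᶜ (λ j → fromℝ (𝔸 i j) *ᶜ x j) ≈ᶜ′ z *ᶜ x i)
                  (modulus≈ρ² : Defs.∣ z ∣² ≈ʳ ρ *ʳ ρ)
                  {q : ℚ} (r<q : r < q) (q≤ρ : fromℚ q ≤ʳ ρ) where

      0≤r : 0ℚ ≤ r
      0≤r = *-cancelˡ (0<W o) (subst₂ _≤_ (sym (*-zeroʳ (W o))) (*-comm r (W o))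
        (≤-trans (∑-nonneg (λ j → *-nonneg (0≤A o j) (<⇒≤ (0<W j)))) (AW≤rW o)))

      quarter = part (<⇒0<- r<q)
      d = proj₁ quarter
      0<d : 0ℚ < d
      0<d = proj₁ (proj₂ quarter)
      4d≡q-r : d + d + d + d ≡ q - r
      4d≡q-r = proj₂ (proj₂ quarter)

      d²⁻¹ = inverse (*-pos 0<d 0<d)

      -- With k d² = 1 + r² one has k (r² + d²) = (k + 1) r² + 1, so ∣z∣² ≥ r² + d² is enough for
      -- the gap.
      k : ℚ
      k = (1ℚ + r * r) * proj₁ d²⁻¹

      0≤k : 0ℚ ≤ k
      0≤k = *-nonneg (+-nonneg 0≤1 (sq-nonneg r)) (<⇒≤ (proj₁ (proj₂ d²⁻¹)))

      kd²≡ : k * (d * d) ≡ 1ℚ + r * r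
      kd²≡ = trans (solve 3 (λ a b c → a :* b :* c := a :* (c :* b)) refl (1ℚ + r * r) (proj₁ d²⁻¹) (d * d))
        (trans (cong ((1ℚ + r * r) *_) (proj₂ (proj₂ d²⁻¹))) (*-identityʳ (1ℚ + r * r)))

      modulus-gap : ∀ {ρₜ Z} → q < ρₜ + d → ∣ Z - ρₜ * ρₜ ∣ < d * d → (k + 1ℚ) * (r * r) + 1ℚ ≤ k * Z
      modulus-gap {ρₜ} {Z} q<ρ near = subst (_≤ k * Z)
        (trans (*-distribˡ-+ k (r * r) (d * d)) (trans (cong (k * (r * r) +_) kd²≡)
          (solve 2 (λ k r → k :* (r :* r) :+ (con 1ℚ :+ r :* r) := (k :+ con 1ℚ) :* (r :* r) :+ con 1ℚ) refl k r)))
        (*-monoˡ 0≤k (by-≤ (+-nonneg (+-nonneg (<⇒≤ (<⇒0<- ρ²<)) (*-nonneg 0≤s (+-nonneg (+-nonneg 0≤s 0≤r) 0≤r)))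
            (+-nonneg (*-nonneg (<⇒≤ 0<d) (+-nonneg (+-nonneg (+-nonneg 0≤s+r 0≤s+r) 0≤s+r) 0≤s+r)) (+-nonneg (sq-nonneg d) (sq-nonneg d))))
          (expand ρₜ Z)))
        where
        ρ²< : ρₜ * ρₜ < Z + d * d
        ρ²< = ∣-∣<⇒< (subst (_< d * d) (∣-∣-sym Z (ρₜ * ρₜ)) near)
        s = ρₜ - r - (d + d)
        0≤s : 0ℚ ≤ s
        0≤s = ≤-trans (<⇒≤ (+-pos (<⇒0<- q<ρ) 0<d)) (≤-reflexive (trans
          (solve 4 (λ q r ρ d → (ρ :+ d :- q) :+ d := ρ :- r :- (d :+ d) :+ ((d :+ d :+ d :+ d) :- (q :- r))) refl q r ρₜ d)
          (trans (cong (λ p → s + (p - (q - r))) 4d≡q-r) (solve 2 (λ s p → s :+ (p :- p) := s) refl s (q - r)))))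
        0≤s+r : 0ℚ ≤ s + r
        0≤s+r = +-nonneg 0≤s 0≤r
        expand : ∀ ρₜ Z → let s = ρₜ - r - (d + d) in
          ((Z + d * d - ρₜ * ρₜ) + s * (s + r + r)) + (d * ((s + r) + (s + r) + (s + r) + (s + r)) + (d * d + d * d)) ≡ Z - (r * r + d * d)
        expand = λ ρₜ Z → solve 4 (λ ρ Z r d → ((Z :+ d :* d :- ρ :* ρ) :+ (ρ :- r :- (d :+ d)) :* ((ρ :- r :- (d :+ d)) :+ r :+ r))
          :+ (d :* (((ρ :- r :- (d :+ d)) :+ r) :+ ((ρ :- r :- (d :+ d)) :+ r) :+ ((ρ :- r :- (d :+ d)) :+ r) :+ ((ρ :- r :- (d :+ d)) :+ r)) :+ (d :* d :+ d :* d))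
          := Z :- (r :* r :+ d :* d)) refl ρₜ Z r d

      least = minimum o (λ i → W i * W i)
      ω Wsup C : ℚ
      ω = W (proj₁ least) * W (proj₁ least)
      Wsup = ∑ (λ i → W i * W i)
      C = (k * (k + 1ℚ) + k * (k + 1ℚ)) * Wsup

      0<ω : 0ℚ < ω
      0<ω = *-pos (0<W (proj₁ least)) (0<W (proj₁ least))

      0≤Wsup : 0ℚ ≤ Wsup
      0≤Wsup = ∑-nonneg (λ i → sq-nonneg (W i))

      0≤C : 0ℚ ≤ C
      0≤C = *-nonneg (+-nonneg 0≤kk 0≤kk) 0≤Wsup
        where 0≤kk = *-nonneg 0≤k (+-nonneg 0≤k 0≤1)

      -- Dividing by C + ω gives both σ ≤ 1 and Cσ < ω, hence Cσ² < ω. Residuals below σε then force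
      -- all coordinates below ε.
      tolerance = fraction (+-nonneg 0≤C (<⇒≤ 0<ω)) 0<ω
      σ : ℚ
      σ = proj₁ tolerance
      0<σ : 0ℚ < σ
      0<σ = proj₁ (proj₂ tolerance)

      Cσ²<ω : C * (σ * σ) < ω
      Cσ²<ω = ≤-<-trans (*-monoˡ 0≤C (subst (σ * σ ≤_) (*-identityˡ σ) (*-monoʳ (<⇒≤ 0<σ) σ≤1)))
        (≤-<-trans (*-monoʳ (<⇒≤ 0<σ) (subst (_≤ C + ω) (+-identityʳ C) (+-monoʳ-≤ C (<⇒≤ 0<ω)))) (proj₂ (proj₂ tolerance)))
        where
        σ≤1 : σ ≤ 1ℚ
        σ≤1 = *-cancelˡ 0<ω (≤-trans (*-monoʳ (<⇒≤ 0<σ) (subst (_≤ C + ω) (+-identityˡ ω) (+-monoˡ-≤ ω 0≤C)))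
          (subst ((C + ω) * σ ≤_) (sym (*-identityʳ ω)) (<⇒≤ (proj₂ (proj₂ tolerance)))))

      reₓ imₓ : ℕ → Vec n
      reₓ t i = seq (re (x i)) t
      imₓ t i = seq (im (x i)) t

      zr zi : ℕ → ℚ
      zr t = seq (re z) t
      zi t = seq (im z) t

      Residual : ℚ → ℕ → Fin n → Set
      Residual e t i = ∣ (A ∙ reₓ t) i - (zr t * reₓ t i - zi t * imₓ t i) ∣ < e ×
                       ∣ (A ∙ imₓ t) i - (zr t * imₓ t i + zi t * reₓ t i) ∣ < e

      residual-small : ∀ {e} → 0ℚ < e → ∀ i → ∃[ N ] (∀ t → N ℕ.≤ t → Residual e t i)
      residual-small {e} 0<e i =
        let M , re-close = proj₁ (eigen-equation i) e 0<e
            N , im-close = proj₂ (eigen-equation i) e 0<e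
        in M ℕ.⊔ N , λ t le →
           subst (λ p → ∣ p - (zr t * reₓ t i - zi t * imₓ t i) ∣ < e) (seq-re-row {𝔸 = 𝔸} rep x i t) (re-close t (ℕₚ.m⊔n≤o⇒m≤o M N le)) ,
           subst (λ p → ∣ p - (zr t * imₓ t i + zi t * reₓ t i) ∣ < e) (seq-im-row {𝔸 = 𝔸} rep x i t) (im-close t (ℕₚ.m⊔n≤o⇒n≤o M N le))

      Gap : ℕ → Set
      Gap t = (k + 1ℚ) * (r * r) + 1ℚ ≤ k * (zr t * zr t + zi t * zi t)

      eventual-gap : ∃[ N ] (∀ t → N ℕ.≤ t → Gap t)
      eventual-gap =
        let M , q<ρ = q≤ρ d 0<d
            N , near = modulus≈ρ² (d * d) (*-pos 0<d 0<d)
        in M ℕ.⊔ N , λ t le → modulus-gap {seq ρ t} {zr t * zr t + zi t * zi t}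
             (q<ρ t (ℕₚ.m⊔n≤o⇒m≤o M N le)) (near t (ℕₚ.m⊔n≤o⇒n≤o M N le))

      small : ∀ {ε} → 0ℚ < ε → ∃[ N ] (∀ t → N ℕ.≤ t → ∀ i → ∣ reₓ t i - 0ℚ ∣ < ε × ∣ imₓ t i - 0ℚ ∣ < ε)
      small {ε} 0<ε =
        let N , ev = _⊔₂_ {Gap} {λ t → ∀ i → Residual (σ * ε) t i} eventual-gap
                       (allF {P = λ i t → Residual (σ * ε) t i} (residual-small (*-pos 0<σ 0<ε)))
        in N , λ t N≤t i → conclude (reₓ t) (imₓ t) (zr t) (zi t) 0<ε i
             (λ i → proj₁ (proj₂ (ev t N≤t) i)) (λ i → proj₂ (proj₂ (ev t N≤t) i)) (proj₁ (ev t N≤t))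
        where
        conclude : ∀ a b zr zi → 0ℚ < ε → ∀ i →
          (∀ i → ∣ (A ∙ a) i - (zr * a i - zi * b i) ∣ < σ * ε) →
          (∀ i → ∣ (A ∙ b) i - (zr * b i + zi * a i) ∣ < σ * ε) →
          (k + 1ℚ) * (r * r) + 1ℚ ≤ k * (zr * zr + zi * zi) → ∣ a i - 0ℚ ∣ < ε × ∣ b i - 0ℚ ∣ < ε
        conclude a b zr zi 0<ε i re-close im-close gap =
          square-cancel-< {a i} 0<ω 0<ε (≤-<-trans (*-monoʳ (<⇒≤ 0<ω) (by-≤ {a i * a i} {a i * a i + b i * b i} (sq-nonneg (b i)) (solve 2 (λ a b → b := a :+ b :- a) refl (a i * a i) (b i * b i)))) both) ,
          square-cancel-< {b i} 0<ω 0<ε (≤-<-trans (*-monoʳ (<⇒≤ 0<ω) (by-≤ {b i * b i} {a i * a i + b i * b i} (sq-nonneg (a i)) (solve 2 (λ a b → a := a :+ b :- b) refl (a i * a i) (b i * b i)))) both)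
          where
          open Approximate a b {zr} {zi} {k} {σ * ε} 0≤k (*-nonneg (<⇒≤ 0<σ) (<⇒≤ 0<ε)) re-close im-close gap
          top = maximum o ratio
          m = proj₁ top
          both : (a i * a i + b i * b i) * ω < ω * (ε * ε)
          both = begin-strict
            (a i * a i + b i * b i) * ω          ≡⟨ cong (_* ω) (modulus i) ⟩
            ratio i * (W i * W i) * ω            ≡⟨ solve 3 (λ p w o → p :* w :* o := p :* o :* w) refl (ratio i) (W i * W i) ω ⟩
            ratio i * ω * (W i * W i)            ≤⟨ *-monoʳ (sq-nonneg (W i)) (*-mono (ratio-nonneg i) (proj₂ top i) (<⇒≤ 0<ω) (proj₂ least m)) ⟩
            ratio m * (W m * W m) * (W i * W i)  ≤⟨ *-mono (*-nonneg (ratio-nonneg m) (sq-nonneg (W m))) (ratio-bound m (proj₂ top)) (sq-nonneg (W i)) (term≤∑ (λ j → sq-nonneg (W j)) i) ⟩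
            E * Wsup                             ≡⟨ solve 4 (λ k s e W → (k :* (k :+ con 1ℚ) :* (s :* e :* (s :* e)) :+ k :* (k :+ con 1ℚ) :* (s :* e :* (s :* e))) :* W
                                                      := (k :* (k :+ con 1ℚ) :+ k :* (k :+ con 1ℚ)) :* W :* (s :* s) :* (e :* e)) refl k σ ε Wsup ⟩
            C * (σ * σ) * (ε * ε)                <⟨ *-monoˡ-<-pos (ε * ε) {{positive (*-pos 0<ε 0<ε)}} Cσ²<ω ⟩
            ω * (ε * ε)                          ∎
            where open ≤-Reasoning

      vanishes : ∀ i → x i ≈ᶜ′ Defs.0ᶜ
      vanishes i =
        (λ ε 0<ε → let N , le = small 0<ε in N , λ t N≤t → proj₁ (le t N≤t i)) ,
        (λ ε 0<ε → let N , le = small 0<ε in N , λ t N≤t → proj₂ (le t N≤t i))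

    radius≤ : ∀ {𝔸 : Matrix n} → Represents 𝔸 A → Fin n → ∀ {ρ} → IsSpectralRadius 𝔸 ρ →
              ∀ {q} → r < q → ¬ (fromℚ q ≤ʳ ρ)
    radius≤ {𝔸} rep o {ρ} isρ r<q q≤ρ =
      let z , (x , nonzero , eq) , modulus≈ρ² = IsSpectralRadius.attained isρ
      in nonzero (Radius.vanishes {𝔸} rep o {ρ} z x eq modulus≈ρ² r<q q≤ρ)

-- Strict comparison of two spectral radii by perturbing one coordinate

module RadiusComparison where

  open RationalArithmetic
  open PowerIteration
  open SpectralBounds
  import Defs
  open import Defs using (fromℚ; Matrix; IsSpectralRadius) renaming (_≤_ to _≤ʳ_)
  open import Data.Bool.Base using (if_then_else_)
  open import Data.Fin.Permutation using (Permutation; _⟨$⟩ʳ_)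
  open import Data.Rational.Base
  open import Data.Rational.Properties
  open import Data.Rational.Solver using (module +-*-Solver)
  open +-*-Solver

  δ : ∀ {n} → Fin n → Vec n
  δ v i = if does (v ≟ᶠ i) then 1ℚ else 0ℚ

  ∑-δ : ∀ {n} (f : Vec n) v → ∑ (λ i → f i * δ v i) ≡ f v
  ∑-δ {suc n} f zero = begin
    f zero * 1ℚ + ∑ (λ i → f (suc i) * 0ℚ)  ≡⟨ cong₂ _+_ (*-identityʳ (f zero)) (trans (∑-cong λ i → *-zeroʳ (f (suc i))) (∑-zero n)) ⟩
    f zero + 0ℚ                             ≡⟨ +-identityʳ (f zero) ⟩
    f zero                                  ∎
    where open ≡-Reasoning
  ∑-δ {suc n} f (suc v) = trans (cong₂ _+_ (*-zeroʳ (f zero)) (∑-δ (λ i → f (suc i)) v)) (+-identityˡ (f (suc v)))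

  module Perturb {n} (B : Mat n) (sym-B : Symmetric B) (y : Vec n) (v : Fin n) (τ : ℚ) where

    bump : Vec n
    bump i = y i + τ * δ v i

    ∑-bump : ∀ f → ∑ (λ i → f i * bump i) ≡ ∑ (λ i → f i * y i) + τ * f v
    ∑-bump f = begin
      ∑ (λ i → f i * (y i + τ * δ v i))
        ≡⟨ ∑-cong (λ i → solve 4 (λ f y t d → f :* (y :+ t :* d) := f :* y :+ t :* (f :* d)) refl (f i) (y i) τ (δ v i)) ⟩
      ∑ (λ i → f i * y i + τ * (f i * δ v i))
        ≡⟨ ∑-+ (λ i → f i * y i) (λ i → τ * (f i * δ v i)) ⟩
      ∑ (λ i → f i * y i) + ∑ (λ i → τ * (f i * δ v i))
        ≡⟨ cong (∑ (λ i → f i * y i) +_) (trans (sym (*-∑ τ (λ i → f i * δ v i))) (cong (τ *_) (∑-δ f v))) ⟩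
      ∑ (λ i → f i * y i) + τ * f v ∎
      where open ≡-Reasoning

    norm-bump : norm bump ≡ norm y + (τ * (y v + y v) + τ * τ)
    norm-bump = begin
      ∑ (λ i → bump i * bump i)                    ≡⟨ ∑-bump bump ⟩
      ∑ (λ i → bump i * y i) + τ * bump v          ≡⟨ cong (_+ τ * bump v) (trans (∑-cong λ i → *-comm (bump i) (y i)) (∑-bump y)) ⟩
      norm y + τ * y v + τ * bump v                ≡⟨ cong (λ z → norm y + τ * y v + τ * z) bump-v ⟩
      norm y + τ * y v + τ * (y v + τ)             ≡⟨ solve 3 (λ N y t → N :+ t :* y :+ t :* (y :+ t) := N :+ (t :* (y :+ y) :+ t :* t)) refl (norm y) (y v) τ ⟩
      norm y + (τ * (y v + y v) + τ * τ)           ∎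
      where
      open ≡-Reasoning
      δ-refl : ∀ {n} (v : Fin n) → δ v v ≡ 1ℚ
      δ-refl zero    = refl
      δ-refl (suc v) = δ-refl v
      bump-v : bump v ≡ y v + τ
      bump-v = cong (y v +_) (trans (cong (τ *_) (δ-refl v)) (*-identityʳ τ))

    form-bump : form B bump ≡ form B y + (τ * ((B ∙ y) v + (B ∙ y) v) + τ * τ * B v v)
    form-bump = begin
      ∑ (λ i → bump i * (B ∙ bump) i)
        ≡⟨ ∑-cong (λ i → trans (cong (bump i *_) (∑-bump (B i))) (*-comm (bump i) ((B ∙ y) i + τ * B i v))) ⟩
      ∑ (λ i → ((B ∙ y) i + τ * B i v) * bump i)
        ≡⟨ ∑-bump (λ i → (B ∙ y) i + τ * B i v) ⟩
      ∑ (λ i → ((B ∙ y) i + τ * B i v) * y i) + τ * ((B ∙ y) v + τ * B v v)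
        ≡⟨ cong (_+ τ * ((B ∙ y) v + τ * B v v)) (trans
             (∑-cong λ i → trans (solve 4 (λ p t b y → (p :+ t :* b) :* y := y :* p :+ t :* (b :* y)) refl ((B ∙ y) i) τ (B i v) (y i))
               (cong (λ b → y i * (B ∙ y) i + τ * (b * y i)) (sym-B i v)))
             (trans (∑-+ (λ i → y i * (B ∙ y) i) (λ i → τ * (B v i * y i)))
               (cong (form B y +_) (sym (*-∑ τ (λ i → B v i * y i)))))) ⟩
      form B y + τ * (B ∙ y) v + τ * ((B ∙ y) v + τ * B v v)
        ≡⟨ solve 4 (λ F t p b → F :+ t :* p :+ t :* (p :+ t :* b) := F :+ (t :* (p :+ p) :+ t :* t :* b)) refl (form B y) τ ((B ∙ y) v) (B v v) ⟩
      form B y + (τ * ((B ∙ y) v + (B ∙ y) v) + τ * τ * B v v) ∎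
      where open ≡-Reasoning

  -- The gain makes the comparison strict: it is the derivative of the form of B in the
  -- direction of one coordinate, so a small increase of that coordinate helps B more than A.
  record Improvement {n k} (A : Mat n) (B : Mat k) (c : ℚ) (y : Vec n) : Set where
    field
      y′     : Vec k
      norm-≡ : norm y′ ≡ norm y
      form-≤ : form A y ≤ form B y′
      v      : Fin k
      i j    : Fin n
      y′v≡yi : y′ v ≡ y i
      gain   : (A ∙ y) i + c * y j ≤ (B ∙ y′) v

  module Separation {n k} {𝔸 : Matrix n} {A : Mat n} {𝔹 : Matrix k} {B : Mat k} (rep-A : Represents 𝔸 A) (rep-B : Represents 𝔹 B)
    (0≤A : ∀ i j → 0ℚ ≤ A i j) (A≤1 : ∀ i j → A i j ≤ 1ℚ) (0≤B : ∀ i j → 0ℚ ≤ B i j) (sym-B : Symmetric B)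
    {o : Fin n} (P : PerronVectors A o) {o′ : Fin k} (P′ : PerronVectors B o′) {c : ℚ} (0<c : 0ℚ < c) where

    open PerronVectors P

    0<K : 0ℚ < K
    0<K = subst (0ℚ <_) (trans (cong (K *_) (w-first 0)) (*-identityʳ K)) (<-≤-trans (w-pos 0 o) (w-ratio 0 o o))

    -- An upper bound for all lower quotients α. With t = c / D and τ = t y j, the second-order cost
    -- ατ² of the perturbation uses up at most half of the gain 2τ c y j.
    D : ℚ
    D = 1ℚ + ι n * K

    0<D : 0ℚ < D
    0<D = +-pos-nonneg 0<1 (*-nonneg (ι-nonneg n) (<⇒≤ 0<K))

    D-inverse = inverse 0<D
    D⁻¹ : ℚ
    D⁻¹ = proj₁ D-inverse
    0<D⁻¹ : 0ℚ < D⁻¹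
    0<D⁻¹ = proj₁ (proj₂ D-inverse)
    DD⁻¹≡1 : D * D⁻¹ ≡ 1ℚ
    DD⁻¹≡1 = proj₂ (proj₂ D-inverse)

    t : ℚ
    t = c * D⁻¹

    0<t : 0ℚ < t
    0<t = *-pos 0<c 0<D⁻¹

    -- Bounds the squared norm of the perturbed vector in units of (y j)², by means of the ratio
    -- bound K.
    Q : ℚ
    Q = ι n * (K * K) + (t * (K + K) + t * t)

    0<Q : 0ℚ < Q
    0<Q = subst (0ℚ <_) (+-comm (t * (K + K) + t * t) (ι n * (K * K)))
      (+-pos-nonneg (+-pos (*-pos 0<t (+-pos 0<K 0<K)) (*-pos 0<t 0<t)) (*-nonneg (ι-nonneg n) (sq-nonneg K)))

    Q-inverse = inverse 0<Q
    -- The other half of the gain, c t (y j)², divided by the bound Q (y j)² for the norm. Neither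
    -- the stage of the sequence nor the coordinates of the improvement enter.
    η : ℚ
    η = c * t * proj₁ Q-inverse

    0<η : 0ℚ < η
    0<η = *-pos (*-pos 0<c 0<t) (proj₁ (proj₂ Q-inverse))

    ηQ≡ : η * Q ≡ c * t
    ηQ≡ = trans (*-assoc (c * t) (proj₁ Q-inverse) Q) (trans (cong (c * t *_) (trans (*-comm (proj₁ Q-inverse) Q) (proj₂ (proj₂ Q-inverse)))) (*-identityʳ (c * t)))

    module At {α : ℚ} {y : Vec n} (0<y : ∀ i → 0ℚ < y i) (ratio : ∀ i j → y i ≤ K * y j)
              (αy≤Ay : ∀ i → α * y i ≤ (A ∙ y) i) (I : Improvement A B c y) where
      open Improvement I

      α≤D : α ≤ D
      α≤D = *-cancelˡ (0<y i) (subst₂ _≤_ (*-comm α (y i)) (*-comm D (y i)) (begin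
        α * y i                        ≤⟨ αy≤Ay i ⟩
        ∑ (λ j → A i j * y j)          ≤⟨ ∑-mono (λ j → ≤-trans (*-monoʳ (<⇒≤ (0<y j)) (A≤1 i j)) (≤-trans (≤-reflexive (*-identityˡ (y j))) (ratio j i))) ⟩
        ∑ {n} (λ _ → K * y i)          ≡⟨ ∑-const n (K * y i) ⟩
        ι n * (K * y i)                ≤⟨ by-≤ (<⇒≤ (0<y i)) (solve 3 (λ p K y → y := (con 1ℚ :+ p :* K) :* y :- p :* (K :* y)) refl (ι n) K (y i)) ⟩
        D * y i                        ∎))
        where open ≤-Reasoning

      τ : ℚ
      τ = t * y j

      0<τ : 0ℚ < τ
      0<τ = *-pos 0<t (0<y j)

      open Perturb B sym-B y′ v τ public

      norm≡ : norm bump ≡ norm y + (τ * (y i + y i) + τ * τ)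
      norm≡ = trans norm-bump (cong₂ (λ p q → p + (τ * (q + q) + τ * τ)) norm-≡ y′v≡yi)

      0<norm : 0ℚ < norm bump
      0<norm = subst (0ℚ <_) (trans (+-comm (τ * (y i + y i) + τ * τ) (norm y)) (sym norm≡))
        (+-pos-nonneg (+-pos (*-pos 0<τ (+-pos (0<y i) (0<y i))) (*-pos 0<τ 0<τ)) (∑-nonneg (λ j → sq-nonneg (y j))))

      norm≤ : norm bump ≤ Q * (y j * y j)
      norm≤ = begin
        norm bump                                  ≡⟨ norm≡ ⟩
        norm y + (τ * (y i + y i) + τ * τ)         ≤⟨ +-mono-≤ (∑-mono λ l → *-mono (<⇒≤ (0<y l)) (ratio l j) (<⇒≤ (0<y l)) (ratio l j))
                                                       (+-monoˡ-≤ (τ * τ) (*-monoˡ (<⇒≤ 0<τ) (+-mono-≤ (ratio i j) (ratio i j)))) ⟩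
        ∑ {n} (λ _ → K * y j * (K * y j)) + (τ * (K * y j + K * y j) + τ * τ)
          ≡⟨ cong (_+ (τ * (K * y j + K * y j) + τ * τ)) (∑-const n (K * y j * (K * y j))) ⟩
        ι n * (K * y j * (K * y j)) + (τ * (K * y j + K * y j) + τ * τ)
          ≡⟨ solve 4 (λ p K y t → p :* (K :* y :* (K :* y)) :+ (t :* y :* (K :* y :+ K :* y) :+ t :* y :* (t :* y))
               := (p :* (K :* K) :+ (t :* (K :+ K) :+ t :* t)) :* (y :* y)) refl (ι n) K (y j) t ⟩
        Q * (y j * y j)                            ∎
        where open ≤-Reasoning

      τD≡ : τ * D ≡ c * y j
      τD≡ = trans (solve 4 (λ c d y D → c :* d :* y :* D := c :* y :* (D :* d)) refl c D⁻¹ (y j) D) (trans (cong (c * y j *_) DD⁻¹≡1) (*-identityʳ (c * y j)))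

      quotient : (α + η) * norm bump ≤ form B bump
      quotient = begin
        (α + η) * norm bump
          ≡⟨ *-distribʳ-+ (norm bump) α η ⟩
        α * norm bump + η * norm bump
          ≤⟨ +-monoʳ-≤ (α * norm bump) (*-monoˡ (<⇒≤ 0<η) norm≤) ⟩
        α * norm bump + η * (Q * (y j * y j))
          ≡⟨ cong₂ _+_ (cong (α *_) norm≡) (trans (sym (*-assoc η Q (y j * y j))) (cong (_* (y j * y j)) ηQ≡)) ⟩
        α * (norm y + (τ * (y i + y i) + τ * τ)) + c * t * (y j * y j)
          ≡⟨ solve 7 (λ a N t y c yj u → a :* (N :+ (t :* (y :+ y) :+ t :* t)) :+ c :* u :* (yj :* yj)
               := a :* N :+ (t :* (a :* y :+ a :* y) :+ (t :* (a :* t) :+ u :* yj :* (c :* yj)))) refl α (norm y) τ (y i) c (y j) t ⟩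
        α * norm y + (τ * (α * y i + α * y i) + (τ * (α * τ) + τ * (c * y j)))
          ≤⟨ +-mono-≤ α-norm (+-monoʳ-≤ (τ * (α * y i + α * y i)) (+-monoˡ-≤ (τ * (c * y j)) (*-monoˡ (<⇒≤ 0<τ) ατ≤))) ⟩
        form A y + (τ * (α * y i + α * y i) + (τ * (c * y j) + τ * (c * y j)))
          ≡⟨ solve 4 (λ F t a g → F :+ (t :* (a :+ a) :+ (t :* g :+ t :* g)) := F :+ t :* ((a :+ g) :+ (a :+ g))) refl (form A y) τ (α * y i) (c * y j) ⟩
        form A y + τ * ((α * y i + c * y j) + (α * y i + c * y j))
          ≤⟨ +-mono-≤ form-≤ (*-monoˡ (<⇒≤ 0<τ) (+-mono-≤ coordinate coordinate)) ⟩
        form B y′ + τ * ((B ∙ y′) v + (B ∙ y′) v)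
          ≤⟨ by-≤ (*-nonneg (sq-nonneg τ) (0≤B v v)) (solve 3 (λ F p b → b := F :+ (p :+ b) :- (F :+ p)) refl (form B y′) (τ * ((B ∙ y′) v + (B ∙ y′) v)) (τ * τ * B v v)) ⟩
        form B y′ + (τ * ((B ∙ y′) v + (B ∙ y′) v) + τ * τ * B v v)
          ≡⟨ form-bump ⟨
        form B bump ∎
        where
        open ≤-Reasoning
        α-norm : α * norm y ≤ form A y
        α-norm = subst (_≤ form A y) (sym (*-∑ α (λ l → y l * y l))) (∑-mono λ l →
          subst (_≤ y l * (A ∙ y) l) (solve 2 (λ y a → y :* (a :* y) := a :* (y :* y)) refl (y l) α) (*-monoˡ (<⇒≤ (0<y l)) (αy≤Ay l)))
        ατ≤ : α * τ ≤ c * y j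
        ατ≤ = subst (α * τ ≤_) (trans (*-comm D τ) τD≡) (*-monoʳ (<⇒≤ 0<τ) α≤D)
        coordinate : α * y i + c * y j ≤ (B ∙ y′) v
        coordinate = ≤-trans (+-monoˡ-≤ (c * y j) (αy≤Ay i)) gain

    -- As η is known beforehand, a stage can be chosen whose quotients spread by less than η. The
    -- radius of A is then at most α + ε, while an improvement of that vector puts the radius of B
    -- at α + η or above.
    separation : ∃[ y ] (∀ i → 0ℚ < y i) × (Improvement A B c y → ∀ {ρ ρ′} →
                 IsSpectralRadius 𝔸 ρ → IsSpectralRadius 𝔹 ρ′ → ¬ (ρ′ ≤ʳ ρ))
    separation =
      let ε , 0<ε , 4ε≡η = part 0<η
          N , eig = eigen 0<ε
          α , b = eig N ℕₚ.≤-refl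
          ε<η : ε < η
          ε<η = by-< (+-pos (+-pos 0<ε 0<ε) 0<ε) (trans (solve 1 (λ e → e :+ e :+ e := (e :+ e :+ e :+ e) :- e) refl ε) (cong (_- ε) 4ε≡η))
      in w N , w-pos N , λ I {ρ} {ρ′} isρ isρ′ ρ′≤ρ →
         let module I = At {α} {w N} (w-pos N) (w-ratio N) (λ i → proj₁ (b i)) I
         in Collatz.radius≤ {A = A} 0≤A {w N} (w-pos N) {α + ε} (λ i → proj₂ (b i)) {𝔸} rep-A o {ρ} isρ {α + η} (+-monoʳ-< α ε<η)
              (≤ʳ-trans {fromℚ (α + η)} {ρ′} {ρ}
                (Eigenpair.rayleigh≤radius {𝔸 = 𝔹} rep-B o′ P′ 0≤B sym-B {ρ′} isρ′ I.bump {α + η} I.0<norm I.quotient) ρ′≤ρ)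

  -- A Perron vector of B serves both sides: pulled back along φ its upper quotient bounds ρ from
  -- above, and its own Rayleigh quotient bounds ρ′ from below.
  radius-permute : ∀ {n k} {𝔸 : Matrix n} {A : Mat n} {𝔹 : Matrix k} {B : Mat k} → Represents 𝔸 A → Represents 𝔹 B →
    (∀ i j → 0ℚ ≤ A i j) → (∀ i j → 0ℚ ≤ B i j) → Symmetric B → Fin n → {o′ : Fin k} → PerronVectors B o′ →
    (φ : Permutation n k) → (∀ i j → A i j ≡ B (φ ⟨$⟩ʳ i) (φ ⟨$⟩ʳ j)) →
    ∀ {ρ ρ′} → IsSpectralRadius 𝔸 ρ → IsSpectralRadius 𝔹 ρ′ → ρ ≤ʳ ρ′
  radius-permute {n} {k} {𝔸} {A} {𝔹} {B} rep-A rep-B 0≤A 0≤B sym-B o {o′} P φ A≡B {ρ} {ρ′} isρ isρ′ ε 0<ε =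
    let d , 0<d , 4d≡ε = part 0<ε
        N , eig = eigen 0<d
        α , b = eig N ℕₚ.≤-refl
        w′ = λ i → w N (φ ⟨$⟩ʳ i)
        ρ≤ = ≰ʳ⇒≥ʳ {fromℚ (α + d + d)} {ρ} (Collatz.radius≤ {A = A} 0≤A {w′} (λ i → w-pos N (φ ⟨$⟩ʳ i)) {α + d}
               (λ i → subst (_≤ (α + d) * w′ i) (sym (product (w N) i)) (proj₂ (b (φ ⟨$⟩ʳ i)))) {𝔸} rep-A o {ρ} isρ
               (by-< 0<d (solve 2 (λ a d → d := a :+ d :+ d :- (a :+ d)) refl α d)))
        ≤ρ′ = Eigenpair.rayleigh≤radius {𝔸 = 𝔹} rep-B o′ P 0≤B sym-B {ρ′} isρ′ (w N) {α}
                (<-≤-trans (*-pos (w-pos N o′) (w-pos N o′)) (term≤∑ (λ i → sq-nonneg (w N i)) o′))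
                (subst (_≤ form B (w N)) (sym (*-∑ α (λ i → w N i * w N i))) (∑-mono λ i →
                  subst (_≤ w N i * (B ∙ w N) i) (solve 2 (λ y a → y :* (a :* y) := a :* (y :* y)) refl (w N i) α)
                    (*-monoˡ (<⇒≤ (w-pos N i)) (proj₁ (b i)))))
        M₁ , le₁ = ρ≤ d 0<d
        M₂ , le₂ = ≤ρ′ d 0<d
    in M₁ ℕ.⊔ M₂ , λ s le → by-< (+-pos (<⇒0<- (le₁ s (ℕₚ.m⊔n≤o⇒m≤o M₁ M₂ le))) (<⇒0<- (le₂ s (ℕₚ.m⊔n≤o⇒n≤o M₁ M₂ le))))
         (trans (solve 4 (λ a d p q → (a :+ d :+ d :+ d :- p) :+ (q :+ d :- a) := q :+ (d :+ d :+ d :+ d) :- p) refl α d (Defs.seq ρ s) (Defs.seq ρ′ s))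
           (cong (λ e → Defs.seq ρ′ s + e - Defs.seq ρ s) 4d≡ε))
    where
    open PerronVectors P
    product : ∀ v i → (A ∙ (λ j → v (φ ⟨$⟩ʳ j))) i ≡ (B ∙ v) (φ ⟨$⟩ʳ i)
    product v i = trans (∑-cong λ j → cong (_* v (φ ⟨$⟩ʳ j)) (A≡B i j)) (sym (∑-permute (λ j → B (φ ⟨$⟩ʳ i) j * v j) φ))

-- The adjacency matrix as a sum over edges

module AdjacencyMatrix where

  open RationalArithmetic
  open PowerIteration
  open SpectralBounds
  open RadiusComparison
  open import Defs using (Hypergraph; order; size; edge; InCommonEdge; inCommonEdge?; adjacency; Connected; pred-nonZero; fromℚ; 0ℝ; seq)
  open import Data.Bool.Base using (true; false; if_then_else_)
  open import Data.Fin.Subset using (_∈_)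
  open import Data.Fin.Subset.Properties using (_∈?_)
  import Data.Integer.Base as ℤ
  open import Data.Rational.Base
  open import Data.Rational.Properties
  open import Data.Rational.Solver using (module +-*-Solver)
  import Data.Rational.Unnormalised.Base as ℚᵘ
  import Data.Rational.Unnormalised.Properties as ℚᵘₚ
  open import Relation.Binary.Construct.Closure.ReflexiveTransitive using (Star; ε; _◅_)
  open +-*-Solver

  ind : ∀ {P : Set} → Dec P → ℚ
  ind d = if does d then 1ℚ else 0ℚ

  ind-yes : ∀ {P : Set} (d : Dec P) → P → ind d ≡ 1ℚ
  ind-yes d p = cong (if_then 1ℚ else 0ℚ) (dec-true d p)

  ind-no : ∀ {P : Set} (d : Dec P) → ¬ P → ind d ≡ 0ℚ
  ind-no d ¬p = cong (if_then 1ℚ else 0ℚ) (dec-false d ¬p)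

  ind-apart : ∀ {P Q : Set} (d : Dec P) (d′ : Dec Q) → ¬ (P × Q) → ind d * ind d′ ≡ 0ℚ
  ind-apart (no _)  d′      _  = *-zeroˡ (ind d′)
  ind-apart (yes _) (no _)  _  = *-zeroʳ 1ℚ
  ind-apart (yes p) (yes q) ¬b = ⊥-elim (¬b (p , q))

  δ-refl : ∀ {n} (v : Fin n) → δ v v ≡ 1ℚ
  δ-refl v = ind-yes (v ≟ᶠ v) refl

  δ-≢ : ∀ {n} {v i : Fin n} → v ≢ i → δ v i ≡ 0ℚ
  δ-≢ {v = v} {i} v≢i = ind-no (v ≟ᶠ i) v≢i

  abstract
    weight : (m : ℕ) → .{{NonTrivial m}} → ℚ
    weight m = (ℤ.+ 1 / (m ℕ.∸ 1)) {{pred-nonZero m}}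

    weight-pos : ∀ m .{{_ : NonTrivial m}} → 0ℚ < weight m
    weight-pos (suc (suc r)) = positive⁻¹ (ℤ.+ 1 / suc r) {{normalize-pos 1 (suc r)}}

    weight≤1 : ∀ m .{{_ : NonTrivial m}} → weight m ≤ 1ℚ
    weight≤1 (suc (suc r)) = toℚᵘ-cancel-≤ (ℚᵘₚ.≤-respˡ-≃ (ℚᵘₚ.≃-sym (toℚᵘ-fromℚᵘ (ℚᵘ.mkℚᵘ (ℤ.+ 1) r)))
      (ℚᵘ.*≤* (ℤ.+≤+ (ℕ.s≤s ℕ.z≤n))))

    weight-def : ∀ m .{{_ : NonTrivial m}} → weight m ≡ (ℤ.+ 1 / (m ℕ.∸ 1)) {{pred-nonZero m}}
    weight-def m = refl

  adj : ∀ {N} → ℚ → {P : Fin N → Fin N → Set} → (∀ i j → Dec (P i j)) → Mat N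
  adj c P? i j = if does (¬? (i ≟ᶠ j) ×-dec P? i j) then c else 0ℚ

  module Adjacency (m : ℕ) .{{_ : NonTrivial m}} (X : Hypergraph) where

    c : ℚ
    c = weight m

    A : Mat (order X)
    A = adj c (inCommonEdge? X)

    represents : Represents (adjacency m X) A
    represents i j t = go (does (¬? (i ≟ᶠ j) ×-dec inCommonEdge? X i j))
      where
      go : ∀ b → seq (if b then fromℚ ((ℤ.+ 1 / (m ℕ.∸ 1)) {{pred-nonZero m}}) else 0ℝ) t ≡ (if b then c else 0ℚ)
      go true  = sym (weight-def m)
      go false = refl

    0<c : 0ℚ < c
    0<c = weight-pos m

    A-yes : ∀ {i j} → i ≢ j → InCommonEdge X i j → A i j ≡ c
    A-yes {i} {j} i≢j common = cong (if_then c else 0ℚ) (dec-true (¬? (i ≟ᶠ j) ×-dec inCommonEdge? X i j) (i≢j , common))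

    A-no : ∀ {i j} → ¬ (i ≢ j × InCommonEdge X i j) → A i j ≡ 0ℚ
    A-no {i} {j} not = cong (if_then c else 0ℚ) (dec-false (¬? (i ≟ᶠ j) ×-dec inCommonEdge? X i j) not)

    A-cases : ∀ i j → (i ≢ j × InCommonEdge X i j × A i j ≡ c) ⊎ (¬ (i ≢ j × InCommonEdge X i j) × A i j ≡ 0ℚ)
    A-cases i j with ¬? (i ≟ᶠ j) ×-dec inCommonEdge? X i j in eq
    ... | yes (i≢j , common) = inj₁ (i≢j , common , cong (λ d → if does d then c else 0ℚ) eq)
    ... | no not             = inj₂ (not , cong (λ d → if does d then c else 0ℚ) eq)

    0≤A : ∀ i j → 0ℚ ≤ A i j
    0≤A i j with A-cases i j
    ... | inj₁ (_ , _ , eq) = subst (0ℚ ≤_) (sym eq) (<⇒≤ 0<c)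
    ... | inj₂ (_ , eq)     = ≤-reflexive (sym eq)

    A≤1 : ∀ i j → A i j ≤ 1ℚ
    A≤1 i j with A-cases i j
    ... | inj₁ (_ , _ , eq) = subst (_≤ 1ℚ) (sym eq) (weight≤1 m)
    ... | inj₂ (_ , eq)     = subst (_≤ 1ℚ) (sym eq) 0≤1

    A-sym : Symmetric A
    A-sym i j with A-cases i j
    ... | inj₁ (i≢j , (e , i∈e , j∈e) , eq) = trans eq (sym (A-yes (≢-sym i≢j) (e , j∈e , i∈e)))
    ... | inj₂ (not , eq) = trans eq (sym (A-no λ { (j≢i , (e , j∈e , i∈e)) → not (≢-sym j≢i , e , i∈e , j∈e) }))

    perron-of-connected : Connected X → (o : Fin (order X)) → PerronVectors A o
    perron-of-connected conn o = perron A o 0≤A A≤1 0<c (weight≤1 m) (λ i j → steps (conn i j))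
      where
      steps : ∀ {i j} → Star (InCommonEdge X) i j → Star (λ i j → c ≤ A i j) i j
      steps ε = ε
      steps {i} (_◅_ {j = j} common path) with i ≟ᶠ j
      ... | yes refl = steps path
      ... | no i≢j   = ≤-reflexive (sym (A-yes i≢j common)) ◅ steps path

    module _ (pair-linear : ∀ {i j e f} → i ≢ j → i ∈ edge X e → j ∈ edge X e → i ∈ edge X f → j ∈ edge X f → e ≡ f) where

      mem : Fin (order X) → Fin (size X) → ℚ
      mem i e = ind (i ∈? edge X e)

      mem-idem : ∀ i e → mem i e * mem i e ≡ mem i e
      mem-idem i e with i ∈? edge X e
      ... | yes _ = *-identityʳ 1ℚ
      ... | no _  = *-zeroʳ 0ℚ

      mem-δ : ∀ {i j e} → i ≢ j → i ∈ edge X e → j ∈ edge X e → ∀ f → mem i f * mem j f ≡ 1ℚ * δ e f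
      mem-δ {i} {j} {e} i≢j i∈e j∈e f with e ≟ᶠ f
      ... | yes refl = cong₂ _*_ (ind-yes (i ∈? edge X e) i∈e) (ind-yes (j ∈? edge X e) j∈e)
      ... | no e≢f = ind-apart (i ∈? edge X f) (j ∈? edge X f) λ { (i∈f , j∈f) → e≢f (pair-linear i≢j i∈e j∈e i∈f j∈f) }

      -- By linearity at most one edge contains both i and j, so the sum of incidence products is 0
      -- or 1.
      A-off-diagonal : ∀ {i j} → i ≢ j → A i j ≡ c * ∑ (λ e → mem i e * mem j e)
      A-off-diagonal {i} {j} i≢j with A-cases i j
      ... | inj₁ (_ , (e , i∈e , j∈e) , eq) = trans eq (sym (trans
        (cong (c *_) (trans (∑-cong (mem-δ i≢j i∈e j∈e)) (∑-δ (λ _ → 1ℚ) e))) (*-identityʳ c)))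
      ... | inj₂ (not , eq) = trans eq (sym (trans
        (cong (c *_) (trans (∑-cong apart) (∑-zero (size X)))) (*-zeroʳ c)))
        where
        apart : ∀ e → mem i e * mem j e ≡ 0ℚ
        apart e = ind-apart (i ∈? edge X e) (j ∈? edge X e) λ { (i∈e , j∈e) → not (i≢j , e , i∈e , j∈e) }

      Y : Vec (order X) → Fin (size X) → ℚ
      Y g e = ∑ (λ i → mem i e * g i)

      -- The term with δ removes the diagonal of the product of incidence matrices, so that one
      -- formula covers i = j as well.
      Entry : Vec (order X) → Fin (order X) → Fin (order X) → Set
      Entry y i j = A i j * y j ≡ c * ∑ (λ e → mem i e * (mem j e * y j - y i * δ i j))

      entry-diagonal : ∀ y i → Entry y i i
      entry-diagonal y i = trans (cong (_* y i) (A-no {i} {i} (λ { (i≢i , _) → i≢i refl })))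
        (trans (*-zeroˡ (y i)) (sym (trans (cong (c *_) (trans (∑-cong vanish) (∑-zero (size X)))) (*-zeroʳ c))))
        where
        vanish : ∀ e → mem i e * (mem i e * y i - y i * δ i i) ≡ 0ℚ
        vanish e = trans (cong (λ d → mem i e * (mem i e * y i - y i * d)) (δ-refl i)) (trans
          (solve 2 (λ a y → a :* (a :* y :- y :* con 1ℚ) := (a :* a :- a) :* y) refl (mem i e) (y i))
          (trans (cong (λ p → (p - mem i e) * y i) (mem-idem i e))
            (solve 2 (λ a y → (a :- a) :* y := con 0ℚ) refl (mem i e) (y i))))

      entry-off-diagonal : ∀ y {i j} → i ≢ j → Entry y i j
      entry-off-diagonal y {i} {j} i≢j = trans (cong (_* y j) (A-off-diagonal i≢j)) (trans (*-assoc c (∑ (λ e → mem i e * mem j e)) (y j))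
        (cong (c *_) (trans (∑-* (λ e → mem i e * mem j e) (y j))
          (∑-cong λ e → trans (solve 4 (λ a b y z → a :* b :* y := a :* (b :* y :- z :* con 0ℚ)) refl (mem i e) (mem j e) (y j) (y i))
            (cong (λ d → mem i e * (mem j e * y j - y i * d)) (sym (δ-≢ i≢j)))))))

      A-entry : ∀ y i j → Entry y i j
      A-entry y i j = decide (i ≟ᶠ j)
        where
        decide : Dec (i ≡ j) → Entry y i j
        decide (yes refl) = entry-diagonal y i
        decide (no i≢j)   = entry-off-diagonal y i≢j

      A-product : ∀ y i → (A ∙ y) i ≡ c * ∑ (λ e → mem i e * (Y y e - y i))
      A-product y i = begin
        ∑ (λ j → A i j * y j)
          ≡⟨ ∑-cong (A-entry y i) ⟩
        ∑ (λ j → c * ∑ (λ e → mem i e * (mem j e * y j - y i * δ i j)))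
          ≡⟨ *-∑ c (λ j → ∑ (λ e → mem i e * (mem j e * y j - y i * δ i j))) ⟨
        c * ∑ (λ j → ∑ (λ e → mem i e * (mem j e * y j - y i * δ i j)))
          ≡⟨ cong (c *_) (trans (∑-swap (λ j e → mem i e * (mem j e * y j - y i * δ i j))) (∑-cong λ e →
               trans (sym (*-∑ (mem i e) (λ j → mem j e * y j - y i * δ i j)))
                 (cong (mem i e *_) (trans (∑-- (λ j → mem j e * y j) (λ j → y i * δ i j)) (cong (λ z → Y y e - z) (∑-δ (λ _ → y i) i)))))) ⟩
        c * ∑ (λ e → mem i e * (Y y e - y i)) ∎
        where open ≡-Reasoning

      A-form : ∀ y → form A y ≡ c * ∑ (λ e → Y y e * Y y e - Y (λ i → y i * y i) e)
      A-form y = begin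
        ∑ (λ i → y i * (A ∙ y) i)
          ≡⟨ ∑-cong (λ i → trans (cong (y i *_) (A-product y i)) (trans
               (solve 3 (λ y c s → y :* (c :* s) := c :* (y :* s)) refl (y i) c (∑ (λ e → mem i e * (Y y e - y i))))
               (cong (c *_) (*-∑ (y i) (λ e → mem i e * (Y y e - y i)))))) ⟩
        ∑ (λ i → c * ∑ (λ e → y i * (mem i e * (Y y e - y i))))
          ≡⟨ *-∑ c (λ i → ∑ (λ e → y i * (mem i e * (Y y e - y i)))) ⟨
        c * ∑ (λ i → ∑ (λ e → y i * (mem i e * (Y y e - y i))))
          ≡⟨ cong (c *_) (trans (∑-swap (λ i e → y i * (mem i e * (Y y e - y i)))) (∑-cong λ e → trans
               (∑-cong λ i → solve 3 (λ y a s → y :* (a :* (s :- y)) := a :* y :* s :- a :* (y :* y)) refl (y i) (mem i e) (Y y e))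
               (trans (∑-- (λ i → mem i e * y i * Y y e) (λ i → mem i e * (y i * y i)))
                 (cong (_- Y (λ i → y i * y i) e) (sym (∑-* (λ i → mem i e * y i) (Y y e))))))) ⟩
        c * ∑ (λ e → Y y e * Y y e - Y (λ i → y i * y i) e) ∎
        where open ≡-Reasoning

-- Power hypergraphs as graphs with loaded edges

module GraphModels where

  open RationalArithmetic
  open PowerIteration
  open SpectralBounds
  open RadiusComparison
  open AdjacencyMatrix
  open import Defs using (Hypergraph; order; size; edge; _≅_)
  open import Data.Fin.Subset using (_∈_)
  open import Data.Fin.Subset.Properties using (_∈?_)
  open import Data.Rational.Base
  open import Data.Rational.Properties
  open import Data.Rational.Solver using (module +-*-Solver)
  open import Data.Product.Function.NonDependent.Propositional using (_×-↔_)
  open import Data.Sum.Function.Propositional using (_⊎-↔_)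
  open +-*-Solver

  module _ {V E : Set} where

    Vertex : ℕ → Set
    Vertex r = V ⊎ (E × Fin r)

    On : (E → V × V) → V → E → Set
    On ends v e = v ≡ proj₁ (ends e) ⊎ v ≡ proj₂ (ends e)

    Incident : ∀ {r} → (E → V × V) → Vertex r → E → Set
    Incident ends (inj₁ v)       e = On ends v e
    Incident ends (inj₂ (f , _)) e = f ≡ e

  -- X is the (2 + r)-th power of the graph with the given ends.
  record Model (X : Hypergraph) {V E : Set} (r : ℕ) (ends : E → V × V) : Set where
    field
      vertices  : Fin (order X) ↔ Vertex {V} {E} r
      edges     : Fin (size X) ↔ E
      incidence : ∀ v e → v ∈ edge X e ⇔ Incident ends (Inverse.to vertices v) (Inverse.to edges e)

  record Simple {V E : Set} (ends : E → V × V) : Set where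
    field
      proper : ∀ e → proj₁ (ends e) ≢ proj₂ (ends e)
      single : ∀ {a b e f} → a ≢ b → On ends a e → On ends b e → On ends a f → On ends b f → e ≡ f

  to-injective : ∀ {A B : Set} (φ : A ↔ B) {x y} → Inverse.to φ x ≡ Inverse.to φ y → x ≡ y
  to-injective φ {x} {y} eq = trans (sym (Inverse.strictlyInverseʳ φ x)) (trans (cong (Inverse.from φ) eq) (Inverse.strictlyInverseʳ φ y))

  model-≅ : ∀ {X X′ V E r} {ends ends′ : E → V × V} → Model X r ends → Model X′ r ends′ →
            (∀ v e → On ends v e ⇔ On ends′ v e) → X ≅ X′
  model-≅ {X} {X′} {V} {E} {r} {ends} {ends′} M M′ same = record
    { onVertices = ↔-sym M′.vertices ↔-∘ M.vertices
    ; onEdges    = ↔-sym M′.edges ↔-∘ M.edges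
    ; incidence  = λ v e → mk⇔
        (λ v∈e → Equivalence.from (M′.incidence _ _) (subst₂ (Incident ends′) (sym (Inverse.strictlyInverseˡ M′.vertices _)) (sym (Inverse.strictlyInverseˡ M′.edges _))
          (forth (Inverse.to M.vertices v) (Equivalence.to (M.incidence v e) v∈e))))
        (λ v∈e → Equivalence.from (M.incidence v e) (back (Inverse.to M.vertices v)
          (subst₂ (Incident ends′) (Inverse.strictlyInverseˡ M′.vertices _) (Inverse.strictlyInverseˡ M′.edges _) (Equivalence.to (M′.incidence _ _) v∈e))))
    }
    where
    module M  = Model M
    module M′ = Model M′
    forth : ∀ u {e} → Incident {r = r} ends u e → Incident ends′ u e
    forth (inj₁ v) {e} = Equivalence.to (same v e)
    forth (inj₂ _)     = λ eq → eq
    back : ∀ u {e} → Incident {r = r} ends′ u e → Incident ends u e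
    back (inj₁ v) {e} = Equivalence.from (same v e)
    back (inj₂ _)     = λ eq → eq

  model-transport : ∀ {X X′ V E r} {ends : E → V × V} → X ≅ X′ → Model X′ r ends → Model X r ends
  model-transport iso M = record
    { vertices  = M.vertices ↔-∘ onVertices
    ; edges     = M.edges ↔-∘ onEdges
    ; incidence = λ v e → M.incidence _ _ ⇔-∘ incidence v e
    }
    where
    open _≅_ iso
    module M = Model M

  relabel : ∀ {X V E V′ E′ r} {ends : E → V × V} {ends′ : E′ → V′ × V′} → Model X r ends →
            (χ : V ↔ V′) (ψ : E ↔ E′) →
            (∀ v e → On ends v e ⇔ On ends′ (Inverse.to χ v) (Inverse.to ψ e)) → Model X r ends′
  relabel {r = r} {ends} {ends′} M χ ψ same = record
    { vertices  = (χ ⊎-↔ (ψ ×-↔ ↔-id (Fin r))) ↔-∘ M.vertices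
    ; edges     = ψ ↔-∘ M.edges
    ; incidence = λ v e → on-incident (Inverse.to M.vertices v) (Inverse.to M.edges e) ⇔-∘ M.incidence v e
    }
    where
    module M = Model M
    on-incident : ∀ u e → Incident {r = r} ends u e ⇔ Incident ends′ (Inverse.to (χ ⊎-↔ (ψ ×-↔ ↔-id (Fin r))) u) (Inverse.to ψ e)
    on-incident (inj₁ v) e = same v e
    on-incident (inj₂ (f , _)) e = mk⇔ (cong (Inverse.to ψ)) (to-injective ψ)

  pair-linear : ∀ {X V E r} {ends : E → V × V} → Model X r ends → Simple ends →
                ∀ {i j e f} → i ≢ j → i ∈ edge X e → j ∈ edge X e → i ∈ edge X f → j ∈ edge X f → e ≡ f
  pair-linear {X} {V} {E} {r} {ends} M simple {i} {j} {e} {f} i≢j i∈e j∈e i∈f j∈f = to-injective edges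
    (same (Inverse.to vertices i) (Inverse.to vertices j) (λ eq → i≢j (to-injective vertices eq))
      (member i∈e) (member j∈e) (member i∈f) (member j∈f))
    where
    open Model M
    member : ∀ {i e} → i ∈ edge X e → Incident ends (Inverse.to vertices i) (Inverse.to edges e)
    member = Equivalence.to (incidence _ _)
    same : ∀ u u′ {e f} → u ≢ u′ → Incident {r = r} ends u e → Incident {r = r} ends u′ e → Incident ends u f → Incident ends u′ f → e ≡ f
    same (inj₂ _) _        _    refl _    refl _    = refl
    same (inj₁ _) (inj₂ _) _    _    refl _    refl = refl
    same (inj₁ a) (inj₁ b) a≢b  p    q    p′   q′   = Simple.single simple (λ eq → a≢b (cong inj₁ eq)) p q p′ q′

  ind-⇔ : ∀ {P Q : Set} (d : Dec P) (d′ : Dec Q) → P ⇔ Q → ind d ≡ ind d′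
  ind-⇔ (yes p) d′ iff = sym (ind-yes d′ (Equivalence.to iff p))
  ind-⇔ (no ¬p) d′ iff = sym (ind-no d′ (λ q → ¬p (Equivalence.from iff q)))

  δ-sym : ∀ {n} (v i : Fin n) → δ v i ≡ δ i v
  δ-sym v i = ind-⇔ (v ≟ᶠ i) (i ≟ᶠ v) (mk⇔ sym sym)

  δ-∑ : ∀ {n} (f : Vec n) v → ∑ (λ i → δ v i * f i) ≡ f v
  δ-∑ f v = trans (∑-cong λ i → *-comm (δ v i) (f i)) (∑-δ f v)

  module Sums (m : ℕ) .{{_ : NonTrivial m}} {X : Hypergraph} {n k r : ℕ} {ends : Fin k → Fin n × Fin n}
              (M : Model X r ends) (simple : Simple ends) where

    open Model M
    open Adjacency m X

    U : Set
    U = Vertex {Fin n} {Fin k} r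

    to : Fin (order X) → U
    to = Inverse.to vertices

    code : U ↔ Fin (n ℕ.+ k ℕ.* r)
    code = ↔-sym +↔⊎ ↔-∘ (↔-id (Fin n) ⊎-↔ ↔-sym *↔×)

    extra : (U → ℚ) → Fin k → ℚ
    extra g e = ∑ (λ j → g (inj₂ (e , j)))

    total : (U → ℚ) → ℚ
    total g = ∑ (λ v → g (inj₁ v)) + ∑ (extra g)

    ∑-vertices : ∀ g → ∑ (λ i → g (to i)) ≡ total g
    ∑-vertices g = begin
      ∑ (λ i → g (to i))                                  ≡⟨ ∑-cong (λ i → decode (to i)) ⟨
      ∑ (λ i → g′ (Inverse.to (code ↔-∘ vertices) i))     ≡⟨ ∑-permute g′ (code ↔-∘ vertices) ⟨
      ∑ g′                                                ≡⟨ ∑-++ n g′ ⟩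
      ∑ (λ v → g′ (v ↑ˡ (k ℕ.* r))) + ∑ (λ x → g′ (n ↑ʳ x))
        ≡⟨ cong₂ _+_ (∑-cong λ v → decode (inj₁ v))
             (trans (∑-combine k (λ x → g′ (n ↑ʳ x))) (∑-cong λ e → ∑-cong λ j → decode (inj₂ (e , j)))) ⟩
      total g ∎
      where
      open ≡-Reasoning
      g′ : Fin (n ℕ.+ k ℕ.* r) → ℚ
      g′ x = g (Inverse.from code x)
      decode : ∀ u → g′ (Inverse.to code u) ≡ g u
      decode u = cong g (Inverse.strictlyInverseʳ code u)

    left right : Fin k → Fin n
    left f  = proj₁ (ends f)
    right f = proj₂ (ends f)

    indicator : U → Fin k → ℚ
    indicator (inj₁ v)       f = δ (left f) v + δ (right f) v
    indicator (inj₂ (g , _)) f = δ f g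

    pl : ∀ {i j e f} → i ≢ j → i ∈ edge X e → j ∈ edge X e → i ∈ edge X f → j ∈ edge X f → e ≡ f
    pl = pair-linear M simple

    mem-indicator : ∀ i e → mem pl i e ≡ indicator (to i) (Inverse.to edges e)
    mem-indicator i e = by-cases (to i) (incidence i e)
      where
      f = Inverse.to edges e
      ends-indicator : ∀ {P : Set} (d : Dec P) v → P ⇔ On ends v f → ind d ≡ δ (left f) v + δ (right f) v
      ends-indicator d v iff with left f ≟ᶠ v in eq₁ | right f ≟ᶠ v in eq₂
      ... | yes l≡v | yes r≡v = ⊥-elim (Simple.proper simple f (trans l≡v (sym r≡v)))
      ... | yes l≡v | no _    = ind-yes d (Equivalence.from iff (inj₁ (sym l≡v)))
      ... | no _    | yes r≡v = ind-yes d (Equivalence.from iff (inj₂ (sym r≡v)))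
      ... | no l≢v  | no r≢v  = ind-no d (λ p → [ (λ eq → l≢v (sym eq)) , (λ eq → r≢v (sym eq)) ]′ (Equivalence.to iff p))
      by-cases : ∀ u → i ∈ edge X e ⇔ Incident ends u f → mem pl i e ≡ indicator u f
      by-cases (inj₁ v)       iff = ends-indicator (i ∈? edge X e) v iff
      by-cases (inj₂ (g , _)) iff = trans (ind-⇔ (i ∈? edge X e) (g ≟ᶠ f) iff) (δ-sym g f)

    Y-load : ∀ (g : U → ℚ) e → let f = Inverse.to edges e in
             Y pl (λ i → g (to i)) e ≡ g (inj₁ (left f)) + g (inj₁ (right f)) + extra g f
    Y-load g e = begin
      ∑ (λ i → mem pl i e * g (to i))
        ≡⟨ ∑-cong (λ i → cong (_* g (to i)) (mem-indicator i e)) ⟩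
      ∑ (λ i → indicator (to i) f * g (to i))
        ≡⟨ ∑-vertices (λ u → indicator u f * g u) ⟩
      ∑ (λ v → (δ (left f) v + δ (right f) v) * g (inj₁ v)) + ∑ (λ h → ∑ (λ j → δ f h * g (inj₂ (h , j))))
        ≡⟨ cong₂ _+_
             (trans (∑-cong λ v → *-distribʳ-+ (g (inj₁ v)) (δ (left f) v) (δ (right f) v))
               (trans (∑-+ (λ v → δ (left f) v * g (inj₁ v)) (λ v → δ (right f) v * g (inj₁ v)))
                 (cong₂ _+_ (δ-∑ (λ v → g (inj₁ v)) (left f)) (δ-∑ (λ v → g (inj₁ v)) (right f)))))
             (trans (∑-cong λ h → sym (*-∑ (δ f h) (λ j → g (inj₂ (h , j))))) (δ-∑ (extra g) f)) ⟩
      g (inj₁ (left f)) + g (inj₁ (right f)) + extra g f ∎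
      where
      open ≡-Reasoning
      f = Inverse.to edges e

    ∑-edges : ∀ (h : Fin k → ℚ) → ∑ (λ e → h (Inverse.to edges e)) ≡ ∑ h
    ∑-edges h = sym (∑-permute h edges)

    module _ (g : U → ℚ) where

      square : U → ℚ
      square u = g u * g u

      y : Fin n → ℚ
      y v = g (inj₁ v)

      -- Twice the sum over pairs of added vertices of one edge. It does not involve the ends, hence
      -- cancels whenever the edge is moved.
      constant : Fin k → ℚ
      constant f = extra g f * extra g f - extra square f

      -- The pairs within an edge that involve one of its ends a, b: the part of the quadratic form
      -- that depends on where the edge is attached.
      Φ : Fin k → Fin n × Fin n → ℚ
      Φ f (a , b) = y a * y b + (y a + y b) * extra g f

      -- What one edge contributes to the coordinate of A y at the core vertex v, up to the matrix
      -- weight.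
      Ψ : Fin n → Fin k → Fin n × Fin n → ℚ
      Ψ v f (a , b) = δ a v * (y b + extra g f) + δ b v * (y a + extra g f)

      model-form : form A (λ i → g (to i)) ≡ c * ((1ℚ + 1ℚ) * ∑ (λ f → Φ f (ends f)) + ∑ constant)
      model-form = trans (A-form pl (λ i → g (to i))) (cong (c *_) (trans
        (∑-cong λ e → trans (cong₂ (λ p q → p * p - q) (Y-load g e) (Y-load square e)) (expand (y (left (Inverse.to edges e))) (y (right (Inverse.to edges e))) (extra g (Inverse.to edges e)) (extra square (Inverse.to edges e))))
        (trans (∑-edges (λ f → (1ℚ + 1ℚ) * Φ f (ends f) + constant f))
          (trans (∑-+ (λ f → (1ℚ + 1ℚ) * Φ f (ends f)) constant) (cong (_+ ∑ constant) (sym (*-∑ (1ℚ + 1ℚ) (λ f → Φ f (ends f)))))))))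
        where
        expand : ∀ a b N N₂ → (a + b + N) * (a + b + N) - (a * a + b * b + N₂) ≡ (1ℚ + 1ℚ) * (a * b + (a + b) * N) + (N * N - N₂)
        expand = solve 4 (λ a b N N₂ → (a :+ b :+ N) :* (a :+ b :+ N) :- (a :* a :+ b :* b :+ N₂) := (con 1ℚ :+ con 1ℚ) :* (a :* b :+ (a :+ b) :* N) :+ (N :* N :- N₂)) refl

      model-product : ∀ i v → to i ≡ inj₁ v → (A ∙ (λ i → g (to i))) i ≡ c * ∑ (λ f → Ψ v f (ends f))
      model-product i v to-i = trans (A-product pl (λ i → g (to i)) i) (cong (c *_) (trans
        (∑-cong λ e → trans (cong₂ (λ p q → p * (q - g (to i))) (mem-indicator i e) (Y-load g e))
          (trans (cong (λ u → indicator u (Inverse.to edges e) * (y (left (Inverse.to edges e)) + y (right (Inverse.to edges e)) + extra g (Inverse.to edges e) - g u)) to-i)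
            (term (Inverse.to edges e))))
        (∑-edges (λ f → Ψ v f (ends f)))))
        where
        δ-diff : ∀ a s → δ a v * (s - y v) ≡ δ a v * (s - y a)
        δ-diff a s = decide (a ≟ᶠ v)
          where
          decide : Dec (a ≡ v) → δ a v * (s - y v) ≡ δ a v * (s - y a)
          decide (yes refl) = refl
          decide (no a≢v)   = trans (cong (_* (s - y v)) (δ-≢ a≢v)) (trans (*-zeroˡ (s - y v)) (sym (trans (cong (_* (s - y a)) (δ-≢ a≢v)) (*-zeroˡ (s - y a)))))
        term : ∀ f → (δ (left f) v + δ (right f) v) * (y (left f) + y (right f) + extra g f - y v) ≡ Ψ v f (ends f)
        term f = trans (*-distribʳ-+ (s - y v) (δ (left f) v) (δ (right f) v)) (trans
          (cong₂ _+_ (δ-diff (left f) s) (δ-diff (right f) s))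
          (solve 5 (λ d e a b N → d :* (a :+ b :+ N :- a) :+ e :* (a :+ b :+ N :- b) := d :* (b :+ N) :+ e :* (a :+ N)) refl
            (δ (left f) v) (δ (right f) v) (y (left f)) (y (right f)) (extra g f)))
          where s = y (left f) + y (right f) + extra g f

  module Compare (m : ℕ) .{{_ : NonTrivial m}} {X X′ : Hypergraph} {n k r : ℕ} {ends ends′ : Fin k → Fin n × Fin n}
                 (M : Model X r ends) (simple : Simple ends) (M′ : Model X′ r ends′) (simple′ : Simple ends′) where

    module L = Sums m M simple
    module R = Sums m M′ simple′
    open L using (U; y; Φ; Ψ)

    -- The vector is carried over by labels: each core vertex and the added vertices of each edge
    -- keep their values. Norms then agree, and only the sums of Φ and Ψ differ.
    improvement : (w : Vec (order X)) → let g = λ u → w (Inverse.from (Model.vertices M) u) in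
                  ∑ (λ f → Φ g f (ends f)) ≤ ∑ (λ f → Φ g f (ends′ f)) →
                  ∀ v j → ∑ (λ f → Ψ g v f (ends f)) + y g j ≤ ∑ (λ f → Ψ g v f (ends′ f)) →
                  Improvement (Adjacency.A m X) (Adjacency.A m X′) (weight m) w
    improvement w form-le v j gain-le = record
      { y′     = λ i → g (R.to i)
      ; norm-≡ = trans (R.∑-vertices (L.square g)) (trans (sym (L.∑-vertices (L.square g))) (∑-cong λ i → cong (λ p → p * p) (g-to i)))
      ; form-≤ = subst₂ _≤_ (trans (sym (L.model-form g)) (form-cong g-to)) (sym (R.model-form g))
                   (*-monoˡ (<⇒≤ (weight-pos m)) (+-monoˡ-≤ (∑ (L.constant g)) (*-monoˡ 0≤₂ form-le)))
      ; v      = Inverse.from (Model.vertices M′) (inj₁ v)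
      ; i      = Inverse.from (Model.vertices M) (inj₁ v)
      ; j      = Inverse.from (Model.vertices M) (inj₁ j)
      ; y′v≡yi = cong g (Inverse.strictlyInverseˡ (Model.vertices M′) (inj₁ v))
      ; gain   = subst₂ _≤_ (trans (*-distribˡ-+ (weight m) (∑ (λ f → Ψ g v f (ends f))) (y g j))
                     (cong (_+ weight m * y g j) (trans (sym (L.model-product g _ v (Inverse.strictlyInverseˡ (Model.vertices M) (inj₁ v)))) (product-cong g-to (Inverse.from (Model.vertices M) (inj₁ v))))))
                   (sym (R.model-product g _ v (Inverse.strictlyInverseˡ (Model.vertices M′) (inj₁ v))))
                   (*-monoˡ (<⇒≤ (weight-pos m)) gain-le)
      }
      where
      g : U → ℚ
      g u = w (Inverse.from (Model.vertices M) u)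
      g-to : ∀ i → g (L.to i) ≡ w i
      g-to i = cong w (Inverse.strictlyInverseʳ (Model.vertices M) i)
      product-cong : ∀ {p q : Vec (order X)} → (∀ i → p i ≡ q i) → ∀ i → (Adjacency.A m X ∙ p) i ≡ (Adjacency.A m X ∙ q) i
      product-cong p≡q i = ∑-cong λ j → cong (Adjacency.A m X i j *_) (p≡q j)
      form-cong : ∀ {p q : Vec (order X)} → (∀ i → p i ≡ q i) → form (Adjacency.A m X) p ≡ form (Adjacency.A m X) q
      form-cong p≡q = ∑-cong λ i → cong₂ _*_ (p≡q i) (product-cong p≡q i)

-- Graph models of powers and of attached pendant edges

module PowerHypergraphs where

  open GraphModels using (Model; Vertex; On; Incident)
  open import Defs using (Hypergraph; order; size; edge; power; attachPendant; bowtie; bowtieEdge; block; B₂C)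
  open import Data.Fin.Subset using (Subset; _∈_; _∉_; ∣_∣; ⁅_⁆; ⊤; _∪_; inside; outside) renaming (⊥ to ∅)
  open import Data.Fin.Subset.Properties using (∉⊥; x∈⁅x⁆; x∈⁅y⁆⇒x≡y; x∈p∪q⁻; x∈p∪q⁺)
  open import Data.Sum.Function.Propositional using (_⊎-↔_)
  open import Data.Sum.Properties using (inj₁-injective; inj₂-injective)
  open import Data.Vec.Base using (_++_; _∷_; here; there; lookup; replicate; _[_]≔_)
  open import Data.Vec.Properties using ([]=⇒lookup; lookup⇒[]=; lookup-++ˡ; lookup-++ʳ; lookup-concat; lookup∘update; lookup∘update′; lookup-replicate)

  ∣p∣≡0⇒∉ : ∀ {n} (p : Subset n) → ∣ p ∣ ≡ 0 → ∀ {x} → x ∉ p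
  ∣p∣≡0⇒∉ (outside ∷ p) eq (there x∈p) = ∣p∣≡0⇒∉ p eq x∈p

  ∣p∣≡1⇒singleton : ∀ {n} (p : Subset n) → ∣ p ∣ ≡ 1 → ∃[ a ] ∀ x → x ∈ p ⇔ x ≡ a
  ∣p∣≡1⇒singleton (inside ∷ p) eq = zero , λ
    { zero    → mk⇔ (λ _ → refl) (λ _ → here)
    ; (suc x) → mk⇔ (λ { (there x∈p) → ⊥-elim (∣p∣≡0⇒∉ p (ℕₚ.suc-injective eq) x∈p) }) (λ ()) }
  ∣p∣≡1⇒singleton (outside ∷ p) eq = let a , iff = ∣p∣≡1⇒singleton p eq in suc a , λ
    { zero    → mk⇔ (λ ()) (λ ())
    ; (suc x) → mk⇔ (λ { (there x∈p) → cong suc (Equivalence.to (iff x) x∈p) })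
                    (λ { refl → there (Equivalence.from (iff x) refl) }) }

  ∣p∣≡2⇒pair : ∀ {n} (p : Subset n) → ∣ p ∣ ≡ 2 → ∃[ a ] ∃[ b ] a ≢ b × (∀ x → x ∈ p ⇔ (x ≡ a ⊎ x ≡ b))
  ∣p∣≡2⇒pair (inside ∷ p) eq = let b , iff = ∣p∣≡1⇒singleton p (ℕₚ.suc-injective eq) in zero , suc b , (λ ()) , λ
    { zero    → mk⇔ (λ _ → inj₁ refl) (λ _ → here)
    ; (suc x) → mk⇔ (λ { (there x∈p) → inj₂ (cong suc (Equivalence.to (iff x) x∈p)) })
                    (λ { (inj₂ refl) → there (Equivalence.from (iff x) refl) }) }
  ∣p∣≡2⇒pair (outside ∷ p) eq = let a , b , a≢b , iff = ∣p∣≡2⇒pair p eq in suc a , suc b , (λ eq → a≢b (suc-injective eq)) , λ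
    { zero    → mk⇔ (λ ()) (λ { (inj₁ ()) ; (inj₂ ()) })
    ; (suc x) → mk⇔ (λ { (there x∈p) → Sum.map (cong suc) (cong suc) (Equivalence.to (iff x) x∈p) })
                    (λ { (inj₁ refl) → there (Equivalence.from (iff x) (inj₁ refl))
                       ; (inj₂ refl) → there (Equivalence.from (iff x) (inj₂ refl)) }) }

  ∈-lookup : ∀ {n} {v : Fin n} {p : Subset n} → v ∈ p ⇔ lookup p v ≡ inside
  ∈-lookup {v = v} {p} = mk⇔ []=⇒lookup (lookup⇒[]= v p)

  ∈-cong : ∀ {n k} {v : Fin n} {w : Fin k} {p q} → lookup p v ≡ lookup q w → v ∈ p ⇔ w ∈ q
  ∈-cong eq = mk⇔ (λ v∈p → Equivalence.from ∈-lookup (trans (sym eq) (Equivalence.to ∈-lookup v∈p)))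
                  (λ w∈q → Equivalence.from ∈-lookup (trans eq (Equivalence.to ∈-lookup w∈q)))

  ∈-++ˡ : ∀ {a b} {p : Subset a} {q : Subset b} {v} → (v ↑ˡ b) ∈ (p ++ q) ⇔ v ∈ p
  ∈-++ˡ {p = p} {q} {v} = ∈-cong (lookup-++ˡ p q v)

  ∈-++ʳ : ∀ {a b} {p : Subset a} {q : Subset b} {v} → (a ↑ʳ v) ∈ (p ++ q) ⇔ v ∈ q
  ∈-++ʳ {p = p} {q} {v} = ∈-cong (lookup-++ʳ p q v)

  ∈-block : ∀ {k q} {i f : Fin k} {j : Fin q} → combine f j ∈ block i ⇔ f ≡ i
  ∈-block {k} {q} {i} {f} {j} = mk⇔ forth (λ { refl → Equivalence.from ∈-lookup at-i })
    where
    rows = replicate k (∅ {q})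
    at-i : lookup (block {k} {q} i) (combine i j) ≡ inside
    at-i = trans (lookup-concat (rows [ i ]≔ ⊤) i j)
      (trans (cong (λ row → lookup row j) (lookup∘update i rows ⊤)) (lookup-replicate j inside))
    forth : combine f j ∈ block i → f ≡ i
    forth h with f ≟ᶠ i
    ... | yes f≡i = f≡i
    ... | no f≢i  with () ← trans (sym (Equivalence.to ∈-lookup h)) (trans (lookup-concat (rows [ i ]≔ ⊤) f j)
      (trans (cong (λ row → lookup row j) (trans (lookup∘update′ f≢i rows ⊤) (lookup-replicate f ∅))) (lookup-replicate j outside)))

  ∈-pair : ∀ {n} {a b x : Fin n} → x ∈ (⁅ a ⁆ ∪ ⁅ b ⁆) ⇔ (x ≡ a ⊎ x ≡ b)
  ∈-pair {a = a} {b} {x} = mk⇔ (λ h → Sum.map (x∈⁅y⁆⇒x≡y a) (x∈⁅y⁆⇒x≡y b) (x∈p∪q⁻ ⁅ a ⁆ ⁅ b ⁆ h))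
    (λ { (inj₁ refl) → x∈p∪q⁺ (inj₁ (x∈⁅x⁆ x)) ; (inj₂ refl) → x∈p∪q⁺ (inj₂ (x∈⁅x⁆ x)) })

  ∈-from : ∀ {N : ℕ} {U : Set} {p : Subset N} {P : U → Set} (φ : Fin N ↔ U) →
           (∀ u → Inverse.from φ u ∈ p ⇔ P u) → ∀ v → v ∈ p ⇔ P (Inverse.to φ v)
  ∈-from {p = p} φ iff v = subst (λ w → w ∈ p ⇔ _) (Inverse.strictlyInverseʳ φ v) (iff (Inverse.to φ v))

  power-model : ∀ m (G : Hypergraph) (ends : Fin (size G) → Fin (order G) × Fin (order G)) →
                (∀ v e → v ∈ edge G e ⇔ On ends v e) → Model (power m G) (m ℕ.∸ 2) ends
  power-model m G ends on = record
    { vertices  = vertices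
    ; edges     = ↔-id (Fin (size G))
    ; incidence = λ v e → ∈-from {P = λ u → Incident ends u e} vertices (λ { (inj₁ v) → on v e ⇔-∘ ∈-++ˡ ; (inj₂ (f , j)) → ∈-block ⇔-∘ ∈-++ʳ {p = edge G e} }) v
    }
    where
    vertices : Fin (order G ℕ.+ size G ℕ.* (m ℕ.∸ 2)) ↔ Vertex (m ℕ.∸ 2)
    vertices = (↔-id (Fin (order G)) ⊎-↔ *↔×) ↔-∘ +↔⊎

  attached-ends : ∀ {V E : Set} {l} → (E → V × V) → V → E ⊎ Fin l → (V ⊎ Fin l) × (V ⊎ Fin l)
  attached-ends ends v (inj₁ e) = inj₁ (proj₁ (ends e)) , inj₁ (proj₂ (ends e))
  attached-ends ends v (inj₂ i) = inj₁ v , inj₂ i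

  -- Of the r + 1 new vertices of a pendant edge, the first becomes the new core vertex of the graph
  -- and the remaining r the vertices added to the new edge.
  regroup : ∀ {V E : Set} {l r} → (Vertex {V} {E} r ⊎ (Fin l × Fin (suc r))) ↔ Vertex {V ⊎ Fin l} {E ⊎ Fin l} r
  regroup = mk↔ₛ′
    (λ { (inj₁ (inj₁ v)) → inj₁ (inj₁ v) ; (inj₁ (inj₂ (e , j))) → inj₂ (inj₁ e , j)
       ; (inj₂ (i , zero)) → inj₁ (inj₂ i) ; (inj₂ (i , suc j)) → inj₂ (inj₂ i , j) })
    (λ { (inj₁ (inj₁ v)) → inj₁ (inj₁ v) ; (inj₂ (inj₁ e , j)) → inj₁ (inj₂ (e , j))
       ; (inj₁ (inj₂ i)) → inj₂ (i , zero) ; (inj₂ (inj₂ i , j)) → inj₂ (i , suc j) })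
    (λ { (inj₁ (inj₁ _)) → refl ; (inj₂ (inj₁ _ , _)) → refl ; (inj₁ (inj₂ _)) → refl ; (inj₂ (inj₂ _ , _)) → refl })
    (λ { (inj₁ (inj₁ _)) → refl ; (inj₁ (inj₂ _)) → refl ; (inj₂ (_ , zero)) → refl ; (inj₂ (_ , suc _)) → refl })

  module Attach (r : ℕ) {H : Hypergraph} {V E : Set} {ends : E → V × V} (M : Model H r ends)
                (c : Fin (order H)) (v : V) (to-c : Inverse.to (Model.vertices M) c ≡ inj₁ v) (l : ℕ) where
    module M = Model M

    X : Hypergraph
    X = attachPendant (suc (suc r)) H c l

    old-edge : ∀ e → edge X (e ↑ˡ l) ≡ edge H e ++ ∅
    old-edge e rewrite splitAt-↑ˡ (size H) e l = refl

    new-edge : ∀ i → edge X (size H ↑ʳ i) ≡ ⁅ c ⁆ ++ block i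
    new-edge i rewrite splitAt-↑ʳ (size H) l i = refl

    vertices₀ : Fin (order X) ↔ (Vertex {V} {E} r ⊎ (Fin l × Fin (suc r)))
    vertices₀ = (M.vertices ⊎-↔ *↔×) ↔-∘ +↔⊎

    edges : Fin (size X) ↔ (E ⊎ Fin l)
    edges = (M.edges ⊎-↔ ↔-id (Fin l)) ↔-∘ +↔⊎

    to₀ = Inverse.to (regroup {V} {E} {l} {r})

    Inc : Vertex {V ⊎ Fin l} {E ⊎ Fin l} r → E ⊎ Fin l → Set
    Inc = Incident (attached-ends ends v)

    old-incident : ∀ u e → Incident {r = r} ends u e ⇔ Inc (to₀ (inj₁ u)) (inj₁ e)
    old-incident (inj₁ w)       e = mk⇔ (Sum.map (cong inj₁) (cong inj₁)) (Sum.map inj₁-injective inj₁-injective)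
    old-incident (inj₂ (f , j)) e = mk⇔ (cong inj₁) inj₁-injective

    old-at-c : ∀ w → w ≡ c ⇔ Inverse.to M.vertices w ≡ inj₁ v
    old-at-c w = mk⇔ (λ { refl → to-c }) (λ eq → trans (sym (Inverse.strictlyInverseʳ M.vertices w))
      (trans (cong (Inverse.from M.vertices) (trans eq (sym to-c))) (Inverse.strictlyInverseʳ M.vertices c)))

    incident : ∀ u f → Inverse.from vertices₀ u ∈ edge X (Inverse.from edges f) ⇔ Inc (to₀ u) f
    incident (inj₁ u) (inj₁ e) rewrite old-edge (Inverse.from M.edges e) =
      old-incident u e ⇔-∘ (subst₂ (λ u′ e′ → Inverse.from M.vertices u ∈ edge H (Inverse.from M.edges e) ⇔ Incident ends u′ e′)
        (Inverse.strictlyInverseˡ M.vertices u) (Inverse.strictlyInverseˡ M.edges e)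
        (M.incidence (Inverse.from M.vertices u) (Inverse.from M.edges e)) ⇔-∘ ∈-++ˡ)
    incident (inj₂ (i , zero)) (inj₁ e) rewrite old-edge (Inverse.from M.edges e) =
      mk⇔ (λ h → ⊥-elim (∉⊥ (Equivalence.to (∈-++ʳ {p = edge H (Inverse.from M.edges e)}) h))) (λ { (inj₁ ()) ; (inj₂ ()) })
    incident (inj₂ (i , suc j)) (inj₁ e) rewrite old-edge (Inverse.from M.edges e) =
      mk⇔ (λ h → ⊥-elim (∉⊥ (Equivalence.to (∈-++ʳ {p = edge H (Inverse.from M.edges e)}) h))) (λ ())
    incident (inj₁ u) (inj₂ i) rewrite new-edge i = at u ⇔-∘ (old-at-c (Inverse.from M.vertices u) ⇔-∘
      (mk⇔ (x∈⁅y⁆⇒x≡y c) (λ { refl → x∈⁅x⁆ c }) ⇔-∘ ∈-++ˡ))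
      where
      at : ∀ u → Inverse.to M.vertices (Inverse.from M.vertices u) ≡ inj₁ v ⇔ Inc (to₀ (inj₁ u)) (inj₂ i)
      at u rewrite Inverse.strictlyInverseˡ M.vertices u = core u
        where
        core : ∀ u → u ≡ inj₁ v ⇔ Inc (to₀ (inj₁ u)) (inj₂ i)
        core (inj₁ w)       = mk⇔ (λ { refl → inj₁ refl }) (λ { (inj₁ refl) → refl })
        core (inj₂ (e , j)) = mk⇔ (λ ()) (λ ())
    incident (inj₂ (i′ , zero)) (inj₂ i) rewrite new-edge i =
      mk⇔ (λ { refl → inj₂ refl }) (λ { (inj₂ refl) → refl }) ⇔-∘ (∈-block {l} {suc r} {i} {i′} {zero} ⇔-∘ ∈-++ʳ {p = ⁅ c ⁆})
    incident (inj₂ (i′ , suc j)) (inj₂ i) rewrite new-edge i =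
      mk⇔ (cong inj₂) inj₂-injective ⇔-∘ (∈-block {l} {suc r} {i} {i′} {suc j} ⇔-∘ ∈-++ʳ {p = ⁅ c ⁆})

    model : Model X r (attached-ends ends v)
    model = record
      { vertices  = regroup ↔-∘ vertices₀
      ; edges     = edges
      ; incidence = λ w e → subst (λ e′ → w ∈ edge X e′ ⇔ Inc (to₀ (Inverse.to vertices₀ w)) (Inverse.to edges e))
          (Inverse.strictlyInverseʳ edges e)
          (∈-from {P = λ u → Inc (to₀ u) (Inverse.to edges e)} vertices₀ (λ u → incident u (Inverse.to edges e)) w)
      }

  bowtie-ends : Fin 6 → Fin 5 × Fin 5
  bowtie-ends 0F = 0F , 1F
  bowtie-ends 1F = 1F , 2F
  bowtie-ends 2F = 2F , 0F
  bowtie-ends 3F = 0F , 3F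
  bowtie-ends 4F = 3F , 4F
  bowtie-ends 5F = 4F , 0F

  bowtie-on : ∀ v e → v ∈ bowtieEdge e ⇔ On bowtie-ends v e
  bowtie-on v 0F = ∈-pair
  bowtie-on v 1F = ∈-pair
  bowtie-on v 2F = ∈-pair
  bowtie-on v 3F = ∈-pair
  bowtie-on v 4F = ∈-pair
  bowtie-on v 5F = ∈-pair

  B₂C-model₀ : ∀ r l₁ l₂ → Model (B₂C (suc (suc r)) l₁ l₂) r (attached-ends {l = l₂} (attached-ends {l = l₁} bowtie-ends 0F) (inj₁ 1F))
  B₂C-model₀ r l₁ l₂ = Attach.model r (Attach.model r (power-model (suc (suc r)) bowtie bowtie-ends bowtie-on) 0F 0F refl l₁) 1F (inj₁ 1F) refl l₂

-- Coordinates on B₂C and bijections with prescribed values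

module Labellings where

  open GraphModels using (Model; Vertex; On; Incident; relabel; Simple; to-injective)
  open PowerHypergraphs using (attached-ends; bowtie-ends; B₂C-model₀)
  open import Defs using (order; B₂C; InCommonEdge; Connected)
  open import Data.Maybe.Base using (Maybe; just; nothing)
  open import Relation.Binary.Construct.Closure.ReflexiveTransitive using (Star; ε; _◅_; _◅◅_; reverse)

  pattern base i = inj₁ (inj₁ i)
  pattern leaf i = inj₁ (inj₂ i)
  pattern tail i = inj₂ i

  Place : ℕ → ℕ → Set
  Place l₁ l₂ = (Fin 5 ⊎ Fin l₁) ⊎ Fin l₂

  -- Every edge of the graph B₂C(l₁, l₂) except {1, 2} and {3, 4} is named by its
  -- endpoint farther from the vertex 0; {1, 2} is named by 0.
  canonical : ∀ {l₁ l₂} → Maybe (Place l₁ l₂) → Place l₁ l₂ × Place l₁ l₂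
  canonical nothing             = base 3F , base 4F
  canonical (just (base 0F))    = base 1F , base 2F
  canonical (just (base (suc i))) = base 0F , base (suc i)
  canonical (just (leaf i))     = base 0F , leaf i
  canonical (just (tail i))     = base 1F , tail i

  name : ∀ {l₁ l₂} → (Fin 6 ⊎ Fin l₁) ⊎ Fin l₂ → Maybe (Place l₁ l₂)
  name (base 0F) = just (base 1F)
  name (base 1F) = just (base 0F)
  name (base 2F) = just (base 2F)
  name (base 3F) = just (base 3F)
  name (base 4F) = nothing
  name (base 5F) = just (base 4F)
  name (leaf i)  = just (leaf i)
  name (tail i)  = just (tail i)

  unname : ∀ {l₁ l₂} → Maybe (Place l₁ l₂) → (Fin 6 ⊎ Fin l₁) ⊎ Fin l₂
  unname (just (base 1F)) = base 0F
  unname (just (base 0F)) = base 1F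
  unname (just (base 2F)) = base 2F
  unname (just (base 3F)) = base 3F
  unname nothing          = base 4F
  unname (just (base 4F)) = base 5F
  unname (just (leaf i))  = leaf i
  unname (just (tail i))  = tail i

  naming : ∀ {l₁ l₂} → ((Fin 6 ⊎ Fin l₁) ⊎ Fin l₂) ↔ Maybe (Place l₁ l₂)
  naming = mk↔ₛ′ name unname
    (λ { (just (base 1F)) → refl ; (just (base 0F)) → refl ; (just (base 2F)) → refl ; (just (base 3F)) → refl
       ; nothing → refl ; (just (base 4F)) → refl ; (just (leaf i)) → refl ; (just (tail i)) → refl })
    (λ { (base 0F) → refl ; (base 1F) → refl ; (base 2F) → refl ; (base 3F) → refl ; (base 4F) → refl ; (base 5F) → refl
       ; (leaf i) → refl ; (tail i) → refl })

  B₂C-model : ∀ r l₁ l₂ → Model (B₂C (suc (suc r)) l₁ l₂) r (canonical {l₁} {l₂})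
  B₂C-model r l₁ l₂ = relabel (B₂C-model₀ r l₁ l₂) (↔-id _) naming same
    where
    same : ∀ v e → On (attached-ends {l = l₂} (attached-ends {l = l₁} bowtie-ends 0F) (inj₁ 1F)) v e ⇔ On canonical v (name e)
    same v (base 0F) = mk⇔ (λ h → h) (λ h → h)
    same v (base 1F) = mk⇔ (λ h → h) (λ h → h)
    same v (base 2F) = mk⇔ Sum.swap Sum.swap
    same v (base 3F) = mk⇔ (λ h → h) (λ h → h)
    same v (base 4F) = mk⇔ (λ h → h) (λ h → h)
    same v (base 5F) = mk⇔ Sum.swap Sum.swap
    same v (leaf i)  = mk⇔ (λ h → h) (λ h → h)
    same v (tail i)  = mk⇔ (λ h → h) (λ h → h)

  -- Junk value: the name nothing of the edge {3, 4} is also returned for places not joined by an edge.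
  between : ∀ {l₁ l₂} → Place l₁ l₂ → Place l₁ l₂ → Maybe (Place l₁ l₂)
  between (base 0F) v         = just v
  between v         (base 0F) = just v
  between (base 1F) (base 2F) = just (base 0F)
  between (base 2F) (base 1F) = just (base 0F)
  between (base 1F) (tail i)  = just (tail i)
  between (tail i)  (base 1F) = just (tail i)
  between _         _         = nothing

  between-ends : ∀ {l₁ l₂} (e : Maybe (Place l₁ l₂)) → between (proj₁ (canonical e)) (proj₂ (canonical e)) ≡ e
  between-ends nothing               = refl
  between-ends (just (base 0F))      = refl
  between-ends (just (base (suc i))) = refl
  between-ends (just (leaf i))       = refl
  between-ends (just (tail i))       = refl

  between-ends′ : ∀ {l₁ l₂} (e : Maybe (Place l₁ l₂)) → between (proj₂ (canonical e)) (proj₁ (canonical e)) ≡ e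
  between-ends′ nothing               = refl
  between-ends′ (just (base 0F))      = refl
  between-ends′ (just (base 1F))      = refl
  between-ends′ (just (base 2F))      = refl
  between-ends′ (just (base 3F))      = refl
  between-ends′ (just (base 4F))      = refl
  between-ends′ (just (leaf i))       = refl
  between-ends′ (just (tail i))       = refl

  canonical-simple : ∀ {l₁ l₂} → Simple (canonical {l₁} {l₂})
  canonical-simple {l₁} {l₂} = record
    { proper = λ { nothing () ; (just (base 0F)) () ; (just (base (suc i))) () ; (just (leaf i)) () ; (just (tail i)) () }
    ; single = λ a≢b a∈e b∈e a∈f b∈f → trans (sym (named a≢b a∈e b∈e)) (named a≢b a∈f b∈f)
    }
    where
    named : ∀ {a b e} → a ≢ b → On (canonical {l₁} {l₂}) a e → On canonical b e → between a b ≡ e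
    named a≢b (inj₁ refl) (inj₁ refl) = ⊥-elim (a≢b refl)
    named {e = e} a≢b (inj₁ refl) (inj₂ refl) = between-ends e
    named {e = e} a≢b (inj₂ refl) (inj₁ refl) = between-ends′ e
    named a≢b (inj₂ refl) (inj₂ refl) = ⊥-elim (a≢b refl)

  B₂C-connected : ∀ r l₁ l₂ → Connected (B₂C (suc (suc r)) l₁ l₂)
  B₂C-connected r l₁ l₂ x y = to-root x ◅◅ reverse flip-edge (to-root y)
    where
    X = B₂C (suc (suc r)) l₁ l₂
    open Model (B₂C-model r l₁ l₂)
    at : Vertex r → Fin (order X)
    at = Inverse.from vertices
    flip-edge : ∀ {u v} → InCommonEdge X u v → InCommonEdge X v u
    flip-edge (e , u∈e , v∈e) = e , v∈e , u∈e
    common : ∀ {u v} e → Incident canonical u e → Incident canonical v e → InCommonEdge X (at u) (at v)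
    common {u} {v} e u∈e v∈e = Inverse.from edges e , member u u∈e , member v v∈e
      where
      member : ∀ w → Incident canonical w e → _
      member w w∈e = Equivalence.from (incidence (at w) (Inverse.from edges e))
        (subst₂ (Incident canonical) (sym (Inverse.strictlyInverseˡ vertices w)) (sym (Inverse.strictlyInverseˡ edges e)) w∈e)
    root : Fin (order X)
    root = at (inj₁ (base 0F))
    core-root : ∀ v → Star (InCommonEdge X) (at (inj₁ v)) root
    core-root (base 0F)      = ε
    core-root (base (suc i)) = common (just (base (suc i))) (inj₂ refl) (inj₁ refl) ◅ ε
    core-root (leaf i)       = common (just (leaf i)) (inj₂ refl) (inj₁ refl) ◅ ε
    core-root (tail i)       = common (just (tail i)) (inj₂ refl) (inj₁ refl) ◅ core-root (base 1F)
    to-root : ∀ x → Star (InCommonEdge X) x root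
    to-root x = subst (λ x → Star (InCommonEdge X) x root) (Inverse.strictlyInverseʳ vertices x) (place-root (Inverse.to vertices x))
      where
      place-root : ∀ u → Star (InCommonEdge X) (at u) root
      place-root (inj₁ v)       = core-root v
      place-root (inj₂ (e , j)) = common {inj₂ (e , j)} {inj₁ (proj₁ (canonical e))} e refl (inj₁ refl) ◅ core-root (proj₁ (canonical e))

  rename : ∀ {V E V′ E′ : Set} → (V ↔ V′) → (E ↔ E′) → (E → V × V) → E′ → V′ × V′
  rename χ ψ ends e = Inverse.to χ (proj₁ (ends (Inverse.from ψ e))) , Inverse.to χ (proj₂ (ends (Inverse.from ψ e)))

  module _ {V E V′ E′ : Set} (χ : V ↔ V′) (ψ : E ↔ E′) {ends : E → V × V} where

    rename-on : ∀ {v e} → On (rename χ ψ ends) v e → On ends (Inverse.from χ v) (Inverse.from ψ e)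
    rename-on = Sum.map back back
      where
      back : ∀ {v w} → v ≡ Inverse.to χ w → Inverse.from χ v ≡ w
      back refl = Inverse.strictlyInverseʳ χ _

    rename-simple : Simple ends → Simple (rename χ ψ ends)
    rename-simple simple = record
      { proper = λ e eq → Simple.proper simple (Inverse.from ψ e) (to-injective χ eq)
      ; single = λ a≢b a∈e b∈e a∈f b∈f → to-injective (↔-sym ψ)
          (Simple.single simple (λ eq → a≢b (to-injective (↔-sym χ) eq)) (rename-on a∈e) (rename-on b∈e) (rename-on a∈f) (rename-on b∈f))
      }

    rename-model : ∀ {X r} → Model X r ends → Model X r (rename χ ψ ends)
    rename-model M = relabel M χ ψ λ v e → mk⇔
      (λ h → subst (λ e′ → Inverse.to χ v ≡ Inverse.to χ (proj₁ (ends e′)) ⊎ Inverse.to χ v ≡ Inverse.to χ (proj₂ (ends e′)))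
               (sym (Inverse.strictlyInverseʳ ψ e)) (Sum.map (cong (Inverse.to χ)) (cong (Inverse.to χ)) h))
      (λ h → subst₂ (On ends) (Inverse.strictlyInverseʳ χ v) (Inverse.strictlyInverseʳ ψ e) (rename-on h))

  maybe↔suc : ∀ {V : Set} {n} → (V ↔ Fin n) → Maybe V ↔ Fin (suc n)
  maybe↔suc χ = mk↔ₛ′
    (λ { nothing → zero ; (just v) → suc (Inverse.to χ v) })
    (λ { zero → nothing ; (suc x) → just (Inverse.from χ x) })
    (λ { zero → refl ; (suc x) → cong suc (Inverse.strictlyInverseˡ χ x) })
    (λ { nothing → refl ; (just v) → cong just (Inverse.strictlyInverseʳ χ v) })

  -- Label zero is the edge {3, 4}, and the successor of a vertex is the edge named by it. H is
  -- numbered by its tree in the same way, so edges of the two graphs correspond by label.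
  labelled : ∀ {l₁ l₂ n} → (Place l₁ l₂ ↔ Fin n) → Fin (suc n) → Fin n × Fin n
  labelled χ = rename χ (maybe↔suc χ) canonical

  labelled-at : ∀ {l₁ l₂ n} (χ : Place l₁ l₂ ↔ Fin n) v →
                labelled χ (suc (Inverse.to χ v)) ≡ (Inverse.to χ (proj₁ (canonical (just v))) , Inverse.to χ (proj₂ (canonical (just v))))
  labelled-at χ v = cong (λ w → Inverse.to χ (proj₁ (canonical (just w))) , Inverse.to χ (proj₂ (canonical (just w)))) (Inverse.strictlyInverseʳ χ v)

  -- A missed value could be added as one more point, giving an injection from a + 1 points into n ≤
  -- a.
  injective⇒surjective : ∀ {a n} (h : Fin a → Fin n) → Injective _≡_ _≡_ h → n ℕ.≤ a → ∀ x → ∃[ i ] h i ≡ x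
  injective⇒surjective {a} {n} h inj n≤a x = decidable-stable (any? (λ i → h i ≟ᶠ x)) λ missed →
    ℕₚ.1+n≰n (ℕₚ.≤-trans (injective⇒≤ {f = extended} (extended-injective missed)) n≤a)
    where
    extended : Fin (suc a) → Fin n
    extended zero    = x
    extended (suc i) = h i
    extended-injective : ¬ (∃[ i ] h i ≡ x) → Injective _≡_ _≡_ extended
    extended-injective missed {zero}  {zero}  _  = refl
    extended-injective missed {zero}  {suc j} eq = ⊥-elim (missed (j , sym eq))
    extended-injective missed {suc i} {zero}  eq = ⊥-elim (missed (i , eq))
    extended-injective missed {suc i} {suc j} eq = cong suc (inj eq)

  outside-image : ∀ {a n} (h : Fin a → Fin n) → Injective _≡_ _≡_ h → a ℕ.< n → ∃[ x ] (∀ i → h i ≢ x)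
  outside-image {a} {n} h inj a<n = decidable-stable (any? (λ x → all? (λ i → ¬? (h i ≟ᶠ x)))) λ none →
    let hit : ∀ x → ∃[ i ] h i ≡ x
        hit x = decidable-stable (any? (λ i → h i ≟ᶠ x)) (λ miss → none (x , λ i eq → miss (i , eq)))
        section-injective : Injective _≡_ _≡_ (λ x → proj₁ (hit x))
        section-injective {x} {y} eq = trans (sym (proj₂ (hit x))) (trans (cong h eq) (proj₂ (hit y)))
    in ℕₚ.1+n≰n (ℕₚ.≤-trans a<n (injective⇒≤ section-injective))

  bijection : ∀ {a n} (h : Fin a → Fin n) → Injective _≡_ _≡_ h → n ℕ.≤ a → Fin a ↔ Fin n
  bijection h inj n≤a = mk↔ₛ′ h (λ x → proj₁ (hit x)) (λ x → proj₂ (hit x)) (λ i → inj (proj₂ (hit (h i))))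
    where hit = injective⇒surjective h inj n≤a

  complete : ∀ {j n} (f : Fin j → Fin n) → Injective _≡_ _≡_ f → ∀ l → j ℕ.+ l ℕ.≤ n →
             ∃[ g ] (∀ {a b : Fin j ⊎ Fin l} → [ f , g ]′ a ≡ [ f , g ]′ b → a ≡ b)
  complete f inj zero    _  = (λ ()) , λ { {inj₁ a} {inj₁ b} eq → cong inj₁ (inj eq) }
  complete {j} {n} f inj (suc l) le with complete f inj l (ℕₚ.≤-trans (ℕₚ.+-monoʳ-≤ j (ℕₚ.n≤1+n l)) le)
  ... | g , inj′ with outside-image (λ i → [ f , g ]′ (Inverse.to +↔⊎ i)) (λ eq → to-injective +↔⊎ (inj′ eq)) (subst (ℕ._≤ n) (ℕₚ.+-suc j l) le)
  ...   | x , new = g′ , λ {a} {b} → inj″ {a} {b}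
    where
    g′ : Fin (suc l) → Fin n
    g′ zero    = x
    g′ (suc i) = g i
    unhit : ∀ s → [ f , g ]′ s ≢ x
    unhit s eq = new (Inverse.from +↔⊎ s) (trans (cong [ f , g ]′ (Inverse.strictlyInverseˡ +↔⊎ s)) eq)
    inj″ : ∀ {a b : Fin j ⊎ Fin (suc l)} → [ f , g′ ]′ a ≡ [ f , g′ ]′ b → a ≡ b
    inj″ {inj₁ a}       {inj₁ b}       eq = cong inj₁ (inj eq)
    inj″ {inj₁ a}       {inj₂ zero}    eq = ⊥-elim (unhit (inj₁ a) eq)
    inj″ {inj₁ a}       {inj₂ (suc i)} eq with () ← inj′ {inj₁ a} {inj₂ i} eq
    inj″ {inj₂ zero}    {inj₁ b}       eq = ⊥-elim (unhit (inj₁ b) (sym eq))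
    inj″ {inj₂ zero}    {inj₂ zero}    eq = refl
    inj″ {inj₂ zero}    {inj₂ (suc i)} eq = ⊥-elim (unhit (inj₂ i) (sym eq))
    inj″ {inj₂ (suc i)} {inj₁ b}       eq with () ← inj′ {inj₂ i} {inj₁ b} eq
    inj″ {inj₂ (suc i)} {inj₂ zero}    eq = ⊥-elim (unhit (inj₂ i) eq)
    inj″ {inj₂ (suc i)} {inj₂ (suc k)} eq = cong (λ z → inj₂ (suc z)) (inj₂-inj (inj′ {inj₂ i} {inj₂ k} eq))
      where
      inj₂-inj : ∀ {A B : Set} {x y : B} → inj₂ {A = A} x ≡ inj₂ y → x ≡ y
      inj₂-inj refl = refl

  -- Used to place the named vertices of B₂C at chosen vertices of the graph of H; where the l
  -- leaves go is immaterial.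
  extend : ∀ {j l n} (f : Fin j → Fin n) → Injective _≡_ _≡_ f → n ≡ j ℕ.+ l →
           Σ ((Fin j ⊎ Fin l) ↔ Fin n) λ φ → ∀ i → Inverse.to φ (inj₁ i) ≡ f i
  extend {j} {l} {n} f inj refl =
    let g , inj′ = complete f inj l ℕₚ.≤-refl
        φ = bijection (λ i → [ f , g ]′ (Inverse.to +↔⊎ i)) (λ eq → to-injective +↔⊎ (inj′ eq)) ℕₚ.≤-refl
    in φ ↔-∘ ↔-sym +↔⊎ , λ i → cong [ f , g ]′ (Inverse.strictlyInverseˡ +↔⊎ (inj₁ i))

-- Cycles, breadth-first trees and chords in simple graphs

module GraphCycles where

  open GraphModels using (On; Simple)
  open import Defs using (next)
  open import Data.Fin.Induction using (<-weakInduction; >-weakInduction)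
  open import Data.Fin.Relation.Unary.Top using (View; view; view-fromℕ; view-inject₁; ‵fromℕ; ‵inject₁)
  open import Data.Nat.DivMod using (m<n⇒m%n≡m; n%n≡0; m%n<n)
  open import Data.Unit.Base using (⊤; tt)
  open import Relation.Binary.Construct.Closure.ReflexiveTransitive using (Star; ε; _◅_; _◅◅_; reverse)

  next-inject₁ : ∀ {l} (t : Fin l) → next (inject₁ t) ≡ suc t
  next-inject₁ {l} t = toℕ-injective (trans (toℕ-fromℕ< (m%n<n (suc (toℕ (inject₁ t))) (suc l)))
    (trans (cong (λ z → suc z ℕ.% suc l) (toℕ-inject₁ t)) (m<n⇒m%n≡m (s≤s (toℕ<n t)))))

  next-fromℕ : ∀ l → next (fromℕ l) ≡ zero
  next-fromℕ l = toℕ-injective (trans (toℕ-fromℕ< (m%n<n (suc (toℕ (fromℕ l))) (suc l)))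
    (trans (cong (λ z → suc z ℕ.% suc l) (toℕ-fromℕ l)) (n%n≡0 (suc l))))

  prev : ∀ {l} → Fin (suc l) → Fin (suc l)
  prev {l} zero = fromℕ l
  prev (suc t)  = inject₁ t

  next-prev : ∀ {l} (i : Fin (suc l)) → next (prev i) ≡ i
  next-prev {l} zero = next-fromℕ l
  next-prev (suc t)  = next-inject₁ t

  prev-next : ∀ {l} (i : Fin (suc l)) → prev (next i) ≡ i
  prev-next {l} i with view i
  ... | ‵fromℕ     = cong prev (next-fromℕ l)
  ... | ‵inject₁ t = cong prev (next-inject₁ t)

  next-injective : ∀ {l} {i j : Fin (suc l)} → next i ≡ next j → i ≡ j
  next-injective {i = i} {j} eq = trans (sym (prev-next i)) (trans (cong prev eq) (prev-next j))

  next≢ : ∀ {l} (i : Fin (suc (suc l))) → next i ≢ i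
  next≢ {l} i eq with view i
  ... | ‵fromℕ     with () ← trans (sym (next-fromℕ (suc l))) eq
  ... | ‵inject₁ t = ℕₚ.1+n≢n (trans (cong toℕ (trans (sym (next-inject₁ t)) eq)) (toℕ-inject₁ t))

  module _ {n k : ℕ} (ends : Fin k → Fin n × Fin n) where

    -- Incidence and injectivity suffice: in a simple graph the intersection conditions of a loose
    -- cycle follow from them.
    record Cycle : Set where
      field
        p         : ℕ
        core      : Fin (3 ℕ.+ p) → Fin n
        cycleEdge : Fin (3 ℕ.+ p) → Fin k
        core-inj  : Injective _≡_ _≡_ core
        edge-inj  : Injective _≡_ _≡_ cycleEdge
        start     : ∀ i → On ends (core i) (cycleEdge i)
        finish    : ∀ i → On ends (core (next i)) (cycleEdge i)

    infix 4 _∈ᶜ_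
    _∈ᶜ_ : Fin k → Cycle → Set
    e ∈ᶜ C = ∃[ i ] Cycle.cycleEdge C i ≡ e

    _∈ᶜ?_ : ∀ e C → Dec (e ∈ᶜ C)
    e ∈ᶜ? C = any? (λ i → Cycle.cycleEdge C i ≟ᶠ e)

    Differ : Cycle → Cycle → Set
    Differ C D = ¬ (∀ e → e ∈ᶜ C ⇔ e ∈ᶜ D)

    Joined : (Fin k → Set) → Fin n → Fin n → Set
    Joined S u v = ∃[ e ] S e × On ends u e × On ends v e

    joined-sym : ∀ {S u v} → Joined S u v → Joined S v u
    joined-sym (e , s , u∈e , v∈e) = e , s , v∈e , u∈e

  module Combinatorics {n k : ℕ} {ends : Fin k → Fin n × Fin n} (simple : Simple ends) where
    open Simple simple

    V E : Set
    V = Fin n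
    E = Fin k

    On? : ∀ v e → Dec (On ends v e)
    On? v e = (v ≟ᶠ proj₁ (ends e)) ⊎-dec (v ≟ᶠ proj₂ (ends e))

    two-ends : ∀ {a b x e} → a ≢ b → On ends a e → On ends b e → On ends x e → x ≡ a ⊎ x ≡ b
    two-ends a≢b (inj₁ refl) (inj₁ refl) _         = ⊥-elim (a≢b refl)
    two-ends a≢b (inj₁ refl) (inj₂ refl) x∈e       = x∈e
    two-ends a≢b (inj₂ refl) (inj₁ refl) x∈e       = Sum.swap x∈e
    two-ends a≢b (inj₂ refl) (inj₂ refl) _         = ⊥-elim (a≢b refl)

    other-end : ∀ {a e} → On ends a e → ∃[ b ] b ≢ a × On ends b e
    other-end {e = e} (inj₁ refl) = proj₂ (ends e) , ≢-sym (proper e) , inj₂ refl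
    other-end {e = e} (inj₂ refl) = proj₁ (ends e) , proper e , inj₁ refl

    data Path (S : E → Set) : ℕ → V → V → Set
    verts : ∀ {S l a b} → Path S l a b → Fin (suc l) → V

    data Path S where
      []   : ∀ {b} → Path S 0 b b
      cons : ∀ {l x y b} e → S e → On ends x e → On ends y e → (p : Path S l y b) → (∀ i → verts p i ≢ x) → Path S (suc l) x b

    verts {a = a} p                  zero    = a
    verts (cons e s x∈e y∈e p fresh) (suc i) = verts p i

    path-edges : ∀ {S l a b} → Path S l a b → Fin l → E
    path-edges (cons e s x∈e y∈e p fresh) zero    = e
    path-edges (cons e s x∈e y∈e p fresh) (suc i) = path-edges p i

    path-S : ∀ {S l a b} (p : Path S l a b) t → S (path-edges p t)
    path-S (cons e s x∈e y∈e p fresh) zero    = s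
    path-S (cons e s x∈e y∈e p fresh) (suc i) = path-S p i

    path-start : ∀ {S l a b} (p : Path S l a b) t → On ends (verts p (inject₁ t)) (path-edges p t)
    path-start (cons e s x∈e y∈e p fresh) zero    = x∈e
    path-start (cons e s x∈e y∈e p fresh) (suc i) = path-start p i

    path-finish : ∀ {S l a b} (p : Path S l a b) t → On ends (verts p (suc t)) (path-edges p t)
    path-finish (cons e s x∈e y∈e p fresh) zero    = y∈e
    path-finish (cons e s x∈e y∈e p fresh) (suc i) = path-finish p i

    path-last : ∀ {S l a b} (p : Path S l a b) → verts p (fromℕ l) ≡ b
    path-last []                          = refl
    path-last (cons e s x∈e y∈e p fresh)  = path-last p

    verts-injective : ∀ {S l a b} (p : Path S l a b) → Injective _≡_ _≡_ (verts p)
    verts-injective p                          {zero}  {zero}  eq = refl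
    verts-injective (cons e s x∈e y∈e p fresh) {zero}  {suc j} eq = ⊥-elim (fresh j (sym eq))
    verts-injective (cons e s x∈e y∈e p fresh) {suc i} {zero}  eq = ⊥-elim (fresh i eq)
    verts-injective (cons e s x∈e y∈e p fresh) {suc i} {suc j} eq = cong suc (verts-injective p eq)

    path-edge-ends : ∀ {S l a b} (p : Path S l a b) t {x} → On ends x (path-edges p t) → ∃[ i ] verts p i ≡ x
    path-edge-ends p t x∈e with two-ends (λ eq → ℕₚ.1+n≢n (trans (cong toℕ (sym (verts-injective p eq))) (toℕ-inject₁ t))) (path-start p t) (path-finish p t) x∈e
    ... | inj₁ x≡ = inject₁ t , sym x≡
    ... | inj₂ x≡ = suc t , sym x≡

    path-edges-injective : ∀ {S l a b} (p : Path S l a b) → Injective _≡_ _≡_ (path-edges p)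
    path-edges-injective (cons e s x∈e y∈e p fresh) {zero}  {zero}  eq = refl
    path-edges-injective (cons e s x∈e y∈e p fresh) {zero}  {suc j} eq =
      let i , hit = path-edge-ends p j (subst (On ends _) eq x∈e) in ⊥-elim (fresh i hit)
    path-edges-injective (cons e s x∈e y∈e p fresh) {suc i} {zero}  eq =
      let j , hit = path-edge-ends p i (subst (On ends _) (sym eq) x∈e) in ⊥-elim (fresh j hit)
    path-edges-injective (cons e s x∈e y∈e p fresh) {suc i} {suc j} eq = cong suc (path-edges-injective p eq)

    suffix : ∀ {S l a b} (p : Path S l a b) i → ∃[ l′ ] Path S l′ (verts p i) b
    suffix {l = l} p                  zero    = l , p
    suffix (cons e s x∈e y∈e p fresh) (suc i) = suffix p i

    simplify : ∀ {S a b} → Star (Joined ends S) a b → ∃[ l ] Path S l a b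
    simplify ε = 0 , []
    simplify {S} {a} {b} ((e , s , a∈e , y∈e) ◅ walk) with simplify walk
    ... | l , p with any? (λ i → verts p i ≟ᶠ a)
    -- When the path already visits the new start, only its part after that visit is kept.
    ...   | yes (i , eq) = subst (λ v → ∃[ l′ ] Path S l′ v b) eq (suffix p i)
    ...   | no unvisited = suc l , cons e s a∈e y∈e p (λ i eq → unvisited (i , eq))

    -- `second` is the edge other than e by which the cycle leaves a; it allows one to say which of
    -- the edges at a the cycle uses.
    record CycleThrough (e : E) (a : V) (S : E → Set) : Set where
      field
        cycle    : Cycle ends
        through  : _∈ᶜ_ ends e cycle
        within   : ∀ {f} → _∈ᶜ_ ends f cycle → f ≡ e ⊎ S f
        second   : E
        second∈  : _∈ᶜ_ ends second cycle
        second-S : S second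
        second-a : On ends a second

    -- A path of length 0 is excluded by a ≢ b, and one of length 1 would be e itself by simplicity.
    -- Together with e the path therefore has length at least 3.
    close : ∀ {e a b S} → a ≢ b → On ends a e → On ends b e → ¬ S e → Star (Joined ends S) a b → CycleThrough e a S
    close {e} {a} {b} {S} a≢b a∈e b∈e ¬Se walk = build (proj₁ (simplify walk)) (proj₂ (simplify walk))
      where
      build : ∀ l → Path S l a b → CycleThrough e a S
      build zero [] = ⊥-elim (a≢b refl)
      build (suc zero) (cons f s a∈f b∈f [] fresh) = ⊥-elim (¬Se (subst S (single a≢b a∈f b∈f a∈e b∈e) s))
      build (suc (suc q)) path = record
        { cycle    = record
            { p = q ; core = verts path ; cycleEdge = cedge ; core-inj = verts-injective path ; edge-inj = λ {i} {j} → cedge-injective i j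
            ; start = start ; finish = finish }
        ; through  = fromℕ l , cedge-last
        ; within   = λ { (i , eq) → subst (λ f → f ≡ e ⊎ S f) eq (members i) }
        ; second   = path-edges path zero
        ; second∈  = inject₁ zero , cedge-inject₁ zero
        ; second-S = path-S path zero
        ; second-a = path-start path zero
        }
        where
        l = suc (suc q)
        from-view : ∀ {i : Fin (suc l)} → View i → E
        from-view ‵fromℕ       = e
        from-view (‵inject₁ t) = path-edges path t
        cedge : Fin (suc l) → E
        cedge i = from-view (view i)
        cedge-last : cedge (fromℕ l) ≡ e
        cedge-last = cong from-view (view-fromℕ l)
        cedge-inject₁ : ∀ t → cedge (inject₁ t) ≡ path-edges path t
        cedge-inject₁ t = cong from-view (view-inject₁ t)
        members : ∀ i → cedge i ≡ e ⊎ S (cedge i)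
        members i with view i
        ... | ‵fromℕ     = inj₁ refl
        ... | ‵inject₁ t = inj₂ (path-S path t)
        cedge-injective : ∀ i j → cedge i ≡ cedge j → i ≡ j
        cedge-injective i j eq with view i | view j
        ... | ‵fromℕ     | ‵fromℕ      = refl
        ... | ‵fromℕ     | ‵inject₁ t  = ⊥-elim (¬Se (subst S (sym eq) (path-S path t)))
        ... | ‵inject₁ t | ‵fromℕ      = ⊥-elim (¬Se (subst S eq (path-S path t)))
        ... | ‵inject₁ t | ‵inject₁ t′ = cong inject₁ (path-edges-injective path eq)
        start : ∀ i → On ends (verts path i) (cedge i)
        start i with view i
        ... | ‵fromℕ     = subst (λ v → On ends v e) (sym (path-last path)) b∈e
        ... | ‵inject₁ t = path-start path t
        finish : ∀ i → On ends (verts path (next i)) (cedge i)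
        finish i with view i
        ... | ‵fromℕ     = subst (λ j → On ends (verts path j) e) (sym (next-fromℕ l)) a∈e
        ... | ‵inject₁ t = subst (λ j → On ends (verts path j) (path-edges path t)) (sym (next-inject₁ t)) (path-finish path t)

    star-map : ∀ {S S′ : E → Set} → (∀ {e} → S e → S′ e) → ∀ {a b} → Star (Joined ends S) a b → Star (Joined ends S′) a b
    star-map f ε = ε
    star-map f ((e , s , p , q) ◅ walk) = (e , f s , p , q) ◅ star-map f walk

    -- Three edges at x whose other ends are joined outside x give three cycles.
    module Fork (x root : V) where

      Away : E → Set
      Away e = ¬ On ends x e

      Out : E → Set
      Out f = On ends x f × ∃[ z ] z ≢ x × On ends z f × Star (Joined ends Away) z root

      -- From x along g, away from x by way of the root, and back along f. Apart from f, the only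
      -- edge at x that the walk may use is g, which keeps a third edge at x off the cycle.
      cycle₂ : ∀ {f g} → f ≢ g → Out f → Out g → CycleThrough f x (λ e → Away e ⊎ e ≡ g)
      cycle₂ {f} {g} f≢g (x∈f , z , z≢x , z∈f , z⇝) (x∈g , z′ , z′≢x , z′∈g , z′⇝) =
        close (≢-sym z≢x) x∈f z∈f [ (λ away → away x∈f) , f≢g ]′
          ((g , inj₂ refl , x∈g , z′∈g) ◅ (star-map inj₁ (z′⇝ ◅◅ reverse (joined-sym ends) z⇝)))

      second≡ : ∀ {f g} (C : CycleThrough f x (λ e → Away e ⊎ e ≡ g)) → _∈ᶜ_ ends g (CycleThrough.cycle C)
      second≡ C with CycleThrough.second-S C
      ... | inj₁ away = ⊥-elim (away (CycleThrough.second-a C))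
      ... | inj₂ refl = CycleThrough.second∈ C

      avoids : ∀ {f g h} (C : CycleThrough f x (λ e → Away e ⊎ e ≡ g)) → On ends x h → h ≢ f → h ≢ g → ¬ _∈ᶜ_ ends h (CycleThrough.cycle C)
      avoids C x∈h h≢f h≢g h∈C with CycleThrough.within C h∈C
      ... | inj₁ h≡f         = h≢f h≡f
      ... | inj₂ (inj₁ away) = away x∈h
      ... | inj₂ (inj₂ h≡g)  = h≢g h≡g

      differ : ∀ {e} C D → _∈ᶜ_ ends e C → ¬ _∈ᶜ_ ends e D → Differ ends C D
      differ {e} C D e∈C e∉D same = e∉D (Equivalence.to (same e) e∈C)

      fork : (∀ C₁ C₂ C₃ → Differ ends C₁ C₂ → Differ ends C₁ C₃ → Differ ends C₂ C₃ → ⊥) →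
             ∀ {f g h} → f ≢ g → f ≢ h → g ≢ h → Out f → Out g → Out h → ⊥
      fork at-most-two {f} {g} {h} f≢g f≢h g≢h out-f out-g out-h =
        at-most-two (cyc fg) (cyc fh) (cyc gh)
          (differ (cyc fg) (cyc fh) (second≡ fg) (avoids fh (proj₁ out-g) (≢-sym f≢g) g≢h))
          (differ (cyc fg) (cyc gh) (CycleThrough.through fg) (avoids gh (proj₁ out-f) f≢g f≢h))
          (differ (cyc fh) (cyc gh) (CycleThrough.through fh) (avoids gh (proj₁ out-f) f≢g f≢h))
        where
        cyc : ∀ {e a S} → CycleThrough e a S → Cycle ends
        cyc = CycleThrough.cycle
        fg = cycle₂ f≢g out-f out-g
        fh = cycle₂ f≢h out-f out-h
        gh = cycle₂ g≢h out-g out-h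

    least : ∀ {P : ℕ → Set} → (∀ l → Dec (P l)) → ∀ l → P l → ∃[ m ] P m × (∀ j → j ℕ.< m → ¬ P j)
    least P? zero    p = 0 , p , λ j ()
    least P? (suc l) p with P? 0
    ... | yes p₀ = 0 , p₀ , λ j ()
    ... | no ¬p₀ with least (λ j → P? (suc j)) l p
    ...   | m , pm , below = suc m , pm , λ { zero _ → ¬p₀ ; (suc j) (s≤s j<m) → below j j<m }

    -- `breadth` speaks of every edge of S, not only of tree edges, and is what a breadth-first tree
    -- has beyond a general spanning tree.
    record Tree (S : E → Set) (root : V) : Set where
      field
        depth     : V → ℕ
        parent    : V → V
        up        : V → E
        up-S      : ∀ {w} → w ≢ root → S (up w)
        up-child  : ∀ {w} → w ≢ root → On ends w (up w)
        up-parent : ∀ {w} → w ≢ root → On ends (parent w) (up w)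
        depth-root : depth root ≡ 0
        depth-up  : ∀ {w} → w ≢ root → depth w ≡ suc (depth (parent w))
        breadth   : ∀ {e a b} → S e → On ends a e → On ends b e → depth a ℕ.≤ suc (depth b)

    module Search (S : E → Set) (S? : ∀ e → Dec (S e)) (e₀ : E) (root : V) (walks : ∀ w → Star (Joined ends S) w root) where

      Reach : ℕ → V → Set
      Reach zero    w = w ≡ root
      Reach (suc l) w = Reach l w ⊎ (∃[ e ] ∃[ z ] S e × On ends w e × On ends z e × Reach l z)

      reach? : ∀ l w → Dec (Reach l w)
      reach? zero    w = w ≟ᶠ root
      reach? (suc l) w = reach? l w ⊎-dec any? (λ e → any? (λ z → S? e ×-dec (On? w e ×-dec (On? z e ×-dec reach? l z))))

      reached : ∀ {w} → Star (Joined ends S) w root → ∃[ l ] Reach l w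
      reached ε = 0 , refl
      reached ((e , s , w∈e , z∈e) ◅ walk) = let l , r = reached walk in suc l , inj₂ (e , _ , s , w∈e , z∈e , r)

      distance : ∀ w → ∃[ l ] Reach l w × (∀ j → j ℕ.< l → ¬ Reach j w)
      distance w = let l , r = reached (walks w) in least (λ l → reach? l w) l r

      depth : V → ℕ
      depth w = proj₁ (distance w)

      depth≤ : ∀ {l w} → Reach l w → depth w ℕ.≤ l
      depth≤ {l} {w} r = ℕₚ.≮⇒≥ λ l<d → proj₂ (proj₂ (distance w)) l l<d r

      Upward : V → Set
      Upward w = ∃[ e ] ∃[ z ] S e × On ends w e × On ends z e × depth w ≡ suc (depth z)

      upward : ∀ w → w ≢ root → Upward w
      upward w w≢root = go (depth w) refl (proj₁ (proj₂ (distance w)))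
        where
        go : ∀ d → depth w ≡ d → Reach d w → Upward w
        go zero    _  w≡root   = ⊥-elim (w≢root w≡root)
        go (suc l) eq (inj₁ r) = ⊥-elim (ℕₚ.1+n≰n (subst (ℕ._≤ l) eq (depth≤ r)))
        go (suc l) eq (inj₂ (e , z , s , w∈e , z∈e , r)) = e , z , s , w∈e , z∈e ,
          ℕₚ.≤-antisym (depth≤ (inj₂ (e , z , s , w∈e , z∈e , proj₁ (proj₂ (distance z)))))
            (subst (suc (depth z) ℕ.≤_) (sym eq) (s≤s (depth≤ r)))

      choice : V → V × E
      choice w with w ≟ᶠ root
      -- A default value: `Tree` constrains `parent` and `up` only away from the root.
      ... | yes _     = root , e₀
      ... | no w≢root = let e , z , _ = upward w w≢root in z , e

      choice-upward : ∀ {w} → w ≢ root → S (proj₂ (choice w)) × On ends w (proj₂ (choice w)) ×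
                      On ends (proj₁ (choice w)) (proj₂ (choice w)) × depth w ≡ suc (depth (proj₁ (choice w)))
      choice-upward {w} w≢root with w ≟ᶠ root
      ... | yes w≡root = ⊥-elim (w≢root w≡root)
      ... | no w≢root′ = proj₂ (proj₂ (upward w w≢root′))

      tree : Tree S root
      tree = record
        { depth     = depth
        ; parent    = λ w → proj₁ (choice w)
        ; up        = λ w → proj₂ (choice w)
        ; up-S      = λ w≢root → proj₁ (choice-upward w≢root)
        ; up-child  = λ w≢root → proj₁ (proj₂ (choice-upward w≢root))
        ; up-parent = λ w≢root → proj₁ (proj₂ (proj₂ (choice-upward w≢root)))
        ; depth-root = ℕₚ.n≤0⇒n≡0 (depth≤ refl)
        ; depth-up  = λ w≢root → proj₂ (proj₂ (proj₂ (choice-upward w≢root)))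
        ; breadth   = λ {e} {a} {b} s a∈e b∈e → depth≤ (inj₂ (e , b , s , a∈e , b∈e , proj₁ (proj₂ (distance b))))
        }

    module InTree {S : E → Set} {root : V} (T : Tree S root) where
      open Tree T public

      IsUp : E → Set
      IsUp e = ∃[ w ] w ≢ root × up w ≡ e

      isUp? : ∀ e → Dec (IsUp e)
      isUp? e = any? (λ w → ¬? (w ≟ᶠ root) ×-dec (up w ≟ᶠ e))

      parent≢ : ∀ {w} → w ≢ root → w ≢ parent w
      parent≢ {w} w≢root eq = ℕₚ.1+n≢n (trans (sym (depth-up w≢root)) (cong depth eq))

      up-ends : ∀ {w x} → w ≢ root → On ends x (up w) → x ≡ w ⊎ x ≡ parent w
      up-ends w≢root = two-ends (parent≢ w≢root) (up-child w≢root) (up-parent w≢root)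

      -- The child is the strictly deeper end of its upward edge, so an end at least as deep as the
      -- other is the child. Upward edges thus determine their vertices.
      up-lower : ∀ {w x z} → w ≢ root → On ends x (up w) → On ends z (up w) → x ≢ z → depth z ℕ.≤ depth x → w ≡ x
      up-lower {w} {x} {z} w≢root x∈ z∈ x≢z dz≤dx with up-ends w≢root x∈ | up-ends w≢root z∈
      ... | inj₁ refl | _         = refl
      ... | inj₂ refl | inj₂ refl = ⊥-elim (x≢z refl)
      ... | inj₂ refl | inj₁ refl = ⊥-elim (ℕₚ.1+n≰n (subst (ℕ._≤ depth x) (depth-up w≢root) dz≤dx))

      up-injective : ∀ {w x} → w ≢ root → x ≢ root → up w ≡ up x → w ≡ x
      up-injective {w} {x} w≢root x≢root eq = up-lower w≢root (subst (On ends x) (sym eq) (up-child x≢root))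
        (subst (On ends (parent x)) (sym eq) (up-parent x≢root)) (parent≢ x≢root)
        (ℕₚ.≤-trans (ℕₚ.n≤1+n _) (ℕₚ.≤-reflexive (sym (depth-up x≢root))))

      -- The two edges of a cycle at its deepest vertex cannot both lead upwards.
      non-tree-edge : (D : Cycle ends) → ∃[ g ] _∈ᶜ_ ends g D × ¬ IsUp g
      non-tree-edge D = pick (isUp? e₁) (isUp? e₂)
        where
        open Cycle D
        deepest : ∀ {l} (f : Fin (suc l) → ℕ) → ∃[ i ] ∀ j → f j ℕ.≤ f i
        deepest {zero}  f = zero , λ { zero → ℕₚ.≤-refl }
        deepest {suc l} f with deepest (λ i → f (suc i))
        ... | i , max with ℕₚ.≤-total (f (suc i)) (f zero)
        ...   | inj₁ le = zero , λ { zero → ℕₚ.≤-refl ; (suc j) → ℕₚ.≤-trans (max j) le }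
        ...   | inj₂ le = suc i , λ { zero → le ; (suc j) → max j }
        i = proj₁ (deepest (λ i → depth (core i)))
        max = proj₂ (deepest (λ i → depth (core i)))
        x = core i
        e₁ = cycleEdge i
        e₂ = cycleEdge (prev i)
        x∈e₂ : On ends x e₂
        x∈e₂ = subst (λ j → On ends (core j) e₂) (next-prev i) (finish (prev i))
        x≢next : x ≢ core (next i)
        x≢next eq = next≢ i (sym (core-inj eq))
        prev≢ : prev i ≢ i
        prev≢ eq = next≢ i (trans (cong next (sym eq)) (next-prev i))
        x≢prev : x ≢ core (prev i)
        x≢prev eq = prev≢ (sym (core-inj eq))
        pick : Dec (IsUp e₁) → Dec (IsUp e₂) → ∃[ g ] _∈ᶜ_ ends g D × ¬ IsUp g
        pick (no ¬up) _ = e₁ , (i , refl) , ¬up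
        pick _ (no ¬up) = e₂ , (prev i , refl) , ¬up
        pick (yes (w , w≢root , up≡e₁)) (yes (v , v≢root , up≡e₂)) = ⊥-elim (prev≢ (edge-inj (trans (sym up≡e₂) (trans (cong up (trans v≡x (sym w≡x))) up≡e₁))))
          where
          w≡x : w ≡ x
          w≡x = up-lower w≢root (subst (On ends x) (sym up≡e₁) (start i)) (subst (On ends (core (next i))) (sym up≡e₁) (finish i)) x≢next (max (next i))
          v≡x : v ≡ x
          v≡x = up-lower v≢root (subst (On ends x) (sym up≡e₂) x∈e₂) (subst (On ends (core (prev i))) (sym up≡e₂) (start (prev i))) x≢prev (max (prev i))

    module Around (C : Cycle ends) (i : Fin (3 ℕ.+ Cycle.p C)) where
      open Cycle C

      Rest : V → V → Set
      Rest = Joined ends (_≢ cycleEdge i)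

      edge-step : ∀ {t j} → t ≢ i → next t ≡ j → Rest (core t) (core j)
      edge-step {t} t≢i refl = cycleEdge t , (λ eq → t≢i (edge-inj eq)) , start t , finish t

      ascend : ∀ t → toℕ t ℕ.≤ toℕ i → Star Rest (core zero) (core t)
      ascend = <-weakInduction (λ t → toℕ t ℕ.≤ toℕ i → Star Rest (core zero) (core t)) (λ _ → ε) λ t below t<i →
        below (subst (ℕ._≤ toℕ i) (sym (toℕ-inject₁ t)) (ℕₚ.<⇒≤ t<i))
        ◅◅ (edge-step (λ eq → ℕₚ.<-irrefl (trans (sym (toℕ-inject₁ t)) (cong toℕ eq)) t<i) (next-inject₁ t) ◅ ε)

      -- The walk passes through increasing indices and then from the last index to zero, hence the
      -- induction from the top.
      descend : ∀ t → toℕ i ℕ.< toℕ t → Star Rest (core t) (core zero)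
      descend = >-weakInduction (λ t → toℕ i ℕ.< toℕ t → Star Rest (core t) (core zero))
        (λ i<l → edge-step (λ eq → ℕₚ.<-irrefl (cong toℕ (sym eq)) i<l) (next-fromℕ (2 ℕ.+ p)) ◅ ε)
        λ t above i<t →
          let i<t′ = subst (toℕ i ℕ.<_) (toℕ-inject₁ t) i<t
          in edge-step (λ eq → ℕₚ.<-irrefl (cong toℕ (sym eq)) i<t) (next-inject₁ t) ◅ above (ℕₚ.m<n⇒m<1+n i<t′)

      after : ∀ (j : Fin (3 ℕ.+ p)) → next i ≡ j → Star Rest (core j) (core zero)
      after zero    eq = ε
      after (suc t) eq = descend (suc t) (s≤s (ℕₚ.≤-reflexive (trans (cong toℕ (trans (sym (prev-next i)) (cong prev eq))) (toℕ-inject₁ t))))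

      around : Star Rest (core (next i)) (core i)
      around = after (next i) refl ◅◅ ascend i ℕₚ.≤-refl

    -- An edge on a cycle is no bridge: each use of it is replaced by the rest of the cycle.
    delete-edge : ∀ (C : Cycle ends) {f} → _∈ᶜ_ ends f C → ∀ {u v} → Star (Joined ends (λ _ → ⊤)) u v → Star (Joined ends (_≢ f)) u v
    delete-edge C (i , refl) ε = ε
    delete-edge C {f} (i , refl) {u} (_◅_ {j = w} (e , _ , u∈e , w∈e) walk) = detour (e ≟ᶠ f) ◅◅ delete-edge C (i , refl) walk
      where
      open Cycle C
      core≢ : core i ≢ core (next i)
      core≢ eq = next≢ i (sym (core-inj eq))
      detour : Dec (e ≡ f) → Star (Joined ends (_≢ f)) u w
      detour (no e≢f)   = (e , e≢f , u∈e , w∈e) ◅ ε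
      detour (yes refl) with two-ends core≢ (start i) (finish i) u∈e | two-ends core≢ (start i) (finish i) w∈e
      ... | inj₁ refl | inj₁ refl = ε
      ... | inj₁ refl | inj₂ refl = reverse (joined-sym ends) (Around.around C i)
      ... | inj₂ refl | inj₁ refl = Around.around C i
      ... | inj₂ refl | inj₂ refl = ε

    All : E → Set
    All _ = ⊤

    -- A spanning tree of the graph without an edge f of C that is not on D has n − 1 edges,
    -- and it misses both f and an edge of D.
    edge-count : V → (∀ u v → Star (Joined ends All) u v) → ∀ C D → Differ ends C D → suc n ℕ.≤ k
    edge-count root connected C D differ = by-cases (any? (λ e → (_∈ᶜ?_ ends e C) ×-dec ¬? (_∈ᶜ?_ ends e D)))
                                                    (any? (λ e → (_∈ᶜ?_ ends e D) ×-dec ¬? (_∈ᶜ?_ ends e C)))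
      where
      count : ∀ C D {f} → _∈ᶜ_ ends f C → ¬ _∈ᶜ_ ends f D → suc n ℕ.≤ k
      count C D {f} f∈C f∉D = injective⇒≤ {f = assign} (λ {x} {y} → assign-injective x y)
        where
        T : Tree (_≢ f) root
        T = Search.tree (_≢ f) (λ e → ¬? (e ≟ᶠ f)) f root (λ w → delete-edge C f∈C (connected w root))
        open InTree T
        g = proj₁ (non-tree-edge D)
        g∈D = proj₁ (proj₂ (non-tree-edge D))
        ¬up-g = proj₂ (proj₂ (non-tree-edge D))
        g≢f : g ≢ f
        g≢f eq = f∉D (subst (λ e → _∈ᶜ_ ends e D) eq g∈D)
        assign′ : ∀ w → Dec (w ≡ root) → E
        -- The root has no upward edge, so its place is free for g; with the additional value f this
        -- makes n + 1 different edges.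
        assign′ w (yes _) = g
        assign′ w (no _)  = up w
        assign : Fin (suc n) → E
        assign zero    = f
        assign (suc w) = assign′ w (w ≟ᶠ root)
        f≢ : ∀ w d → f ≢ assign′ w d
        f≢ w (yes _)     eq = g≢f (sym eq)
        f≢ w (no w≢root) eq = up-S w≢root (sym eq)
        both : ∀ w x d d′ → assign′ w d ≡ assign′ x d′ → w ≡ x
        both w x (yes refl)   (yes refl)   eq = refl
        both w x (yes _)      (no x≢root)  eq = ⊥-elim (¬up-g (x , x≢root , sym eq))
        both w x (no w≢root)  (yes _)      eq = ⊥-elim (¬up-g (w , w≢root , eq))
        both w x (no w≢root)  (no x≢root)  eq = up-injective w≢root x≢root eq
        assign-injective : ∀ x y → assign x ≡ assign y → x ≡ y
        assign-injective zero    zero    eq = refl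
        assign-injective zero    (suc y) eq = ⊥-elim (f≢ y (y ≟ᶠ root) eq)
        assign-injective (suc x) zero    eq = ⊥-elim (f≢ x (x ≟ᶠ root) (sym eq))
        assign-injective (suc x) (suc y) eq = cong suc (both x y (x ≟ᶠ root) (y ≟ᶠ root) eq)
      by-cases : Dec (∃[ e ] _∈ᶜ_ ends e C × ¬ _∈ᶜ_ ends e D) → Dec (∃[ e ] _∈ᶜ_ ends e D × ¬ _∈ᶜ_ ends e C) → suc n ℕ.≤ k
      by-cases (yes (f , f∈C , f∉D)) _ = count C D f∈C f∉D
      by-cases _ (yes (f , f∈D , f∉C)) = count D C f∈D f∉C
      by-cases (no none) (no none′) = ⊥-elim (differ λ e → mk⇔
        (λ e∈C → decidable-stable (_∈ᶜ?_ ends e D) (λ e∉D → none (e , e∈C , e∉D)))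
        (λ e∈D → decidable-stable (_∈ᶜ?_ ends e C) (λ e∉C → none′ (e , e∈D , e∉C))))

    AtMostTwo : Set
    AtMostTwo = ∀ C₁ C₂ C₃ → Differ ends C₁ C₂ → Differ ends C₁ C₃ → Differ ends C₂ C₃ → ⊥

    record Chords {root : V} (T : Tree All root) : Set where
      open InTree T
      field
        e₁ e₂  : E
        e₁≢e₂  : e₁ ≢ e₂
        chord₁ : ¬ IsUp e₁
        chord₂ : ¬ IsUp e₂
        cover  : ∀ e → IsUp e ⊎ (e ≡ e₁ ⊎ e ≡ e₂)

    module _ {root : V} (T : Tree All root) where
      open InTree T

      root-path : ∀ d v → depth v ≡ d → Star (Joined ends IsUp) v root
      root-path zero v eq with v ≟ᶠ root
      ... | yes refl  = ε
      ... | no v≢root with () ← trans (sym eq) (depth-up v≢root)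
      root-path (suc d) v eq with v ≟ᶠ root
      ... | yes refl  = ε
      ... | no v≢root = (up v , (v , v≢root , refl) , up-child v≢root , up-parent v≢root)
                        ◅ root-path d (parent v) (ℕₚ.suc-injective (trans (sym (depth-up v≢root)) eq))

      fundamental : ∀ {e} → ¬ IsUp e → CycleThrough e (proj₁ (ends e)) IsUp
      fundamental {e} chord = close (proper e) (inj₁ refl) (inj₂ refl) chord
        (root-path _ _ refl ◅◅ reverse (joined-sym ends) (root-path _ _ refl))

      fundamental-avoids : ∀ {e f} (chord : ¬ IsUp e) → ¬ IsUp f → f ≢ e → ¬ _∈ᶜ_ ends f (CycleThrough.cycle (fundamental chord))
      fundamental-avoids chord ¬up f≢e f∈C = [ f≢e , ¬up ]′ (CycleThrough.within (fundamental chord) f∈C)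

      -- A fundamental cycle contains its own chord and no other, so three chords would give three
      -- different cycles.
      three-chords : AtMostTwo → ∀ {e f g} → ¬ IsUp e → ¬ IsUp f → ¬ IsUp g → e ≢ f → e ≢ g → f ≢ g → ⊥
      three-chords at-most-two {e} {f} {g} ce cf cg e≢f e≢g f≢g = at-most-two (cyc ce) (cyc cf) (cyc cg)
        (λ same → fundamental-avoids cf ce e≢f (Equivalence.to (same e) (CycleThrough.through (fundamental ce))))
        (λ same → fundamental-avoids cg ce e≢g (Equivalence.to (same e) (CycleThrough.through (fundamental ce))))
        (λ same → fundamental-avoids cg cf f≢g (Equivalence.to (same f) (CycleThrough.through (fundamental cf))))
        where
        cyc : ∀ {e} → ¬ IsUp e → Cycle ends
        cyc chord = CycleThrough.cycle (fundamental chord)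

      chords : AtMostTwo → suc n ℕ.≤ k → Chords T
      chords at-most-two n<k = record
        { e₁ = e₁ ; e₂ = e₂ ; e₁≢e₂ = e₁≢e₂ ; chord₁ = chord₁ ; chord₂ = chord₂
        ; cover = λ e → cover e (isUp? e) (e ≟ᶠ e₁) (e ≟ᶠ e₂) }
        where
        owner-injective : ∀ {x y w v} → up w ≡ x → up v ≡ y → w ≡ v → x ≡ y
        owner-injective refl refl refl = refl
        first : ∃[ e ] ¬ IsUp e
        first = decidable-stable (any? (λ e → ¬? (isUp? e))) λ none →
          let owner : ∀ e → IsUp e
              owner e = decidable-stable (isUp? e) (λ ¬up → none (e , ¬up))
          in ℕₚ.<⇒≱ n<k (injective⇒≤ {f = λ e → proj₁ (owner e)} (owner-injective (proj₂ (proj₂ (owner _))) (proj₂ (proj₂ (owner _)))))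
        e₁ = proj₁ first
        chord₁ = proj₂ first
        -- Counting as in `first`, with e₁ assigned to the root: the root owns no upward edge, so
        -- the assignment of edges to vertices remains injective.
        second : ∃[ e ] e₁ ≢ e × ¬ IsUp e
        second = decidable-stable (any? (λ e → ¬? (e₁ ≟ᶠ e) ×-dec ¬? (isUp? e))) λ none →
          let owner : ∀ e → e₁ ≢ e → IsUp e
              owner e e₁≢e = decidable-stable (isUp? e) (λ ¬up → none (e , e₁≢e , ¬up))
              pick : ∀ e → Dec (e₁ ≡ e) → V
              pick = λ { e (yes _) → root ; e (no e₁≢e) → proj₁ (owner e e₁≢e) }
              pick-injective : ∀ x y d d′ → pick x d ≡ pick y d′ → x ≡ y
              pick-injective = λ
                { x y (yes p) (yes q) _  → trans (sym p) q
                ; x y (yes _) (no q)  eq → ⊥-elim (proj₁ (proj₂ (owner y q)) (sym eq))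
                ; x y (no p)  (yes _) eq → ⊥-elim (proj₁ (proj₂ (owner x p)) eq)
                ; x y (no p)  (no q)  eq → owner-injective (proj₂ (proj₂ (owner x p))) (proj₂ (proj₂ (owner y q))) eq }
          in ℕₚ.<⇒≱ n<k (injective⇒≤ {f = λ e → pick e (e₁ ≟ᶠ e)} (λ {x} {y} → pick-injective x y (e₁ ≟ᶠ x) (e₁ ≟ᶠ y)))
        e₂ = proj₁ second
        e₁≢e₂ = proj₁ (proj₂ second)
        chord₂ = proj₂ (proj₂ second)
        cover : ∀ e → Dec (IsUp e) → Dec (e ≡ e₁) → Dec (e ≡ e₂) → IsUp e ⊎ (e ≡ e₁ ⊎ e ≡ e₂)
        cover e (yes up) _         _         = inj₁ up
        cover e (no _)   (yes e≡e₁) _        = inj₂ (inj₁ e≡e₁)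
        cover e (no _)   (no _)   (yes e≡e₂) = inj₂ (inj₂ e≡e₂)
        cover e (no ¬up) (no e≢e₁) (no e≢e₂) = ⊥-elim (three-chords at-most-two chord₁ chord₂ ¬up e₁≢e₂ (≢-sym e≢e₁) (≢-sym e≢e₂))

      chord-parent : ∀ {e x z} → ¬ IsUp e → On ends x e → On ends z e → x ≢ z → z ≢ root → parent z ≢ x
      chord-parent {e} {x} {z} chord x∈e z∈e x≢z z≢root refl =
        chord (z , z≢root , single x≢z (up-parent z≢root) (up-child z≢root) x∈e z∈e)

      -- A neighbour of the root has depth at most 1 and hence the root as its parent; by simplicity
      -- the edge between them is its upward edge.
      chord-root : ∀ {e} → ¬ IsUp e → ¬ On ends root e
      chord-root {e} chord root∈e =
        let a , a≢root , a∈e = other-end root∈e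
        in chord-parent chord root∈e a∈e (≢-sym a≢root) a≢root (parent-root a≢root (breadth tt a∈e root∈e))
        where
        parent-root : ∀ {a} → a ≢ root → depth a ℕ.≤ suc (depth root) → parent a ≡ root
        parent-root {a} a≢root le with parent a ≟ᶠ root
        ... | yes p≡root = p≡root
        ... | no p≢root  = ⊥-elim (ℕₚ.1+n≰n (ℕₚ.≤-trans (ℕ.s≤s (ℕ.s≤s ℕ.z≤n))
          (subst₂ ℕ._≤_ (trans (depth-up a≢root) (cong suc (depth-up p≢root))) (cong suc depth-root) le)))

      -- The tree path from z only becomes shallower, so after z itself it stays strictly above the
      -- depth of x. The number d is the recursion measure.
      avoiding : ∀ x d z → depth z ≡ d → z ≢ x → depth z ℕ.≤ depth x → Star (Joined ends (λ e → ¬ On ends x e)) z root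
      avoiding x d z eq z≢x le with z ≟ᶠ root
      ... | yes refl = ε
      avoiding x zero z eq z≢x le | no z≢root with () ← trans (sym eq) (depth-up z≢root)
      avoiding x (suc d) z eq z≢x le | no z≢root =
        (up z , away , up-child z≢root , up-parent z≢root)
        ◅ avoiding x d (parent z) (ℕₚ.suc-injective (trans (sym (depth-up z≢root)) eq)) parent≢x (ℕₚ.<⇒≤ parent<)
        where
        parent< : depth (parent z) ℕ.< depth x
        parent< = subst (ℕ._≤ depth x) (depth-up z≢root) le
        parent≢x : parent z ≢ x
        parent≢x eq = ℕₚ.<-irrefl (cong depth eq) parent<
        away : ¬ On ends x (up z)
        away x∈ = [ (λ x≡z → z≢x (sym x≡z)) , (λ x≡p → parent≢x (sym x≡p)) ]′ (up-ends z≢root x∈)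

      -- Admits z one level below x, which is all that `breadth` gives for the other end of an edge
      -- at x, provided that the tree path does not step to x at once.
      avoiding′ : ∀ {x z} → z ≢ x → (z ≢ root → parent z ≢ x) → depth z ℕ.≤ suc (depth x) → Star (Joined ends (λ e → ¬ On ends x e)) z root
      avoiding′ {x} {z} z≢x p≢x le with z ≟ᶠ root
      ... | yes refl  = ε
      ... | no z≢root = (up z , away , up-child z≢root , up-parent z≢root)
        ◅ avoiding x _ (parent z) refl (p≢x z≢root) (ℕₚ.≤-pred (subst (ℕ._≤ suc (depth x)) (depth-up z≢root) le))
        where
        away : ¬ On ends x (up z)
        away x∈ = [ (λ x≡z → z≢x (sym x≡z)) , (λ x≡p → p≢x z≢root (sym x≡p)) ]′ (up-ends z≢root x∈)

      module _ (at-most-two : AtMostTwo) where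

        chord-out : ∀ {x e} → ¬ IsUp e → On ends x e → Fork.Out x root e
        chord-out {x} {e} chord x∈e =
          let z , z≢x , z∈e = other-end x∈e
          in x∈e , z , z≢x , z∈e , avoiding′ z≢x (chord-parent chord x∈e z∈e (≢-sym z≢x)) (breadth tt z∈e x∈e)

        up-out : ∀ {x} → x ≢ root → Fork.Out x root (up x)
        up-out {x} x≢root = up-child x≢root , parent x , (λ eq → parent≢ x≢root (sym eq)) , up-parent x≢root ,
          avoiding x _ (parent x) refl (λ eq → parent≢ x≢root (sym eq))
            (ℕₚ.≤-trans (ℕₚ.n≤1+n _) (ℕₚ.≤-reflexive (sym (depth-up x≢root))))

        -- At a common end x the two chords and the upward edge of x would be three edges from which
        -- the root can be reached without returning to x.
        chords-disjoint : ∀ {e f x} → ¬ IsUp e → ¬ IsUp f → e ≢ f → On ends x e → On ends x f → ⊥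
        chords-disjoint {e} {f} {x} ce cf e≢f x∈e x∈f = Fork.fork x root at-most-two e≢f
          (λ eq → ce (x , x≢root , sym eq)) (λ eq → cf (x , x≢root , sym eq))
          (chord-out ce x∈e) (chord-out cf x∈f) (up-out x≢root)
          where
          x≢root : x ≢ root
          x≢root refl = chord-root ce x∈e

        -- Otherwise the parent of w would lie on three cycles: via e to b and the root, via f, and via its own parent.
        chords-apart : ∀ {e f w b} → ¬ IsUp e → ¬ IsUp f → e ≢ f → w ≢ root → parent w ≢ root → w ≢ b →
                       On ends w e → On ends b e → On ends (parent w) f → parent b ≢ root
        chords-apart {e} {f} {w} {b} ce cf e≢f w≢root p≢root w≢b w∈e b∈e p∈f parent-b =
          Fork.fork p root at-most-two
            (λ eq → p≢w (up-injective p≢root w≢root eq)) (λ eq → cf (p , p≢root , eq)) (λ eq → cf (w , w≢root , eq))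
            (up-out p≢root) (up-parent w≢root , w , (λ eq → p≢w (sym eq)) , up-child w≢root , walk) (chord-out cf p∈f)
          where
          p = parent w
          p≢w : p ≢ w
          p≢w eq = parent≢ w≢root (sym eq)
          p∉e : ¬ On ends p e
          p∉e p∈e = chords-disjoint ce cf e≢f p∈e p∈f
          p≢b : p ≢ b
          p≢b refl = p∉e b∈e
          b≢root : b ≢ root
          b≢root refl = chord-root ce b∈e
          walk : Star (Joined ends (λ e → ¬ On ends p e)) w root
          walk = (e , p∉e , w∈e , b∈e) ◅
                 (up b , (λ p∈ → [ p≢b , (λ p≡ → p≢root (trans p≡ parent-b)) ]′ (up-ends b≢root p∈)) , up-child b≢root ,
                  subst (λ v → On ends v (up b)) parent-b (up-parent b≢root)) ◅ ε

      module Numbering (Ch : Chords T) where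
        open Chords Ch

        -- Every vertex numbers its upward edge. The root has none, which leaves its number for one
        -- chord, and the additional number zero for the other.
        number′ : ∀ w → Dec (w ≡ root) → E
        number′ w (yes _) = e₁
        number′ w (no _)  = up w

        number : Fin (suc n) → E
        number zero    = e₂
        number (suc w) = number′ w (w ≟ᶠ root)

        number-up : ∀ {w} → w ≢ root → number (suc w) ≡ up w
        number-up {w} w≢root with w ≟ᶠ root
        ... | yes w≡root = ⊥-elim (w≢root w≡root)
        ... | no _       = refl

        number-root : number (suc root) ≡ e₁
        number-root with root ≟ᶠ root
        ... | yes _   = refl
        ... | no r≢r = ⊥-elim (r≢r refl)

        number-injective : ∀ x y → number x ≡ number y → x ≡ y
        number-injective zero    zero    eq = refl
        number-injective zero    (suc y) eq = ⊥-elim (e₂≢ y (y ≟ᶠ root) eq)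
          where
          e₂≢ : ∀ w d → e₂ ≢ number′ w d
          e₂≢ w (yes _)     eq = e₁≢e₂ (sym eq)
          e₂≢ w (no w≢root) eq = chord₂ (w , w≢root , sym eq)
        number-injective (suc x) zero    eq = sym (number-injective zero (suc x) (sym eq))
        number-injective (suc x) (suc y) eq = cong suc (both x y (x ≟ᶠ root) (y ≟ᶠ root) eq)
          where
          both : ∀ w x d d′ → number′ w d ≡ number′ x d′ → w ≡ x
          both w x (yes refl)  (yes refl)  eq = refl
          both w x (yes _)     (no x≢root) eq = ⊥-elim (chord₁ (x , x≢root , sym eq))
          both w x (no w≢root) (yes _)     eq = ⊥-elim (chord₁ (w , w≢root , eq))
          both w x (no w≢root) (no x≢root) eq = up-injective w≢root x≢root eq

        unnumber : ∀ e → ∃[ i ] number i ≡ e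
        unnumber e with cover e
        ... | inj₁ (w , w≢root , eq) = suc w , trans (number-up w≢root) eq
        ... | inj₂ (inj₁ refl)       = suc root , number-root
        ... | inj₂ (inj₂ refl)       = zero , refl

        numbering : Fin (suc n) ↔ E
        numbering = mk↔ₛ′ number (λ e → proj₁ (unnumber e)) (λ e → proj₂ (unnumber e))
          (λ i → number-injective _ i (proj₂ (unnumber (number i))))

-- Loose cycles of a power hypergraph and cycles of its graph

module LooseCycles where

  open GraphModels using (Model; Vertex; On; Incident; Simple; to-injective)
  open GraphCycles
  open import Defs using (Hypergraph; order; size; edge; IsLooseCycle; Bicyclic; Connected; next)
  open import Data.Fin.Subset using (Subset; _∈_; _∩_; ⁅_⁆; inside)
  open import Data.Fin.Subset.Properties using (x∈⁅x⁆; x∈⁅y⁆⇒x≡y; x∈p∩q⁻; x∈p∩q⁺; ⊆-antisym)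
  open import Data.Unit.Base using (tt)
  open import Data.Vec.Base using (tabulate)
  open import Data.Vec.Properties using (lookup∘tabulate; []=⇒lookup; lookup⇒[]=)
  open import Relation.Binary.Construct.Closure.ReflexiveTransitive using (Star; gmap)

  select : ∀ {k} {P : Fin k → Set} → (∀ e → Dec (P e)) → Subset k
  select P? = tabulate (λ e → does (P? e))

  ∈-select : ∀ {k} {P : Fin k → Set} (P? : ∀ e → Dec (P e)) e → e ∈ select P? ⇔ P e
  ∈-select {P = P} P? e = mk⇔
    (λ h → witness (P? e) (trans (sym (lookup∘tabulate (λ e → does (P? e)) e)) ([]=⇒lookup h)))
    (λ p → lookup⇒[]= e (select P?) (trans (lookup∘tabulate (λ e → does (P? e)) e) (dec-true (P? e) p)))
    where
    witness : (d : Dec (P e)) → does d ≡ inside → P e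
    witness (yes p) _ = p

  module _ {X : Hypergraph} {n k r : ℕ} {ends : Fin k → Fin n × Fin n} (M : Model X r ends) (simple : Simple ends) where
    open Model M renaming (edges to E↔)
    open Combinatorics simple using (two-ends; AtMostTwo; All)

    toV : Fin (order X) → Vertex r
    toV = Inverse.to vertices

    toE : Fin (size X) → Fin k
    toE = Inverse.to E↔

    fromE : Fin k → Fin (size X)
    fromE = Inverse.from E↔

    fromV : Fin n → Fin (order X)
    fromV v = Inverse.from vertices (inj₁ v)

    member : ∀ {v e} → v ∈ edge X e → Incident ends (toV v) (toE e)
    member = Equivalence.to (incidence _ _)

    on-member : ∀ {v e} → On ends v e ⇔ fromV v ∈ edge X (fromE e)
    on-member {v} {e} = subst₂ (λ u f → Incident ends u f ⇔ fromV v ∈ edge X (fromE e))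
      (Inverse.strictlyInverseˡ vertices (inj₁ v)) (Inverse.strictlyInverseˡ E↔ e) (⇔-sym (incidence (fromV v) (fromE e)))

    -- A vertex added to an edge lies in no other edge.
    shared-core : ∀ {v e f} → e ≢ f → v ∈ edge X e → v ∈ edge X f → ∃[ c ] toV v ≡ inj₁ c
    shared-core {v} {e} {f} e≢f v∈e v∈f = go (toV v) refl (member v∈e) (member v∈f)
      where
      go : ∀ u → toV v ≡ u → Incident {r = r} ends u (toE e) → Incident ends u (toE f) → ∃[ c ] toV v ≡ inj₁ c
      go (inj₁ c) eq _ _ = c , eq
      go (inj₂ (g , _)) _ g≡e g≡f = ⊥-elim (e≢f (to-injective E↔ (trans (sym g≡e) g≡f)))

    core-member : ∀ {v c e} → toV v ≡ inj₁ c → v ∈ edge X e → On ends c (toE e)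
    core-member {e = e} eq v∈e = subst (λ u → Incident {r = r} ends u (toE e)) eq (member v∈e)

    module FromLoose {C : Subset (size X)} (L : IsLooseCycle X C) where
      open IsLooseCycle L

      both : ∀ i → core i ∈ (edge X (cycleEdge (prev i)) ∩ edge X (cycleEdge i))
      both i = subst (λ j → core j ∈ (edge X (cycleEdge (prev i)) ∩ edge X (cycleEdge j))) (next-prev i)
        (subst (core (next (prev i)) ∈_) (sym (consecutive (prev i))) (x∈⁅x⁆ (core (next (prev i)))))

      in-prev : ∀ i → core i ∈ edge X (cycleEdge (prev i))
      in-prev i = proj₁ (x∈p∩q⁻ (edge X (cycleEdge (prev i))) _ (both i))

      in-self : ∀ i → core i ∈ edge X (cycleEdge i)
      in-self i = proj₂ (x∈p∩q⁻ (edge X (cycleEdge (prev i))) _ (both i))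

      core-at : ∀ i → ∃[ c ] toV (core i) ≡ inj₁ c
      core-at i = shared-core (λ eq → next≢ (prev i) (trans (next-prev i) (sym (edge-inj eq)))) (in-prev i) (in-self i)

      to-cycle : Cycle ends
      to-cycle = record
        { p = p
        ; core = λ i → proj₁ (core-at i)
        ; cycleEdge = λ i → toE (cycleEdge i)
        ; core-inj = λ {i} {j} eq → core-inj (to-injective vertices (trans (proj₂ (core-at i)) (trans (cong inj₁ eq) (sym (proj₂ (core-at j))))))
        ; edge-inj = λ eq → edge-inj (to-injective E↔ eq)
        ; start = λ i → core-member (proj₂ (core-at i)) (in-self i)
        ; finish = λ i → core-member (proj₂ (core-at (next i)))
            (subst (λ j → core (next i) ∈ edge X (cycleEdge j)) (prev-next i) (in-prev (next i)))
        }

      to-cycle-edges : ∀ e → e ∈ C ⇔ _∈ᶜ_ ends (toE e) to-cycle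
      to-cycle-edges e = mk⇔
        (λ e∈C → let i , eq = Equivalence.to (edges e) e∈C in i , cong toE eq)
        (λ { (i , eq) → Equivalence.from (edges e) (i , to-injective E↔ eq) })

    module ToLoose (D : Cycle ends) where
      open Cycle D

      edge-set : Subset (size X)
      edge-set = select (λ e → _∈ᶜ?_ ends (toE e) D)

      ∈-edge-set : ∀ e → e ∈ edge-set ⇔ _∈ᶜ_ ends (toE e) D
      ∈-edge-set = ∈-select (λ e → _∈ᶜ?_ ends (toE e) D)

      on : ∀ {v c e} → toV v ≡ inj₁ c → v ∈ edge X (fromE e) → On ends c e
      on {e = e} eq v∈e = subst (On ends _) (Inverse.strictlyInverseˡ E↔ e) (core-member eq v∈e)

      fromE-injective : ∀ {e f} → fromE e ≡ fromE f → e ≡ f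
      fromE-injective = to-injective (↔-sym E↔)

      core≢ : ∀ i → core i ≢ core (next i)
      core≢ i eq = next≢ i (sym (core-inj eq))

      at-next : ∀ i → On ends (core (next i)) (cycleEdge i) × On ends (core (next i)) (cycleEdge (next i))
      at-next i = finish i , start (next i)

      distinct : ∀ i → cycleEdge i ≢ cycleEdge (next i)
      distinct i eq = next≢ i (sym (edge-inj eq))

      to-fromV : ∀ {v c} → toV v ≡ inj₁ c → v ≡ fromV c
      to-fromV {v} eq = trans (sym (Inverse.strictlyInverseʳ vertices v)) (cong (Inverse.from vertices) eq)

      -- A second common vertex would be another common end of two different edges of a simple
      -- graph.
      meet : ∀ i {v} → v ∈ (edge X (fromE (cycleEdge i)) ∩ edge X (fromE (cycleEdge (next i)))) → v ≡ fromV (core (next i))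
      meet i {v} v∈ with x∈p∩q⁻ (edge X (fromE (cycleEdge i))) _ v∈
      ... | v∈e , v∈f with shared-core (λ eq → distinct i (fromE-injective eq)) v∈e v∈f
      ...   | c , eq with c ≟ᶠ core (next i)
      ...     | yes refl = to-fromV eq
      ...     | no c≢    = ⊥-elim (distinct i (Simple.single simple c≢ (on eq v∈e) (proj₁ (at-next i)) (on eq v∈f) (proj₂ (at-next i))))

      is-loose : IsLooseCycle X edge-set
      is-loose = record
        { p = p
        ; core = λ i → fromV (core i)
        ; cycleEdge = λ i → fromE (cycleEdge i)
        ; edges = λ e → mk⇔
            (λ e∈ → let i , eq = Equivalence.to (∈-edge-set e) e∈ in i , trans (cong fromE eq) (Inverse.strictlyInverseʳ E↔ e))
            (λ { (i , eq) → Equivalence.from (∈-edge-set e) (i , trans (sym (Inverse.strictlyInverseˡ E↔ (cycleEdge i))) (cong toE eq)) })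
        ; core-inj = λ eq → core-inj (from-core eq)
        ; edge-inj = λ eq → edge-inj (fromE-injective eq)
        ; consecutive = λ i → ⊆-antisym
            (λ v∈ → subst (λ w → w ∈ ⁅ fromV (core (next i)) ⁆) (sym (meet i v∈)) (x∈⁅x⁆ (fromV (core (next i)))))
            (λ v∈ → subst (_∈ (edge X (fromE (cycleEdge i)) ∩ edge X (fromE (cycleEdge (next i))))) (sym (x∈⁅y⁆⇒x≡y _ v∈))
              (x∈p∩q⁺ (Equivalence.to on-member (proj₁ (at-next i)) , Equivalence.to on-member (proj₂ (at-next i)))))
        ; disjoint = λ { i j i≢j j≢next i≢next (v , v∈) → apart i j i≢j j≢next i≢next (x∈p∩q⁻ (edge X (fromE (cycleEdge i))) _ v∈) }
        }
        where
        from-core : ∀ {u v} → fromV u ≡ fromV v → u ≡ v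
        from-core eq with to-injective (↔-sym vertices) eq
        ... | refl = refl
        apart : ∀ i j → i ≢ j → j ≢ next i → i ≢ next j → ∀ {v} → v ∈ edge X (fromE (cycleEdge i)) × v ∈ edge X (fromE (cycleEdge j)) → ⊥
        apart i j i≢j j≢next i≢next (v∈e , v∈f) with shared-core (λ eq → i≢j (edge-inj (fromE-injective eq))) v∈e v∈f
        ... | c , eq with two-ends (core≢ i) (start i) (finish i) (on eq v∈e) | two-ends (core≢ j) (start j) (finish j) (on eq v∈f)
        ...   | inj₁ p | inj₁ q = i≢j (core-inj (trans (sym p) q))
        ...   | inj₁ p | inj₂ q = i≢next (core-inj (trans (sym p) q))
        ...   | inj₂ p | inj₁ q = j≢next (core-inj (trans (sym q) p))
        ...   | inj₂ p | inj₂ q = i≢j (next-injective (core-inj (trans (sym p) q)))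

    at-most-two : Bicyclic X → AtMostTwo
    at-most-two (C , D , _ , _ , _ , only) C₁ C₂ C₃ d₁₂ d₁₃ d₂₃ = pigeon (class C₁) (class C₂) (class C₃)
      where
      class : ∀ C′ → ToLoose.edge-set C′ ≡ C ⊎ ToLoose.edge-set C′ ≡ D
      class C′ = only _ (ToLoose.is-loose C′)
      same : ∀ C′ D′ {F} → ToLoose.edge-set C′ ≡ F → ToLoose.edge-set D′ ≡ F → ¬ Differ ends C′ D′
      same C′ D′ p q differ = differ λ e → subst (λ f → _∈ᶜ_ ends f C′ ⇔ _∈ᶜ_ ends f D′) (Inverse.strictlyInverseˡ E↔ e)
        (ToLoose.∈-edge-set D′ (fromE e) ⇔-∘ (mk⇔ (subst (fromE e ∈_) (trans p (sym q))) (subst (fromE e ∈_) (trans q (sym p))) ⇔-∘ ⇔-sym (ToLoose.∈-edge-set C′ (fromE e))))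
      pigeon : _ → _ → _ → ⊥
      pigeon (inj₁ p) (inj₁ q) _        = same C₁ C₂ p q d₁₂
      pigeon (inj₂ p) (inj₂ q) _        = same C₁ C₂ p q d₁₂
      pigeon (inj₁ p) (inj₂ q) (inj₁ r) = same C₁ C₃ p r d₁₃
      pigeon (inj₁ p) (inj₂ q) (inj₂ r) = same C₂ C₃ q r d₂₃
      pigeon (inj₂ p) (inj₁ q) (inj₁ r) = same C₂ C₃ q r d₂₃
      pigeon (inj₂ p) (inj₁ q) (inj₂ r) = same C₁ C₃ p r d₁₃

    two-cycles : Bicyclic X → ∃[ C ] ∃[ D ] Differ ends C D
    two-cycles (C , D , C≢D , loose-C , loose-D , _) = FromLoose.to-cycle loose-C , FromLoose.to-cycle loose-D , λ same →
      let agree : ∀ e → e ∈ C ⇔ e ∈ D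
          agree e = ⇔-sym (FromLoose.to-cycle-edges loose-D e) ⇔-∘ (same (toE e) ⇔-∘ FromLoose.to-cycle-edges loose-C e)
      in C≢D (⊆-antisym (λ {e} → Equivalence.to (agree e)) (λ {e} → Equivalence.from (agree e)))

    connected : Connected X → ∀ u v → Star (Joined ends All) u v
    connected conn u v = subst₂ (Star (Joined ends All)) (rep-core u) (rep-core v)
      (gmap (λ x → rep (toV x)) (λ { (e , x∈e , y∈e) → toE e , tt , rep-on (toV _) (member x∈e) , rep-on (toV _) (member y∈e) }) (conn (fromV u) (fromV v)))
      where
      -- An added vertex is represented by an end of its edge, so that a step inside a hyperedge
      -- becomes a step along the graph edge.
      rep : Vertex r → Fin n
      rep (inj₁ c)       = c
      rep (inj₂ (e , _)) = proj₁ (ends e)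
      rep-core : ∀ c → rep (toV (fromV c)) ≡ c
      rep-core c = cong rep (Inverse.strictlyInverseˡ vertices (inj₁ c))
      rep-on : ∀ u {e} → Incident {r = r} ends u e → On ends (rep u) e
      rep-on (inj₁ c)       c∈e  = c∈e
      rep-on (inj₂ (e , _)) refl = inj₁ refl

-- Copies of B₂C on a given vertex set with given edge labels

module TargetCopies where

  open GraphModels using (Model; On; Simple)
  open Labellings
  open import Defs using (Hypergraph; B₂C)
  open import Data.Maybe.Base using (just)
  open import Data.Vec.Base using ([]; _∷_; lookup)
  open import Data.Vec.Relation.Unary.Unique.Propositional using (Unique)
  open import Data.Vec.Relation.Unary.Unique.Propositional.Properties using (lookup-injective)

  swap-at : ∀ {n} (a b x : Fin n) → Dec (x ≡ a) → Dec (x ≡ b) → Fin n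
  swap-at a b x (yes _) _       = b
  swap-at a b x (no _)  (yes _) = a
  swap-at a b x (no _)  (no _)  = x

  swap : ∀ {n} → Fin n → Fin n → Fin n → Fin n
  swap a b x = swap-at a b x (x ≟ᶠ a) (x ≟ᶠ b)

  swap-left : ∀ {n} (a b : Fin n) → swap a b a ≡ b
  swap-left a b with a ≟ᶠ a
  ... | yes _  = refl
  ... | no a≢a = ⊥-elim (a≢a refl)

  swap-right : ∀ {n} (a b : Fin n) → swap a b b ≡ a
  swap-right a b with b ≟ᶠ a | b ≟ᶠ b
  ... | yes b≡a | _      = b≡a
  ... | no _    | yes _  = refl
  ... | no _    | no b≢b = ⊥-elim (b≢b refl)

  swap-other : ∀ {n} {a b x : Fin n} → x ≢ a → x ≢ b → swap a b x ≡ x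
  swap-other {a = a} {b} {x} x≢a x≢b with x ≟ᶠ a | x ≟ᶠ b
  ... | yes x≡a | _       = ⊥-elim (x≢a x≡a)
  ... | no _    | yes x≡b = ⊥-elim (x≢b x≡b)
  ... | no _    | no _    = refl

  swap-involutive : ∀ {n} (a b x : Fin n) → swap a b (swap a b x) ≡ x
  swap-involutive a b x = by-cases (x ≟ᶠ a) (x ≟ᶠ b)
    where
    by-cases : Dec (x ≡ a) → Dec (x ≡ b) → swap a b (swap a b x) ≡ x
    by-cases (yes refl) _          = trans (cong (swap a b) (swap-left a b)) (swap-right a b)
    by-cases (no _)     (yes refl) = trans (cong (swap a b) (swap-right a b)) (swap-left a b)
    by-cases (no x≢a)   (no x≢b)   = trans (cong (swap a b) (swap-other x≢a x≢b)) (swap-other x≢a x≢b)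

  swapping : ∀ {n} → Fin n → Fin n → Fin n ↔ Fin n
  swapping a b = mk↔ₛ′ (swap a b) (swap a b) (swap-involutive a b) (swap-involutive a b)

  -- Unordered, because the order in which two ends are listed may differ between H and its
  -- rewirings.
  record Joins {n k} (ends : Fin k → Fin n × Fin n) (e : Fin k) (a b : Fin n) : Set where
    constructor joins
    field
      apart  : a ≢ b
      on-a   : On ends a e
      on-b   : On ends b e

  joins-sym : ∀ {n k} {ends : Fin k → Fin n × Fin n} {e a b} → Joins ends e a b → Joins ends e b a
  joins-sym (joins a≢b a b) = joins (≢-sym a≢b) b a

  joins-≡ : ∀ {n k} {ends : Fin k → Fin n × Fin n} → Simple ends → ∀ {e a b} → ends e ≡ (a , b) → Joins ends e a b
  joins-≡ simple {e} refl = joins (Simple.proper simple e) (inj₁ refl) (inj₂ refl)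

  -- A copy of B₂C(l, 1) with the given centre, whose triangles at the centre are
  -- completed by the edges c = {t₁, t₂} and d = {t₃, t₄}, and with u hanging at t₁.
  record Target (r l : ℕ) {n} (c d : Fin (suc n)) (root t₁ t₂ t₃ t₄ u : Fin n) : Set where
    field
      ends     : Fin (suc n) → Fin n × Fin n
      simple   : Simple ends
      model    : Model (B₂C (suc (suc r)) l 1) r ends
      joins-c  : Joins ends c t₁ t₂
      joins-d  : Joins ends d t₃ t₄
      joins-up : ∀ {x} → x ≢ root → x ≢ u → Joins ends (suc x) root x
      joins-u  : Joins ends (suc u) t₁ u

  places₁ : ∀ {l} → Place l 1 ↔ (Fin 6 ⊎ Fin l)
  places₁ = mk↔ₛ′
    (λ { (base 0F) → inj₁ 0F ; (base 1F) → inj₁ 1F ; (base 2F) → inj₁ 2F ; (base 3F) → inj₁ 3F ; (base 4F) → inj₁ 4F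
       ; (leaf i) → inj₂ i ; (tail 0F) → inj₁ 5F })
    (λ { (inj₁ 0F) → base 0F ; (inj₁ 1F) → base 1F ; (inj₁ 2F) → base 2F ; (inj₁ 3F) → base 3F ; (inj₁ 4F) → base 4F
       ; (inj₂ i) → leaf i ; (inj₁ 5F) → tail 0F })
    (λ { (inj₁ 0F) → refl ; (inj₁ 1F) → refl ; (inj₁ 2F) → refl ; (inj₁ 3F) → refl ; (inj₁ 4F) → refl
       ; (inj₂ i) → refl ; (inj₁ 5F) → refl })
    (λ { (base 0F) → refl ; (base 1F) → refl ; (base 2F) → refl ; (base 3F) → refl ; (base 4F) → refl
       ; (leaf i) → refl ; (tail 0F) → refl })

  places₀ : ∀ {l} → Place l 0 ↔ (Fin 5 ⊎ Fin l)
  places₀ = mk↔ₛ′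
    (λ { (inj₁ p) → p ; (inj₂ ()) }) (λ p → inj₁ p) (λ _ → refl) (λ { (inj₁ p) → refl ; (inj₂ ()) })

  module _ {r l n : ℕ} {root t₁ t₂ t₃ t₄ u : Fin n} (n≡ : n ≡ 6 ℕ.+ l)
           (distinct : Unique (root ∷ t₁ ∷ t₂ ∷ t₃ ∷ t₄ ∷ u ∷ [])) where

    private
      points : Fin 6 → Fin n
      points = lookup (root ∷ t₁ ∷ t₂ ∷ t₃ ∷ t₄ ∷ u ∷ [])
      extension = extend points (λ {i} {j} → lookup-injective distinct i j) n≡
      χ : Place l 1 ↔ Fin n
      χ = proj₁ extension ↔-∘ places₁
      χ-points : ∀ i → Inverse.to (proj₁ extension) (inj₁ i) ≡ points i
      χ-points = proj₂ extension
      ends₀ : Fin (suc n) → Fin n × Fin n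
      ends₀ = labelled χ
      simple₀ : Simple ends₀
      simple₀ = rename-simple χ (maybe↔suc χ) canonical-simple
      at : ∀ v → Joins ends₀ (suc (Inverse.to χ v)) (Inverse.to χ (proj₁ (canonical (just v)))) (Inverse.to χ (proj₂ (canonical (just v))))
      at v = joins-≡ simple₀ (labelled-at χ v)
      joins-cong : ∀ {ends : Fin (suc n) → Fin n × Fin n} {e e′ a a′ b b′} → e ≡ e′ → a ≡ a′ → b ≡ b′ → Joins ends e a b → Joins ends e′ a′ b′
      joins-cong refl refl refl j = j
      up₀ : ∀ {x} → x ≢ root → x ≢ u → Joins ends₀ (suc x) root x
      up₀ {x} x≢root x≢u = subst (λ x → Joins ends₀ (suc x) root x) (Inverse.strictlyInverseˡ χ x) (go (Inverse.from χ x) (Inverse.strictlyInverseˡ χ x))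
        where
        go : ∀ v → Inverse.to χ v ≡ x → Joins ends₀ (suc (Inverse.to χ v)) root (Inverse.to χ v)
        go (base 0F)      eq = ⊥-elim (x≢root (trans (sym eq) (χ-points 0F)))
        go (base (suc i)) eq = joins-cong refl (χ-points 0F) refl (at (base (suc i)))
        go (leaf i)       eq = joins-cong refl (χ-points 0F) refl (at (leaf i))
        go (tail 0F)      eq = ⊥-elim (x≢u (trans (sym eq) (χ-points 5F)))

    target : Target r l (suc root) zero root t₁ t₂ t₃ t₄ u
    target = record
      { ends     = ends₀
      ; simple   = simple₀
      ; model    = rename-model χ (maybe↔suc χ) (B₂C-model r l 1)
      ; joins-c  = joins-cong (cong suc (χ-points 0F)) (χ-points 1F) (χ-points 2F) (at (base 0F))
      ; joins-d  = joins-cong refl (χ-points 3F) (χ-points 4F) (joins-≡ simple₀ {zero} refl)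
      ; joins-up = up₀
      ; joins-u  = joins-cong (cong suc (χ-points 5F)) (χ-points 1F) (χ-points 5F) (at (tail 0F))
      }

  -- The graph stays the same up to the names of two edges. This matters because loads belong to
  -- labels: the two loads change places.
  module Swapped {k n r : ℕ} {X : Hypergraph} {ends : Fin k → Fin n × Fin n} (simple : Simple ends) (M : Model X r ends) (a b : Fin k) where

    ends′ : Fin k → Fin n × Fin n
    ends′ = rename (↔-id (Fin n)) (swapping a b) ends

    simple′ : Simple ends′
    simple′ = rename-simple (↔-id (Fin n)) (swapping a b) simple

    model′ : Model X r ends′
    model′ = rename-model (↔-id (Fin n)) (swapping a b) M

    joins′ : ∀ {e x y} → Joins ends (swap a b e) x y → Joins ends′ e x y
    joins′ (joins x≢y x∈ y∈) = joins x≢y x∈ y∈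

    joins-left : ∀ {x y} → Joins ends b x y → Joins ends′ a x y
    joins-left j = joins′ (subst (λ e → Joins ends e _ _) (sym (swap-left a b)) j)

    joins-right : ∀ {x y} → Joins ends a x y → Joins ends′ b x y
    joins-right j = joins′ (subst (λ e → Joins ends e _ _) (sym (swap-right a b)) j)

    joins-other : ∀ {e x y} → e ≢ a → e ≢ b → Joins ends e x y → Joins ends′ e x y
    joins-other e≢a e≢b j = joins′ (subst (λ e → Joins ends e _ _) (sym (swap-other e≢a e≢b)) j)

  -- The two chord labels in either order, so that what is proved about one chord also applies to
  -- the other.
  Oriented : ∀ {n} → Fin (suc n) → Fin (suc n) → Fin n → Set
  Oriented c d root = (c ≡ suc root × d ≡ zero) ⊎ (c ≡ zero × d ≡ suc root)

  oriented-target : ∀ {r l n} {c d : Fin (suc n)} {root t₁ t₂ t₃ t₄ u : Fin n} → Oriented c d root → n ≡ 6 ℕ.+ l → u ≢ root →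
                    Unique (root ∷ t₁ ∷ t₂ ∷ t₃ ∷ t₄ ∷ u ∷ []) → Target r l c d root t₁ t₂ t₃ t₄ u
  oriented-target (inj₁ (refl , refl)) n≡ u≢root distinct = target n≡ distinct
  oriented-target {r} {l} {root = root} {u = u} (inj₂ (refl , refl)) n≡ u≢root distinct = record
    { ends     = ends′
    ; simple   = simple′
    ; model    = model′
    ; joins-c  = joins-right joins-c
    ; joins-d  = joins-left joins-d
    ; joins-up = λ x≢root x≢u → joins-other (λ { refl → x≢root refl }) (λ ()) (joins-up x≢root x≢u)
    ; joins-u  = joins-other (λ { refl → u≢root refl }) (λ ()) joins-u
    }
    where
    open Target (target {r} {l} n≡ distinct)
    open Swapped simple model (suc root) zero

  record Centred (r l : ℕ) {n} (c d : Fin (suc n)) (root t₁ t₂ t₃ t₄ : Fin n) : Set where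
    field
      ends     : Fin (suc n) → Fin n × Fin n
      simple   : Simple ends
      model    : Model (B₂C (suc (suc r)) l 0) r ends
      joins-c  : Joins ends c t₁ t₂
      joins-d  : Joins ends d t₃ t₄
      joins-up : ∀ {x} → x ≢ root → Joins ends (suc x) root x

  module _ {r l n : ℕ} {root t₁ t₂ t₃ t₄ : Fin n} (n≡ : n ≡ 5 ℕ.+ l)
           (distinct : Unique (root ∷ t₁ ∷ t₂ ∷ t₃ ∷ t₄ ∷ [])) where

    private
      points : Fin 5 → Fin n
      points = lookup (root ∷ t₁ ∷ t₂ ∷ t₃ ∷ t₄ ∷ [])
      extension = extend points (λ {i} {j} → lookup-injective distinct i j) n≡
      χ : Place l 0 ↔ Fin n
      χ = proj₁ extension ↔-∘ places₀
      χ-points : ∀ i → Inverse.to (proj₁ extension) (inj₁ i) ≡ points i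
      χ-points = proj₂ extension
      ends₀ : Fin (suc n) → Fin n × Fin n
      ends₀ = labelled χ
      simple₀ : Simple ends₀
      simple₀ = rename-simple χ (maybe↔suc χ) canonical-simple
      at : ∀ v → Joins ends₀ (suc (Inverse.to χ v)) (Inverse.to χ (proj₁ (canonical (just v)))) (Inverse.to χ (proj₂ (canonical (just v))))
      at v = joins-≡ simple₀ (labelled-at χ v)
      joins-cong : ∀ {e e′ a a′ b b′} → e ≡ e′ → a ≡ a′ → b ≡ b′ → Joins ends₀ e a b → Joins ends₀ e′ a′ b′
      joins-cong refl refl refl j = j
      up₀ : ∀ {x} → x ≢ root → Joins ends₀ (suc x) root x
      up₀ {x} x≢root = subst (λ x → Joins ends₀ (suc x) root x) (Inverse.strictlyInverseˡ χ x) (go (Inverse.from χ x) (Inverse.strictlyInverseˡ χ x))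
        where
        go : ∀ v → Inverse.to χ v ≡ x → Joins ends₀ (suc (Inverse.to χ v)) root (Inverse.to χ v)
        go (base 0F)      eq = ⊥-elim (x≢root (trans (sym eq) (χ-points 0F)))
        go (base (suc i)) eq = joins-cong refl (χ-points 0F) refl (at (base (suc i)))
        go (leaf i)       eq = joins-cong refl (χ-points 0F) refl (at (leaf i))

    centred : Centred r l (suc root) zero root t₁ t₂ t₃ t₄
    centred = record
      { ends     = ends₀
      ; simple   = simple₀
      ; model    = rename-model χ (maybe↔suc χ) (B₂C-model r l 0)
      ; joins-c  = joins-cong (cong suc (χ-points 0F)) (χ-points 1F) (χ-points 2F) (at (base 0F))
      ; joins-d  = joins-cong refl (χ-points 3F) (χ-points 4F) (joins-≡ simple₀ {zero} refl)
      ; joins-up = up₀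
      }

-- Inequalities between edge sums under rewiring

module EdgeWeights where

  open RationalArithmetic
  open RadiusComparison using (δ; ∑-δ)
  open SpectralBounds using (by-≤)
  open AdjacencyMatrix using (δ-refl; δ-≢)
  open TargetCopies using (Joins; joins; swap; swapping; swap-left; swap-right; swap-other)
  open import Data.Rational.Base
  open import Data.Rational.Properties
  open import Data.Rational.Solver using (module +-*-Solver)
  open +-*-Solver

  ∑-gain : ∀ {k} {f g : Fin k → ℚ} {c} → (∀ e → f e ≤ g e) → ∀ e → f e + c ≤ g e → ∑ f + c ≤ ∑ g
  ∑-gain {f = f} {g} {c} f≤g e gain = by-≤ (≤⇒0≤- (≤-trans c≤ (term≤∑ (λ e → ≤⇒0≤- (f≤g e)) e)))
    (trans (cong (_- c) (∑-- g f)) (solve 3 (λ g f c → g :- f :- c := g :- (f :+ c)) refl (∑ g) (∑ f) c))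
    where
    c≤ : c ≤ g e - f e
    c≤ = by-≤ (≤⇒0≤- gain) (solve 3 (λ g f c → g :- (f :+ c) := g :- f :- c) refl (g e) (f e) c)

  -- Summing over all e counts both sides twice. In this way two edges need only satisfy an
  -- inequality jointly.
  ∑-swap-≤ : ∀ {k} {f g : Fin k → ℚ} (a b : Fin k) → (∀ e → f e + f (swap a b e) ≤ g e + g (swap a b e)) → ∑ f ≤ ∑ g
  ∑-swap-≤ {f = f} {g} a b pairs = *-cancelˡ (+-pos 0<1 0<1) (subst₂ _≤_ (double f) (double g) (∑-mono pairs))
    where
    double : ∀ h → ∑ (λ e → h e + h (swap a b e)) ≡ (1ℚ + 1ℚ) * ∑ h
    double h = trans (∑-+ h (λ e → h (swap a b e))) (trans (cong (∑ h +_) (sym (∑-permute h (swapping a b))))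
      (solve 1 (λ s → s :+ s := (con 1ℚ :+ con 1ℚ) :* s) refl (∑ h)))

  -- The amount c is charged to the term at e. As the exchange fixes e, the paired inequality there
  -- is `gain` taken twice.
  ∑-swap-gain : ∀ {k} {f g : Fin k → ℚ} {c} (a b : Fin k) → (∀ e → f e + f (swap a b e) ≤ g e + g (swap a b e)) →
                ∀ e → e ≢ a → e ≢ b → f e + c ≤ g e → ∑ f + c ≤ ∑ g
  ∑-swap-gain {k} {f} {g} {c} a b pairs e e≢a e≢b gain = subst (_≤ ∑ g)
    (trans (∑-+ f (λ i → c * δ e i)) (cong (∑ f +_) (trans (sym (*-∑ c (δ e))) (trans (cong (c *_) ∑δ) (*-identityʳ c)))))
    (∑-swap-≤ {f = λ i → f i + c * δ e i} {g} a b raised)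
    where
    ∑δ : ∑ (δ e) ≡ 1ℚ
    ∑δ = trans (∑-cong λ i → sym (*-identityˡ (δ e i))) (∑-δ (λ _ → 1ℚ) e)
    swap-e : swap a b e ≡ e
    swap-e = swap-other e≢a e≢b
    raised : ∀ i → (f i + c * δ e i) + (f (swap a b i) + c * δ e (swap a b i)) ≤ g i + g (swap a b i)
    raised i = by-cases (e ≟ᶠ i)
      where
      by-cases : Dec (e ≡ i) → (f i + c * δ e i) + (f (swap a b i) + c * δ e (swap a b i)) ≤ g i + g (swap a b i)
      by-cases (yes refl) = subst (λ j → (f e + c * δ e e) + (f j + c * δ e j) ≤ g e + g j) (sym swap-e)
        (subst (λ z → (f e + c * z) + (f e + c * z) ≤ g e + g e) (sym (δ-refl e))
          (subst (λ z → (f e + z) + (f e + z) ≤ g e + g e) (sym (*-identityʳ c)) (+-mono-≤ gain gain)))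
      by-cases (no e≢i) = subst₂ (λ p q → (f i + c * p) + (f (swap a b i) + c * q) ≤ g i + g (swap a b i)) (sym (δ-≢ e≢i)) (sym (δ-≢ e≢swap))
        (subst (_≤ g i + g (swap a b i)) (solve 3 (λ p q c → p :+ q := (p :+ c :* con 0ℚ) :+ (q :+ c :* con 0ℚ)) refl (f i) (f (swap a b i)) c) (pairs i))
        where
        e≢swap : e ≢ swap a b i
        e≢swap eq = e≢i (trans (sym swap-e) (trans (cong (swap a b) eq) (TargetCopies.swap-involutive a b i)))

  module Weights {n k : ℕ} (y : Fin n → ℚ) (N : Fin k → ℚ) (0<y : ∀ v → 0ℚ < y v) (0≤N : ∀ e → 0ℚ ≤ N e) where

    Φ : Fin k → Fin n × Fin n → ℚ
    Φ e (a , b) = y a * y b + (y a + y b) * N e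

    Ψ : Fin n → Fin k → Fin n × Fin n → ℚ
    Ψ v e (a , b) = δ a v * (y b + N e) + δ b v * (y a + N e)

    0≤y : ∀ v → 0ℚ ≤ y v
    0≤y v = <⇒≤ (0<y v)

    0≤y+N : ∀ v e → 0ℚ ≤ y v + N e
    0≤y+N v e = +-nonneg (0≤y v) (0≤N e)

    Φ-joins : ∀ {ends : Fin k → Fin n × Fin n} {e a b} → Joins ends e a b → Φ e (ends e) ≡ Φ e (a , b)
    Φ-joins (joins a≢b (inj₁ refl) (inj₁ refl)) = ⊥-elim (a≢b refl)
    Φ-joins (joins a≢b (inj₁ refl) (inj₂ refl)) = refl
    Φ-joins {ends} {e} (joins a≢b (inj₂ refl) (inj₁ refl)) = solve 3 (λ a b N → a :* b :+ (a :+ b) :* N := b :* a :+ (b :+ a) :* N) refl (y (proj₁ (ends e))) (y (proj₂ (ends e))) (N e)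
    Φ-joins (joins a≢b (inj₂ refl) (inj₂ refl)) = ⊥-elim (a≢b refl)

    Ψ-joins : ∀ {ends : Fin k → Fin n × Fin n} {e a b} → Joins ends e a b → ∀ v → Ψ v e (ends e) ≡ Ψ v e (a , b)
    Ψ-joins (joins a≢b (inj₁ refl) (inj₁ refl)) v = ⊥-elim (a≢b refl)
    Ψ-joins (joins a≢b (inj₁ refl) (inj₂ refl)) v = refl
    Ψ-joins {ends} {e} (joins a≢b (inj₂ refl) (inj₁ refl)) v = +-comm (δ (proj₁ (ends e)) v * (y (proj₂ (ends e)) + N e)) _
    Ψ-joins (joins a≢b (inj₂ refl) (inj₂ refl)) v = ⊥-elim (a≢b refl)

    Φ-mono : ∀ e {a b a′ b′} → y a ≤ y a′ → y b ≤ y b′ → Φ e (a , b) ≤ Φ e (a′ , b′)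
    Φ-mono e {a} {b} a≤ b≤ = +-mono-≤ (*-mono (0≤y a) a≤ (0≤y b) b≤) (*-monoʳ (0≤N e) (+-mono-≤ a≤ b≤))

    Ψ-first : ∀ e {a b} → a ≢ b → Ψ a e (a , b) ≡ y b + N e
    Ψ-first e {a} {b} a≢b = trans (cong₂ (λ p q → p * (y b + N e) + q * (y a + N e)) (δ-refl a) (δ-≢ (≢-sym a≢b)))
      (solve 2 (λ p q → con 1ℚ :* p :+ con 0ℚ :* q := p) refl (y b + N e) (y a + N e))

    Ψ-none : ∀ e {v a b} → v ≢ a → v ≢ b → Ψ v e (a , b) ≡ 0ℚ
    Ψ-none e {v} {a} {b} v≢a v≢b = trans (cong₂ (λ p q → p * (y b + N e) + q * (y a + N e)) (δ-≢ (≢-sym v≢a)) (δ-≢ (≢-sym v≢b)))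
      (solve 2 (λ p q → con 0ℚ :* p :+ con 0ℚ :* q := con 0ℚ) refl (y b + N e) (y a + N e))

    Ψ-nonneg : ∀ v e a b → 0ℚ ≤ Ψ v e (a , b)
    Ψ-nonneg v e a b = +-nonneg (*-nonneg (δ-nonneg a) (0≤y+N b e)) (*-nonneg (δ-nonneg b) (0≤y+N a e))
      where
      δ-nonneg : ∀ a → 0ℚ ≤ δ a v
      δ-nonneg a = by-cases (a ≟ᶠ v)
        where
        by-cases : Dec (a ≡ v) → 0ℚ ≤ δ a v
        by-cases (yes refl) = subst (0ℚ ≤_) (sym (δ-refl a)) 0≤1
        by-cases (no a≢v)   = ≤-reflexive (sym (δ-≢ a≢v))

    module Change (ends ends′ : Fin k → Fin n × Fin n) where

      Gain : Set
      Gain = ∑ (λ e → Φ e (ends e)) ≤ ∑ (λ e → Φ e (ends′ e)) ×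
             ∃[ v ] ∃[ j ] ∑ (λ e → Ψ v e (ends e)) + y j ≤ ∑ (λ e → Ψ v e (ends′ e))

      -- The ends move to places of no smaller weight. The end b is not the root, so only a matters
      -- for the root's coordinate of A y, and `keeps` prevents that contribution from being lost.
      record Upgrade (root : Fin n) (e : Fin k) : Set where
        constructor upgrade
        field
          {a b a′ b′} : Fin n
          old     : Joins ends e a b
          new     : Joins ends′ e a′ b′
          a≤a′    : y a ≤ y a′
          b≤b′    : y b ≤ y b′
          keeps   : a ≡ root → a′ ≡ root
          b≢root  : b ≢ root

      upgrade-Φ : ∀ {root e} → Upgrade root e → Φ e (ends e) ≤ Φ e (ends′ e)
      upgrade-Φ {e = e} U = subst₂ _≤_ (sym (Φ-joins old)) (sym (Φ-joins new)) (Φ-mono e a≤a′ b≤b′)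
        where open Upgrade U

      upgrade-Ψ : ∀ {root e} → Upgrade root e → Ψ root e (ends e) ≤ Ψ root e (ends′ e)
      upgrade-Ψ {root} {e} U = subst₂ _≤_ (sym (Ψ-joins old root)) (sym (Ψ-joins new root)) (by-cases (a ≟ᶠ root))
        where
        open Upgrade U
        by-cases : Dec (a ≡ root) → Ψ root e (a , b) ≤ Ψ root e (a′ , b′)
        by-cases (yes refl) = subst (λ z → Ψ a e (a , b) ≤ Ψ a e (z , b′)) (sym (keeps refl))
          (subst₂ _≤_ (sym (Ψ-first e (Joins.apart old))) (sym (Ψ-first e (λ eq → Joins.apart new (trans (keeps refl) eq)))) (+-monoˡ-≤ (N e) b≤b′))
        by-cases (no a≢root) = subst (_≤ Ψ root e (a′ , b′)) (sym (Ψ-none e (≢-sym a≢root) (≢-sym b≢root))) (Ψ-nonneg root e a′ b′)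

      new-at : ∀ {v e a b b′} → Joins ends e a b → Joins ends′ e v b′ → v ≢ a → v ≢ b → Ψ v e (ends e) + y b′ ≤ Ψ v e (ends′ e)
      new-at {v} {e} {b′ = b′} old new v≢a v≢b = subst₂ (λ p q → p + y b′ ≤ q)
        (sym (trans (Ψ-joins old v) (Ψ-none e v≢a v≢b))) (sym (trans (Ψ-joins new v) (Ψ-first e (Joins.apart new))))
        (subst₂ _≤_ (solve 1 (λ b → b :+ con 0ℚ := con 0ℚ :+ b) refl (y b′)) refl (+-monoʳ-≤ (y b′) (0≤N e)))

      -- No upgrade lowers the root's coordinate, and an edge newly attached to the root raises it
      -- by at least the weight of its other end.
      star-gain : ∀ {root} → (∀ e → Upgrade root e) → ∀ {e a b b′} → Joins ends e a b → Joins ends′ e root b′ → root ≢ a → root ≢ b → Gain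
      star-gain {root} U {e} {b′ = b′} old new root≢a root≢b =
        ∑-mono (λ e → upgrade-Φ (U e)) , root , b′ , ∑-gain (λ e → upgrade-Ψ (U e)) e (new-at old new root≢a root≢b)

      Unchanged : Fin k → Set
      Unchanged e = ∃[ a ] ∃[ b ] Joins ends e a b × Joins ends′ e a b

      -- When all other edges stay in place, the gain may be read at any new end of e and not only
      -- at the root.
      single-gain : ∀ {root} → (∀ e → Upgrade root e) → ∀ {e v a b b′} → (∀ f → f ≢ e → Unchanged f) →
                    Joins ends e a b → Joins ends′ e v b′ → v ≢ a → v ≢ b → Gain
      single-gain U {e} {v} {b′ = b′} same old new v≢a v≢b =
        ∑-mono (λ e → upgrade-Φ (U e)) , v , b′ , ∑-gain monotone e gain
        where
        gain = new-at old new v≢a v≢b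
        monotone : ∀ f → Ψ v f (ends f) ≤ Ψ v f (ends′ f)
        monotone f = by-cases (f ≟ᶠ e)
          where
          by-cases : Dec (f ≡ e) → Ψ v f (ends f) ≤ Ψ v f (ends′ f)
          by-cases (yes refl) = ≤-trans (subst (_≤ Ψ v e (ends e) + y b′) (+-identityʳ (Ψ v e (ends e))) (+-monoʳ-≤ (Ψ v e (ends e)) (0≤y b′))) gain
          by-cases (no f≢e)   = let _ , _ , old , new = same f f≢e in ≤-reflexive (trans (Ψ-joins old v) (sym (Ψ-joins new v)))

      -- For moves in which p and q improve only together; the strict gain comes from a third edge
      -- that arrives at the root.
      pair-gain : ∀ {root} (p q : Fin k) → p ≢ q → (∀ e → e ≢ p → e ≢ q → Upgrade root e) →
                  Φ p (ends p) + Φ q (ends q) ≤ Φ p (ends′ p) + Φ q (ends′ q) →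
                  Ψ root p (ends p) + Ψ root q (ends q) ≤ Ψ root p (ends′ p) + Ψ root q (ends′ q) →
                  ∀ {e a b b′} → e ≢ p → e ≢ q → Joins ends e a b → Joins ends′ e root b′ → root ≢ a → root ≢ b → Gain
      pair-gain {root} p q p≢q U Φ-pair Ψ-pair {e} {b′ = b′} e≢p e≢q old new root≢a root≢b =
        ∑-swap-≤ p q (pairwise (λ e → Φ e (ends e)) (λ e → Φ e (ends′ e)) (λ e e≢p e≢q → upgrade-Φ (U e e≢p e≢q)) Φ-pair) , root , b′ ,
        ∑-swap-gain p q (pairwise (λ e → Ψ root e (ends e)) (λ e → Ψ root e (ends′ e)) (λ e e≢p e≢q → upgrade-Ψ (U e e≢p e≢q)) Ψ-pair)
          e e≢p e≢q (new-at old new root≢a root≢b)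
        where
        pairwise : ∀ (f g : Fin k → ℚ) → (∀ e → e ≢ p → e ≢ q → f e ≤ g e) → f p + f q ≤ g p + g q →
                   ∀ e → f e + f (swap p q e) ≤ g e + g (swap p q e)
        pairwise f g single pair e = by-cases (e ≟ᶠ p) (e ≟ᶠ q)
          where
          by-cases : Dec (e ≡ p) → Dec (e ≡ q) → f e + f (swap p q e) ≤ g e + g (swap p q e)
          by-cases (yes refl) _          = subst (λ z → f p + f z ≤ g p + g z) (sym (swap-left p q)) pair
          by-cases (no _)     (yes refl) = subst (λ z → f q + f z ≤ g q + g z) (sym (swap-right p q))
            (subst₂ _≤_ (+-comm (f p) (f q)) (+-comm (g p) (g q)) pair)
          by-cases (no e≢p)   (no e≢q)   = subst (λ z → f e + f z ≤ g e + g z) (sym (swap-other e≢p e≢q)) (+-mono-≤ (single e e≢p e≢q) (single e e≢p e≢q))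

-- The moves towards B₂C(k - 7, 1)

module EdgeMoves where

  open RationalArithmetic
  open SpectralBounds using (by-≤)
  open GraphModels using (Model; On; Simple)
  open Labellings using (outside-image)
  open TargetCopies
  open GraphCycles using (module Combinatorics)
  open EdgeWeights
  open import Defs using (B₂C)
  open import Data.Rational.Base
  open import Data.Rational.Properties
  open import Data.Rational.Solver using (module +-*-Solver)
  open import Data.Vec.Base using ([]; _∷_; lookup)
  open import Data.Vec.Relation.Unary.All using ([]; _∷_)
  open import Data.Vec.Relation.Unary.AllPairs using ([]; _∷_)
  open import Data.Vec.Relation.Unary.Unique.Propositional using (Unique)
  open import Data.Vec.Relation.Unary.Unique.Propositional.Properties using (lookup-injective)
  open +-*-Solver using (solve; _:+_; _:*_; _:-_; _:=_)

  module Comparison {n : ℕ} (r l : ℕ) (n≡ : n ≡ 6 ℕ.+ l)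
    {ends : Fin (ℕ.suc n) → Fin n × Fin n} (simple : Simple ends) (root : Fin n) (parent : Fin n → Fin n)
    (up-joins : ∀ {w} → w ≢ root → Joins ends (suc w) (parent w) w)
    (chord-root : ∀ {c d} → Oriented c d root → ¬ On ends root c)
    (chords-disjoint : ∀ {c d x} → Oriented c d root → On ends x c → On ends x d → ⊥)
    (chords-apart : ∀ {c d w b} → Oriented c d root → w ≢ root → parent w ≢ root → w ≢ b →
                    On ends w c → On ends b c → On ends (parent w) d → parent b ≢ root)
    (y : Fin n → ℚ) (N : Fin (ℕ.suc n) → ℚ) (0<y : ∀ v → 0ℚ < y v) (0≤N : ∀ e → 0ℚ ≤ N e) (y≤ : ∀ v → y v ≤ y root) where

    open Weights y N 0<y 0≤N
    open Combinatorics simple using (On?; two-ends; other-end)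

    Same : (Fin (ℕ.suc n) → Fin n × Fin n) → Set
    Same ends′ = ∀ v e → On ends v e ⇔ On ends′ v e

    -- `centred-copy` is the excluded hypergraph, `target-copy` the case of equality, and `improved`
    -- the case of strict inequality.
    data Outcome : Set where
      centred-copy : ∀ ends′ → Model (B₂C (ℕ.suc (ℕ.suc r)) (ℕ.suc l) 0) r ends′ → Same ends′ → Outcome
      target-copy  : ∀ ends′ → Model (B₂C (ℕ.suc (ℕ.suc r)) l 1) r ends′ → Same ends′ → Outcome
      improved     : ∀ ends′ → Simple ends′ → Model (B₂C (ℕ.suc (ℕ.suc r)) l 1) r ends′ → Change.Gain ends ends′ → Outcome

    flip-orientation : ∀ {c d} → Oriented c d root → Oriented d c root
    flip-orientation (inj₁ (p , q)) = inj₂ (q , p)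
    flip-orientation (inj₂ (p , q)) = inj₁ (q , p)

    edge-elim : ∀ {c d} → Oriented c d root → (P : Fin (ℕ.suc n) → Set) → P c → P d → (∀ x → x ≢ root → P (suc x)) → ∀ e → P e
    edge-elim (inj₁ (refl , refl)) P pc pd px zero    = pd
    edge-elim (inj₂ (refl , refl)) P pc pd px zero    = pc
    edge-elim o P pc pd px (suc x) with x ≟ᶠ root
    edge-elim (inj₁ (refl , refl)) P pc pd px (suc x) | yes refl = pc
    edge-elim (inj₂ (refl , refl)) P pc pd px (suc x) | yes refl = pd
    edge-elim o                    P pc pd px (suc x) | no x≢root = px x x≢root

    up≢chord : ∀ {c d x} → Oriented c d root → x ≢ root → suc x ≢ c
    up≢chord (inj₁ (refl , refl)) x≢root eq = x≢root (suc-injective eq)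
    up≢chord (inj₂ (refl , refl)) x≢root ()

    same-ends : ∀ {ends′} → Simple ends′ → (∀ e → Change.Unchanged ends ends′ e) → Same ends′
    same-ends {ends′} simple′ same v e with same e
    ... | a , b , joins a≢b p q , joins _ p′ q′ = mk⇔
      (λ v∈ → [ (λ { refl → p′ }) , (λ { refl → q′ }) ]′ (two-ends a≢b p q v∈))
      (λ v∈ → [ (λ { refl → p }) , (λ { refl → q }) ]′ (Combinatorics.two-ends simple′ a≢b p′ q′ v∈))

    chord-joins : ∀ e → Joins ends e (proj₁ (ends e)) (proj₂ (ends e))
    chord-joins e = joins-≡ simple refl

    chord≢root : ∀ {c d x} → Oriented c d root → On ends x c → root ≢ x
    chord≢root o x∈c refl = chord-root o x∈c

    apart-chords : ∀ {c d x z} → Oriented c d root → On ends x c → On ends z d → x ≢ z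
    apart-chords o x∈c z∈d refl = chords-disjoint o x∈c z∈d

    off : ∀ {e x z} → On ends x e → ¬ On ends z e → x ≢ z
    off x∈e z∉e refl = z∉e x∈e

    -- The parent of w joins it by suc w, so they cannot also be the ends of a chord.
    not-parallel : ∀ {c d w} → Oriented c d root → w ≢ root → On ends w c → ¬ On ends (parent w) c
    not-parallel o w≢root w∈c p∈c = up≢chord o w≢root (Simple.single simple (Joins.apart (up-joins w≢root))
      (Joins.on-a (up-joins w≢root)) (Joins.on-b (up-joins w≢root)) p∈c w∈c)

    module _ {c d : Fin (ℕ.suc n)} (o : Oriented c d root) where

      module UsingTarget {c′ d′ t₁ t₂ t₃ t₄ u} (T : Target r l c′ d′ root t₁ t₂ t₃ t₄ u) where
        module T = Target T
        open Change ends T.ends public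

        same-upgrade : ∀ {e a b} → Joins ends e a b → Joins T.ends e a b → root ≢ b → Upgrade root e
        same-upgrade old new root≢b = upgrade old new ≤-refl ≤-refl (λ eq → eq) (≢-sym root≢b)

        star-upgrade : ∀ {x} → x ≢ root → x ≢ u → Upgrade root (suc x)
        star-upgrade {x} x≢root x≢u = upgrade (up-joins x≢root) (T.joins-up x≢root x≢u) (y≤ (parent x)) ≤-refl (λ _ → refl) x≢root

        improve : Gain → Outcome
        improve = improved T.ends T.simple T.model

      -- A vertex besides w that is not yet attached to the root; moving it there gives strictness.
      -- When there is none, only w is exceptional and the gain must come from elsewhere.
      Other : Fin n → Fin n → Set
      Other w x = x ≢ root × x ≢ w × parent x ≢ root

      other? : ∀ w → Dec (∃[ x ] Other w x)
      other? w = any? (λ x → ¬? (x ≟ᶠ root) ×-dec (¬? (x ≟ᶠ w) ×-dec ¬? (parent x ≟ᶠ root)))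

      settled : ∀ {w} → ¬ (∃[ x ] Other w x) → ∀ {x} → x ≢ root → x ≢ w → parent x ≡ root
      settled none {x} x≢root x≢w = decidable-stable (parent x ≟ᶠ root) λ p≢root → none (x , x≢root , x≢w , p≢root)

      settled-joins : ∀ {w} → ¬ (∃[ x ] Other w x) → ∀ {x} → x ≢ root → x ≢ w → Joins ends (suc x) root x
      settled-joins none {x} x≢root x≢w = subst (λ p → Joins ends (suc x) p x) (settled none x≢root x≢w) (up-joins x≢root)

      -- Here w already hangs at an end of a chord, as in the target, so it stays and all other
      -- vertices move to the root. If none has to move, H is the target.
      hanging : ∀ {w t₂} → w ≢ root → parent w ≢ root → ¬ On ends w c → ¬ On ends w d → Joins ends c (parent w) t₂ → Outcome
      hanging {w} {t₂} w≢root p≢root w∉c w∉d jc = finish (other? w)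
        where
        p  = parent w
        jd = chord-joins d
        t₃ = proj₁ (ends d)
        t₄ = proj₂ (ends d)
        open Joins
        o′ = flip-orientation o
        T : Target r l c d root p t₂ t₃ t₄ w
        T = oriented-target o n≡ w≢root
          ( (≢-sym p≢root ∷ chord≢root o (on-b jc) ∷ chord≢root o′ (on-a jd) ∷ chord≢root o′ (on-b jd) ∷ ≢-sym w≢root ∷ [])
          ∷ (apart jc ∷ apart-chords o (on-a jc) (on-a jd) ∷ apart-chords o (on-a jc) (on-b jd) ∷ off (on-a jc) w∉c ∷ [])
          ∷ (apart-chords o (on-b jc) (on-a jd) ∷ apart-chords o (on-b jc) (on-b jd) ∷ off (on-b jc) w∉c ∷ [])
          ∷ (apart jd ∷ off (on-a jd) w∉d ∷ []) ∷ (off (on-b jd) w∉d ∷ []) ∷ [] ∷ [])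
        open UsingTarget T
        up-case : ∀ x → x ≢ root → Upgrade root (suc x)
        up-case x x≢root with x ≟ᶠ w
        ... | yes refl = same-upgrade (up-joins w≢root) T.joins-u (≢-sym w≢root)
        ... | no x≢w   = star-upgrade x≢root x≢w
        U : ∀ e → Upgrade root e
        U = edge-elim o (Upgrade root) (same-upgrade jc T.joins-c (chord≢root o (on-b jc)))
              (same-upgrade jd T.joins-d (chord≢root o′ (on-b jd))) up-case
        finish : Dec (∃[ x ] Other w x) → Outcome
        finish (yes (x , x≢root , x≢w , px≢root)) =
          improve (star-gain U (up-joins x≢root) (T.joins-up x≢root x≢w) (≢-sym px≢root) (≢-sym x≢root))
        finish (no none) = target-copy T.ends T.model (same-ends T.simple (edge-elim o Unchanged
          (p , t₂ , jc , T.joins-c) (t₃ , t₄ , jd , T.joins-d) unchanged))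
          where
          unchanged : ∀ x → x ≢ root → Unchanged (suc x)
          unchanged x x≢root with x ≟ᶠ w
          ... | yes refl = p , w , up-joins w≢root , T.joins-u
          ... | no x≢w   = root , x , settled-joins none x≢root x≢w , T.joins-up x≢root x≢w

      -- Move w from its parent to the end z of c.
      rehang : ∀ {w z b} → w ≢ root → parent w ≢ root → ¬ On ends w c → ¬ On ends w d → ¬ On ends (parent w) c →
               Joins ends c z b → y (parent w) ≤ y z → Outcome
      rehang {w} {z} {b} w≢root p≢root w∉c w∉d p∉c jc yp≤yz = finish (other? w)
        where
        p  = parent w
        jd = chord-joins d
        t₃ = proj₁ (ends d)
        t₄ = proj₂ (ends d)
        open Joins
        o′ = flip-orientation o
        T : Target r l c d root z b t₃ t₄ w
        T = oriented-target o n≡ w≢root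
          ( (chord≢root o (on-a jc) ∷ chord≢root o (on-b jc) ∷ chord≢root o′ (on-a jd) ∷ chord≢root o′ (on-b jd) ∷ ≢-sym w≢root ∷ [])
          ∷ (apart jc ∷ apart-chords o (on-a jc) (on-a jd) ∷ apart-chords o (on-a jc) (on-b jd) ∷ off (on-a jc) w∉c ∷ [])
          ∷ (apart-chords o (on-b jc) (on-a jd) ∷ apart-chords o (on-b jc) (on-b jd) ∷ off (on-b jc) w∉c ∷ [])
          ∷ (apart jd ∷ off (on-a jd) w∉d ∷ []) ∷ (off (on-b jd) w∉d ∷ []) ∷ [] ∷ [])
        open UsingTarget T
        up-case : ∀ x → x ≢ root → Upgrade root (suc x)
        up-case x x≢root with x ≟ᶠ w
        ... | yes refl = upgrade (up-joins w≢root) T.joins-u yp≤yz ≤-refl (λ eq → ⊥-elim (p≢root eq)) w≢root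
        ... | no x≢w   = star-upgrade x≢root x≢w
        U : ∀ e → Upgrade root e
        U = edge-elim o (Upgrade root) (same-upgrade jc T.joins-c (chord≢root o (on-b jc)))
              (same-upgrade jd T.joins-d (chord≢root o′ (on-b jd))) up-case
        finish : Dec (∃[ x ] Other w x) → Outcome
        finish (yes (x , x≢root , x≢w , px≢root)) =
          improve (star-gain U (up-joins x≢root) (T.joins-up x≢root x≢w) (≢-sym px≢root) (≢-sym x≢root))
        -- Only `suc w` differs from the target, and its upper end is not the root; the gain is read
        -- at its new end z.
        finish (no none) = improve (single-gain U (edge-elim o (λ f → f ≢ suc w → Unchanged f)
            (λ _ → z , b , jc , T.joins-c) (λ _ → t₃ , t₄ , jd , T.joins-d)
            (λ x x≢root ≢w → root , x , settled-joins none x≢root (λ { refl → ≢w refl }) , T.joins-up x≢root (λ { refl → ≢w refl })))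
          (up-joins w≢root) T.joins-u (off (on-a jc) p∉c) (off (on-a jc) w∉c))

      -- Move the end z of c to the parent of w.
      rechord : ∀ {w z b} → w ≢ root → parent w ≢ root → w ≢ b → ¬ On ends w d → ¬ On ends (parent w) c → ¬ On ends (parent w) d →
                Joins ends c z b → y z ≤ y (parent w) → Outcome
      rechord {w} {z} {b} w≢root p≢root w≢b w∉d p∉c p∉d jc yz≤yp = finish (other? w)
        where
        p  = parent w
        jd = chord-joins d
        t₃ = proj₁ (ends d)
        t₄ = proj₂ (ends d)
        open Joins
        o′ = flip-orientation o
        T : Target r l c d root p b t₃ t₄ w
        T = oriented-target o n≡ w≢root
          ( (≢-sym p≢root ∷ chord≢root o (on-b jc) ∷ chord≢root o′ (on-a jd) ∷ chord≢root o′ (on-b jd) ∷ ≢-sym w≢root ∷ [])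
          ∷ (≢-sym (off (on-b jc) p∉c) ∷ ≢-sym (off (on-a jd) p∉d) ∷ ≢-sym (off (on-b jd) p∉d) ∷ apart (up-joins w≢root) ∷ [])
          ∷ (apart-chords o (on-b jc) (on-a jd) ∷ apart-chords o (on-b jc) (on-b jd) ∷ ≢-sym w≢b ∷ [])
          ∷ (apart jd ∷ off (on-a jd) w∉d ∷ []) ∷ (off (on-b jd) w∉d ∷ []) ∷ [] ∷ [])
        open UsingTarget T
        up-case : ∀ x → x ≢ root → Upgrade root (suc x)
        up-case x x≢root with x ≟ᶠ w
        ... | yes refl = same-upgrade (up-joins w≢root) T.joins-u (≢-sym w≢root)
        ... | no x≢w   = star-upgrade x≢root x≢w
        U : ∀ e → Upgrade root e
        U = edge-elim o (Upgrade root)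
              (upgrade jc T.joins-c yz≤yp ≤-refl (λ eq → ⊥-elim (chord≢root o (on-a jc) (sym eq))) (≢-sym (chord≢root o (on-b jc))))
              (same-upgrade jd T.joins-d (chord≢root o′ (on-b jd))) up-case
        finish : Dec (∃[ x ] Other w x) → Outcome
        finish (yes (x , x≢root , x≢w , px≢root)) =
          improve (star-gain U (up-joins x≢root) (T.joins-up x≢root x≢w) (≢-sym px≢root) (≢-sym x≢root))
        finish (no none) = improve (single-gain U (edge-elim o (λ f → f ≢ c → Unchanged f)
            (λ c≢c → ⊥-elim (c≢c refl)) (λ _ → t₃ , t₄ , jd , T.joins-d) unchanged)
          jc T.joins-c (≢-sym (off (on-a jc) p∉c)) (≢-sym (off (on-b jc) p∉c)))
          where
          unchanged : ∀ x → x ≢ root → suc x ≢ c → Unchanged (suc x)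
          unchanged x x≢root _ with x ≟ᶠ w
          ... | yes refl = p , w , up-joins w≢root , T.joins-u
          ... | no x≢w   = root , x , settled-joins none x≢root x≢w , T.joins-up x≢root x≢w

      -- Exchange w, an end of c, with its parent.
      exchange : ∀ {w b} → w ≢ root → parent w ≢ root → ¬ On ends (parent w) d → Joins ends c w b → y (parent w) ≤ y w → Outcome
      exchange {w} {b} w≢root p≢root p∉d jc yp≤yw = finish (other? w)
        where
        p  = parent w
        jd = chord-joins d
        t₃ = proj₁ (ends d)
        t₄ = proj₂ (ends d)
        open Joins
        o′ = flip-orientation o
        p∉c : ¬ On ends p c
        p∉c = not-parallel o w≢root (on-a jc)
        -- In `T₀` the parent p hangs at w. After the labels `suc w` and `suc p` are exchanged,
        -- `suc w` still joins p and w with its own load, while `suc p` now joins the root and w.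
        T₀ : Target r l c d root w b t₃ t₄ p
        T₀ = oriented-target o n≡ p≢root
          ( (≢-sym w≢root ∷ chord≢root o (on-b jc) ∷ chord≢root o′ (on-a jd) ∷ chord≢root o′ (on-b jd) ∷ ≢-sym p≢root ∷ [])
          ∷ (apart jc ∷ apart-chords o (on-a jc) (on-a jd) ∷ apart-chords o (on-a jc) (on-b jd) ∷ off (on-a jc) p∉c ∷ [])
          ∷ (apart-chords o (on-b jc) (on-a jd) ∷ apart-chords o (on-b jc) (on-b jd) ∷ off (on-b jc) p∉c ∷ [])
          ∷ (apart jd ∷ off (on-a jd) p∉d ∷ []) ∷ (off (on-b jd) p∉d ∷ []) ∷ [] ∷ [])
        module T₀ = Target T₀
        module Sw = Swapped T₀.simple T₀.model (suc w) (suc p)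
        open Change ends Sw.ends′
        w≢p : w ≢ p
        w≢p eq = apart (up-joins w≢root) (sym eq)
        chord-new : ∀ {e a b} → suc w ≢ e → suc p ≢ e → Joins T₀.ends e a b → Joins Sw.ends′ e a b
        chord-new w≢ p≢ = Sw.joins-other (≢-sym w≢) (≢-sym p≢)
        new-c : Joins Sw.ends′ c w b
        new-c = chord-new (up≢chord o w≢root) (up≢chord o p≢root) T₀.joins-c
        new-d : Joins Sw.ends′ d t₃ t₄
        new-d = chord-new (up≢chord o′ w≢root) (up≢chord o′ p≢root) T₀.joins-d
        new-w : Joins Sw.ends′ (suc w) p w
        new-w = joins-sym (Sw.joins-left T₀.joins-u)
        new-p : Joins Sw.ends′ (suc p) root w
        new-p = Sw.joins-right (T₀.joins-up w≢root w≢p)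
        new-x : ∀ {x} → x ≢ root → x ≢ w → x ≢ p → Joins Sw.ends′ (suc x) root x
        new-x x≢root x≢w x≢p = Sw.joins-other (λ eq → x≢w (suc-injective eq)) (λ eq → x≢p (suc-injective eq)) (T₀.joins-up x≢root x≢p)
        same-upgrade : ∀ {e a b} → Joins ends e a b → Joins Sw.ends′ e a b → root ≢ b → Upgrade root e
        same-upgrade old new root≢b = upgrade old new ≤-refl ≤-refl (λ eq → eq) (≢-sym root≢b)
        up-case : ∀ x → x ≢ root → Upgrade root (suc x)
        up-case x x≢root with x ≟ᶠ w | x ≟ᶠ p
        ... | yes refl | _        = same-upgrade (up-joins w≢root) new-w (≢-sym w≢root)
        ... | no _     | yes refl = upgrade (up-joins p≢root) new-p (y≤ (parent p)) yp≤yw (λ _ → refl) p≢root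
        ... | no x≢w   | no x≢p   = upgrade (up-joins x≢root) (new-x x≢root x≢w x≢p) (y≤ (parent x)) ≤-refl (λ _ → refl) x≢root
        U : ∀ e → Upgrade root e
        U = edge-elim o (Upgrade root) (same-upgrade jc new-c (chord≢root o (on-b jc))) (same-upgrade jd new-d (chord≢root o′ (on-b jd))) up-case
        improve : Gain → Outcome
        improve = improved Sw.ends′ Sw.simple′ Sw.model′
        finish : Dec (∃[ x ] Other w x) → Outcome
        finish (yes (x , x≢root , x≢w , px≢root)) with x ≟ᶠ p
        ... | yes refl = improve (star-gain U (up-joins p≢root) new-p (≢-sym px≢root) (≢-sym p≢root))
        ... | no x≢p   = improve (star-gain U (up-joins x≢root) (new-x x≢root x≢w x≢p) (≢-sym px≢root) (≢-sym x≢root))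
        -- The root already is an end of `suc p`, so the gain is read at the other new end w.
        finish (no none) = improve (single-gain U (edge-elim o (λ f → f ≢ suc p → Unchanged f)
            (λ _ → w , b , jc , new-c) (λ _ → t₃ , t₄ , jd , new-d) unchanged)
          (settled-joins none p≢root (≢-sym w≢p)) (joins-sym new-p) w≢root w≢p)
          where
          unchanged : ∀ x → x ≢ root → suc x ≢ suc p → Unchanged (suc x)
          unchanged x x≢root x≢p with x ≟ᶠ w
          ... | yes refl = p , w , up-joins w≢root , new-w
          ... | no x≢w   = root , x , settled-joins none x≢root x≢w , new-x x≢root x≢w (λ { refl → x≢p refl })

      -- The parent of w is on the other chord, as in two triangles with a common vertex that is not
      -- the root. Moving w to the root would lead beyond the target, so another vertex x takes its place.
      module Opposite {w b q : Fin n} (w≢root : w ≢ root) (p≢root : parent w ≢ root)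
                      (jc : Joins ends c w b) (jd : Joins ends d (parent w) q) where
        open Joins
        p  = parent w
        o′ = flip-orientation o

        p∉c : ¬ On ends p c
        p∉c p∈c = chords-disjoint o p∈c (on-a jd)

        w∉d : ¬ On ends w d
        w∉d w∈d = chords-disjoint o (on-a jc) w∈d

        b≢root : b ≢ root
        b≢root = ≢-sym (chord≢root o (on-b jc))

        b≢p : b ≢ p
        b≢p = apart-chords o (on-b jc) (on-a jd)

        -- The upward edge of b is certain to move to the root, which supplies the strict gain in
        -- all three moves below.
        b-moves : root ≢ parent b
        b-moves = ≢-sym (chords-apart o w≢root p≢root (apart jc) (on-a jc) (on-b jc) (on-a jd))

        -- A sixth vertex exists because n = 6 + l.
        spare : ∃[ x ] (∀ i → lookup (root ∷ w ∷ b ∷ p ∷ q ∷ []) i ≢ x)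
        spare = outside-image (lookup (root ∷ w ∷ b ∷ p ∷ q ∷ [])) (λ {i} {j} → lookup-injective distinct i j)
          (subst (5 ℕ.<_) (sym n≡) (ℕₚ.m≤m+n 6 l))
          where
          distinct : Unique (root ∷ w ∷ b ∷ p ∷ q ∷ [])
          distinct = (≢-sym w≢root ∷ ≢-sym b≢root ∷ ≢-sym p≢root ∷ chord≢root o′ (on-b jd) ∷ [])
            ∷ (apart jc ∷ off (on-a jc) p∉c ∷ apart-chords o (on-a jc) (on-b jd) ∷ [])
            ∷ (b≢p ∷ apart-chords o (on-b jc) (on-b jd) ∷ []) ∷ (apart jd ∷ []) ∷ [] ∷ []

        x : Fin n
        x = proj₁ spare

        x≢root : x ≢ root
        x≢root = ≢-sym (proj₂ spare zero)
        x≢w : x ≢ w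
        x≢w = ≢-sym (proj₂ spare (suc zero))
        x≢b : x ≢ b
        x≢b = ≢-sym (proj₂ spare (suc (suc zero)))
        x≢p : x ≢ p
        x≢p = ≢-sym (proj₂ spare (suc (suc (suc zero))))
        x≢q : x ≢ q
        x≢q = ≢-sym (proj₂ spare (suc (suc (suc (suc zero)))))

        -- The heavier x takes the place of w on chord c, and w stays where it hangs, at the end p
        -- of d. Hence d is the chord of the triangle that carries the pendant.
        replace-w : y w ≤ y x → Outcome
        replace-w yw≤yx = improve (star-gain U (up-joins b≢root) (T.joins-up b≢root (≢-sym (apart jc))) b-moves (≢-sym b≢root))
          where
          T : Target r l d c root p q x b w
          T = oriented-target o′ n≡ w≢root
            ( (≢-sym p≢root ∷ chord≢root o′ (on-b jd) ∷ ≢-sym x≢root ∷ ≢-sym b≢root ∷ ≢-sym w≢root ∷ [])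
            ∷ (apart jd ∷ ≢-sym x≢p ∷ ≢-sym b≢p ∷ ≢-sym (off (on-a jc) p∉c) ∷ [])
            ∷ (≢-sym x≢q ∷ apart-chords o′ (on-b jd) (on-b jc) ∷ apart-chords o′ (on-b jd) (on-a jc) ∷ [])
            ∷ (x≢b ∷ x≢w ∷ []) ∷ (≢-sym (apart jc) ∷ []) ∷ [] ∷ [])
          open UsingTarget T
          up-case : ∀ z → z ≢ root → Upgrade root (suc z)
          up-case z z≢root with z ≟ᶠ w
          ... | yes refl = same-upgrade (up-joins w≢root) T.joins-u (≢-sym w≢root)
          ... | no z≢w   = star-upgrade z≢root z≢w
          U : ∀ e → Upgrade root e
          U = edge-elim o (Upgrade root) (upgrade jc T.joins-d yw≤yx ≤-refl (λ eq → ⊥-elim (w≢root eq)) b≢root)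
                (same-upgrade jd T.joins-c (chord≢root o′ (on-b jd))) up-case

        -- Here w and x exchange their parents; whether they should exchange the edges suc w and suc x
        -- as well depends on which of N (suc w) and N (suc x) is larger.
        T₀ : Target r l d c root p q w b x
        T₀ = oriented-target o′ n≡ x≢root
          ( (≢-sym p≢root ∷ chord≢root o′ (on-b jd) ∷ ≢-sym w≢root ∷ ≢-sym b≢root ∷ ≢-sym x≢root ∷ [])
          ∷ (apart jd ∷ ≢-sym (off (on-a jc) p∉c) ∷ ≢-sym b≢p ∷ ≢-sym x≢p ∷ [])
          ∷ (apart-chords o′ (on-b jd) (on-a jc) ∷ apart-chords o′ (on-b jd) (on-b jc) ∷ ≢-sym x≢q ∷ [])
          ∷ (apart jc ∷ ≢-sym x≢w ∷ []) ∷ (≢-sym x≢b ∷ []) ∷ [] ∷ [])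

        y₀ yp yw yx ypx Nw Nx : ℚ
        y₀  = y root
        yp  = y p
        yw  = y w
        yx  = y x
        ypx = y (parent x)
        Nw  = N (suc w)
        Nx  = N (suc x)

        sw≢sx : suc w ≢ suc x
        sw≢sx eq = x≢w (sym (suc-injective eq))

        x-at-root : Ψ root (suc x) (ends (suc x)) ≤ yx + Nx
        x-at-root = subst (_≤ yx + Nx) (sym (Ψ-joins (up-joins x≢root) root)) (by-cases (parent x ≟ᶠ root))
          where
          by-cases : Dec (parent x ≡ root) → Ψ root (suc x) (parent x , x) ≤ yx + Nx
          by-cases (yes eq) = ≤-reflexive (trans (cong (λ z → Ψ root (suc x) (z , x)) eq) (Ψ-first (suc x) (≢-sym x≢root)))
          by-cases (no px≢root) = subst (_≤ yx + Nx) (sym (Ψ-none (suc x) (≢-sym px≢root) (≢-sym x≢root))) (0≤y+N x (suc x))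

        old-Ψ : Ψ root (suc w) (ends (suc w)) + Ψ root (suc x) (ends (suc x)) ≤ yx + Nx
        old-Ψ = subst₂ _≤_ (cong (_+ Ψ root (suc x) (ends (suc x))) (sym (trans (Ψ-joins (up-joins w≢root) root) (Ψ-none (suc w) (≢-sym p≢root) (≢-sym w≢root)))))
          refl (subst (_≤ yx + Nx) (sym (+-identityˡ (Ψ root (suc x) (ends (suc x))))) x-at-root)

        old-Φ : Φ (suc w) (ends (suc w)) + Φ (suc x) (ends (suc x)) ≡ Φ (suc w) (p , w) + Φ (suc x) (parent x , x)
        old-Φ = cong₂ _+_ (Φ-joins (up-joins w≢root)) (Φ-joins (up-joins x≢root))

        keep-edges : yx ≤ yw → Nx ≤ Nw → Outcome
        keep-edges yx≤yw Nx≤Nw = improve (pair-gain (suc w) (suc x) sw≢sx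
            (λ e ≢w ≢x → edge-elim o (λ e → e ≢ suc w → e ≢ suc x → Upgrade root e)
              (λ _ _ → same-upgrade jc T.joins-d (≢-sym b≢root)) (λ _ _ → same-upgrade jd T.joins-c (chord≢root o′ (on-b jd)))
              (λ z z≢root _ z≢x → star-upgrade z≢root (λ { refl → z≢x refl })) e ≢w ≢x)
            Φ-pair Ψ-pair (λ eq → apart jc (sym (suc-injective eq))) (λ eq → x≢b (sym (suc-injective eq)))
            (up-joins b≢root) (T.joins-up b≢root (≢-sym x≢b)) b-moves (≢-sym b≢root))
          where
          open UsingTarget T₀
          new-w : Joins T.ends (suc w) root w
          new-w = T.joins-up w≢root (≢-sym x≢w)
          Φ-pair : Φ (suc w) (ends (suc w)) + Φ (suc x) (ends (suc x)) ≤ Φ (suc w) (T.ends (suc w)) + Φ (suc x) (T.ends (suc x))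
          Φ-pair = subst₂ _≤_ (sym old-Φ) (sym (cong₂ _+_ (Φ-joins new-w) (Φ-joins T.joins-u)))
            -- `suc w` gains (y₀ - yp)(yw + Nw), while `suc x` changes by (yp - ypx)(yx + Nx),
            -- possibly a loss. The sum regroups into two nonnegative products.
            (by-≤ (+-nonneg (*-nonneg (≤⇒0≤- (y≤ p)) (≤⇒0≤- (+-mono-≤ yx≤yw Nx≤Nw))) (*-nonneg (≤⇒0≤- (y≤ (parent x))) (0≤y+N x (suc x))))
              (solve 7 (λ y₀ yp yw yx ypx Nw Nx → (y₀ :- yp) :* ((yw :+ Nw) :- (yx :+ Nx)) :+ (y₀ :- ypx) :* (yx :+ Nx)
                := ((y₀ :* yw :+ (y₀ :+ yw) :* Nw) :+ (yp :* yx :+ (yp :+ yx) :* Nx)) :- ((yp :* yw :+ (yp :+ yw) :* Nw) :+ (ypx :* yx :+ (ypx :+ yx) :* Nx)))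
                refl y₀ yp yw yx ypx Nw Nx))
          Ψ-pair : Ψ root (suc w) (ends (suc w)) + Ψ root (suc x) (ends (suc x)) ≤ Ψ root (suc w) (T.ends (suc w)) + Ψ root (suc x) (T.ends (suc x))
          Ψ-pair = ≤-trans old-Ψ (≤-trans (+-mono-≤ yx≤yw Nx≤Nw) (subst₂ (λ s t → yw + Nw ≤ s + t)
            (sym (trans (Ψ-joins new-w root) (Ψ-first (suc w) (≢-sym w≢root)))) (sym (Ψ-joins T.joins-u root))
            (subst (_≤ yw + Nw + Ψ root (suc x) (p , x)) (+-identityʳ (yw + Nw)) (+-monoʳ-≤ (yw + Nw) (Ψ-nonneg root (suc x) p x)))))

        exchange-edges : yx ≤ yw → Nw ≤ Nx → Outcome
        exchange-edges yx≤yw Nw≤Nx = improved Sw.ends′ Sw.simple′ Sw.model′ (pair-gain (suc w) (suc x) sw≢sx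
            (λ e ≢w ≢x → edge-elim o (λ e → e ≢ suc w → e ≢ suc x → Upgrade root e)
              (λ ≢w ≢x → upgrade jc (Sw.joins-other ≢w ≢x T₀.joins-d) ≤-refl ≤-refl (λ eq → eq) b≢root)
              (λ ≢w ≢x → upgrade jd (Sw.joins-other ≢w ≢x T₀.joins-c) ≤-refl ≤-refl (λ eq → eq) (≢-sym (chord≢root o′ (on-b jd))))
              (λ z z≢root ≢w ≢x → upgrade (up-joins z≢root) (Sw.joins-other ≢w ≢x (T₀.joins-up z≢root (λ { refl → ≢x refl })))
                (y≤ (parent z)) ≤-refl (λ _ → refl) z≢root) e ≢w ≢x)
            Φ-pair Ψ-pair b≢w b≢x
            (up-joins b≢root) (Sw.joins-other b≢w b≢x (T₀.joins-up b≢root (≢-sym x≢b))) b-moves (≢-sym b≢root))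
          where
          module T₀ = Target T₀
          module Sw = Swapped T₀.simple T₀.model (suc w) (suc x)
          open Change ends Sw.ends′
          b≢w : suc b ≢ suc w
          b≢w eq = apart jc (sym (suc-injective eq))
          b≢x : suc b ≢ suc x
          b≢x eq = x≢b (sym (suc-injective eq))
          new-w : Joins Sw.ends′ (suc w) p x
          new-w = Sw.joins-left T₀.joins-u
          new-x : Joins Sw.ends′ (suc x) root w
          new-x = Sw.joins-right (T₀.joins-up w≢root (≢-sym x≢w))
          Φ-pair : Φ (suc w) (ends (suc w)) + Φ (suc x) (ends (suc x)) ≤ Φ (suc w) (Sw.ends′ (suc w)) + Φ (suc x) (Sw.ends′ (suc x))
          Φ-pair = subst₂ _≤_ (sym old-Φ) (sym (cong₂ _+_ (Φ-joins new-w) (Φ-joins new-x)))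
            -- `suc w` loses (yw - yx)(yp + Nw), and `suc x` gains (yw - yx)(y₀ + Nx) besides (y₀ -
            -- ypx)(yx + Nx). With Nw ≤ Nx the loss is covered.
            (by-≤ (+-nonneg (*-nonneg (≤⇒0≤- (y≤ (parent x))) (0≤y+N x (suc x)))
                    (+-nonneg (*-nonneg (≤⇒0≤- yx≤yw) (≤⇒0≤- (y≤ p))) (*-nonneg (≤⇒0≤- yx≤yw) (≤⇒0≤- Nw≤Nx))))
              (solve 7 (λ y₀ yp yw yx ypx Nw Nx → (y₀ :- ypx) :* (yx :+ Nx) :+ ((yw :- yx) :* (y₀ :- yp) :+ (yw :- yx) :* (Nx :- Nw))
                := ((yp :* yx :+ (yp :+ yx) :* Nw) :+ (y₀ :* yw :+ (y₀ :+ yw) :* Nx)) :- ((yp :* yw :+ (yp :+ yw) :* Nw) :+ (ypx :* yx :+ (ypx :+ yx) :* Nx)))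
                refl y₀ yp yw yx ypx Nw Nx))
          Ψ-pair : Ψ root (suc w) (ends (suc w)) + Ψ root (suc x) (ends (suc x)) ≤ Ψ root (suc w) (Sw.ends′ (suc w)) + Ψ root (suc x) (Sw.ends′ (suc x))
          Ψ-pair = ≤-trans old-Ψ (≤-trans (+-monoˡ-≤ Nx yx≤yw) (subst₂ (λ s t → yw + Nx ≤ s + t)
            (sym (Ψ-joins new-w root)) (sym (trans (Ψ-joins new-x root) (Ψ-first (suc x) (≢-sym w≢root))))
            (subst (_≤ Ψ root (suc w) (p , x) + (yw + Nx)) (+-identityˡ (yw + Nx)) (+-monoˡ-≤ (yw + Nx) (Ψ-nonneg root (suc w) p x)))))

        opposite : Outcome
        opposite = by-cases (≤-total yw yx) (≤-total Nx Nw)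
          where
          by-cases : yw ≤ yx ⊎ yx ≤ yw → Nx ≤ Nw ⊎ Nw ≤ Nx → Outcome
          by-cases (inj₁ yw≤yx) _            = replace-w yw≤yx
          by-cases (inj₂ yx≤yw) (inj₁ Nx≤Nw) = keep-edges yx≤yw Nx≤Nw
          by-cases (inj₂ yx≤yw) (inj₂ Nw≤Nx) = exchange-edges yx≤yw Nw≤Nx

      -- If the parent of w is off both chords, the heavier of the two becomes the triangle vertex
      -- and the other hangs from it.
      chord-end : ∀ {w} → w ≢ root → parent w ≢ root → On ends w c → Outcome
      chord-end {w} w≢root p≢root w∈c = by-cases (On? p d) (≤-total (y p) (y w))
        where
        p = parent w
        b = proj₁ (other-end w∈c)
        b≢w = proj₁ (proj₂ (other-end w∈c))
        b∈c = proj₂ (proj₂ (other-end w∈c))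
        jc : Joins ends c w b
        jc = joins (≢-sym b≢w) w∈c b∈c
        by-cases : Dec (On ends p d) → y p ≤ y w ⊎ y w ≤ y p → Outcome
        by-cases (yes p∈d) _ = let q , q≢p , q∈d = other-end p∈d in Opposite.opposite w≢root p≢root jc (joins (≢-sym q≢p) p∈d q∈d)
        by-cases (no p∉d) (inj₁ yp≤yw) = exchange w≢root p≢root p∉d jc yp≤yw
        by-cases (no p∉d) (inj₂ yw≤yp) = rechord w≢root p≢root (≢-sym b≢w) (λ w∈d → chords-disjoint o w∈c w∈d)
          (not-parallel o w≢root w∈c) p∉d jc yw≤yp

      -- The pendant w must end up at a triangle vertex. Either w moves to the end z of c or that
      -- end of c moves to the parent of w, whichever place is the heavier.
      isolated : ∀ {w} → w ≢ root → parent w ≢ root → ¬ On ends w c → ¬ On ends w d → ¬ On ends (parent w) c → ¬ On ends (parent w) d → Outcome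
      isolated {w} w≢root p≢root w∉c w∉d p∉c p∉d = by-cases (≤-total (y (parent w)) (y z))
        where
        z = proj₁ (ends c)
        jc = chord-joins c
        by-cases : y (parent w) ≤ y z ⊎ y z ≤ y (parent w) → Outcome
        by-cases (inj₁ yp≤yz) = rehang w≢root p≢root w∉c w∉d p∉c jc yp≤yz
        by-cases (inj₂ yz≤yp) = rechord w≢root p≢root (≢-sym (off (Joins.on-b jc) w∉c)) w∉d p∉c p∉d jc yz≤yp

    -- Any vertex whose parent is not the root can be the one excepted from the move to the root. If
    -- there is none, all tree edges meet the root and the disjoint chords close two triangles.
    outcome : Outcome
    outcome = by-cases (any? (λ w → ¬? (w ≟ᶠ root) ×-dec ¬? (parent w ≟ᶠ root)))
      where
      c d : Fin (ℕ.suc n)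
      c = suc root
      d = zero
      o : Oriented c d root
      o = inj₁ (refl , refl)
      o′ = flip-orientation o
      jc = chord-joins c
      jd = chord-joins d
      low : ∀ w → w ≢ root → parent w ≢ root → Dec (On ends w c) → Dec (On ends w d) → Dec (On ends (parent w) c) → Dec (On ends (parent w) d) → Outcome
      low w w≢root p≢root (yes w∈c) _         _         _         = chord-end o w≢root p≢root w∈c
      low w w≢root p≢root (no _)    (yes w∈d) _         _         = chord-end o′ w≢root p≢root w∈d
      low w w≢root p≢root (no w∉c)  (no w∉d)  (yes p∈c) _         =
        let t , t≢p , t∈c = other-end p∈c in hanging o w≢root p≢root w∉c w∉d (joins (≢-sym t≢p) p∈c t∈c)
      low w w≢root p≢root (no w∉c)  (no w∉d)  (no _)    (yes p∈d) =
        let t , t≢p , t∈d = other-end p∈d in hanging o′ w≢root p≢root w∉d w∉c (joins (≢-sym t≢p) p∈d t∈d)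
      low w w≢root p≢root (no w∉c)  (no w∉d)  (no p∉c)  (no p∉d)  = isolated o w≢root p≢root w∉c w∉d p∉c p∉d
      by-cases : Dec (∃[ w ] w ≢ root × parent w ≢ root) → Outcome
      by-cases (yes (w , w≢root , p≢root)) = low w w≢root p≢root (On? w c) (On? w d) (On? (parent w) c) (On? (parent w) d)
      by-cases (no none) = centred-copy C.ends C.model (same-ends C.simple (edge-elim o (Change.Unchanged ends C.ends)
          (_ , _ , jc , C.joins-c) (_ , _ , jd , C.joins-d)
          (λ x x≢root → root , x ,
            subst (λ p → Joins ends (suc x) p x) (decidable-stable (parent x ≟ᶠ root) (λ p≢root → none (x , x≢root , p≢root))) (up-joins x≢root) ,
            C.joins-up x≢root)))
        where
        open Joins
        module C = Centred (centred {r} {ℕ.suc l} {n} {root} n≡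
          ( (chord≢root o (on-a jc) ∷ chord≢root o (on-b jc) ∷ chord≢root o′ (on-a jd) ∷ chord≢root o′ (on-b jd) ∷ [])
          ∷ (apart jc ∷ apart-chords o (on-a jc) (on-a jd) ∷ apart-chords o (on-a jc) (on-b jd) ∷ [])
          ∷ (apart-chords o (on-b jc) (on-a jd) ∷ apart-chords o (on-b jc) (on-b jd) ∷ [])
          ∷ (apart jd ∷ []) ∷ [] ∷ []))

-- From the power hypergraph to its graph, and the conclusion

open RationalArithmetic using (maximum; ∑-nonneg)
open PowerIteration using (PerronVectors)
open SpectralBounds using (≤ʳ-stable; ≰ʳ⇒≥ʳ; ≈ʳ⇒≥ʳ)
open RadiusComparison using (module Separation; Improvement; radius-permute)
open Separation using (separation)
open AdjacencyMatrix using (module Adjacency; weight)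
open GraphModels using (Model; Vertex; On; Simple; to-injective; model-≅; model-transport; module Sums; module Compare)
open PowerHypergraphs using (∣p∣≡2⇒pair; power-model)
open Labellings using (rename; rename-simple; rename-model; B₂C-connected)
open TargetCopies using (Joins; joins; Oriented)
open GraphCycles using (module Combinatorics; Joined)
open LooseCycles using (at-most-two; two-cycles; connected)
open EdgeMoves using (module Comparison)
open import Defs
open import Data.Fin.Permutation using (↔⇒≡)
open import Data.Fin.Subset using (_∈_)
open import Data.Fin.Subset.Properties using (⊆-antisym)
open import Data.Rational.Base as ℚ using (ℚ; 0ℚ)
import Data.Rational.Properties as ℚₚ
open import Data.Unit.Base using (tt)
open import Relation.Binary.Construct.Closure.ReflexiveTransitive using (Star)

adjacency-≅ : ∀ m .{{_ : NonTrivial m}} {X Y : Hypergraph} (iso : X ≅ Y) → let φ = Inverse.to (_≅_.onVertices iso) in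
              ∀ i j → Adjacency.A m X i j ≡ Adjacency.A m Y (φ i) (φ j)
adjacency-≅ m {X} {Y} iso i j with Adjacency.A-cases m X i j
... | inj₁ (i≢j , (e , i∈e , j∈e) , eq) = trans eq (sym (Adjacency.A-yes m Y (λ φi≡φj → i≢j (to-injective onVertices φi≡φj))
        (Inverse.to onEdges e , Equivalence.to (incidence i e) i∈e , Equivalence.to (incidence j e) j∈e)))
  where open _≅_ iso
... | inj₂ (not , eq) = trans eq (sym (Adjacency.A-no m Y λ { (φi≢φj , f , i∈f , j∈f) → not ((λ { refl → φi≢φj refl }) ,
        Inverse.from onEdges f , Equivalence.from (incidence i _) (back i∈f) , Equivalence.from (incidence j _) (back j∈f)) }))
  where
  open _≅_ iso
  back : ∀ {v f} → v ∈ edge Y f → v ∈ edge Y (Inverse.to onEdges (Inverse.from onEdges f))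
  back {v} {f} = subst (λ f → v ∈ edge Y f) (sym (Inverse.strictlyInverseˡ onEdges f))

module Ends (G : Hypergraph) (uniform : Uniform 2 G) where

  pair : ∀ e → ∃[ a ] ∃[ b ] a ≢ b × (∀ x → x ∈ edge G e ⇔ (x ≡ a ⊎ x ≡ b))
  pair e = ∣p∣≡2⇒pair (edge G e) (uniform e)

  ends : Fin (size G) → Fin (order G) × Fin (order G)
  ends e = proj₁ (pair e) , proj₁ (proj₂ (pair e))

  on : ∀ v e → v ∈ edge G e ⇔ On ends v e
  on v e = proj₂ (proj₂ (proj₂ (pair e))) v

  proper : ∀ e → proj₁ (ends e) ≢ proj₂ (ends e)
  proper e = proj₁ (proj₂ (proj₂ (pair e)))

  two-ends : ∀ {a b x e} → a ≢ b → On ends a e → On ends b e → On ends x e → x ≡ a ⊎ x ≡ b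
  two-ends a≢b (inj₁ refl) (inj₁ refl) _   = ⊥-elim (a≢b refl)
  two-ends a≢b (inj₁ refl) (inj₂ refl) x∈e = x∈e
  two-ends a≢b (inj₂ refl) (inj₁ refl) (inj₁ refl) = inj₂ refl
  two-ends a≢b (inj₂ refl) (inj₁ refl) (inj₂ refl) = inj₁ refl
  two-ends a≢b (inj₂ refl) (inj₂ refl) _   = ⊥-elim (a≢b refl)

  included : ∀ {a b e f} → a ≢ b → On ends a e → On ends b e → On ends a f → On ends b f →
             ∀ {x} → x ∈ edge G e → x ∈ edge G f
  included {f = f} a≢b a∈e b∈e a∈f b∈f {x} x∈e with two-ends a≢b a∈e b∈e (Equivalence.to (on x _) x∈e)
  ... | inj₁ refl = Equivalence.from (on x f) a∈f
  ... | inj₂ refl = Equivalence.from (on x f) b∈f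

  simple : Simple ends
  simple = record
    { proper = proper
    ; single = λ a≢b a∈e b∈e a∈f b∈f → edge-injective G (⊆-antisym (included a≢b a∈e b∈e a∈f b∈f) (included a≢b a∈f b∈f a∈e b∈e))
    }

module Main (r : ℕ) (H : Hypergraph) (conn : Connected H) (bicyclic : Bicyclic H)
            {n k : ℕ} {ends₀ : Fin k → Fin n × Fin n} (simple₀ : Simple ends₀) (M₀ : Model H r ends₀) (e₀ : Fin k) where

  m : ℕ
  m = suc (suc r)

  open Combinatorics simple₀

  two : AtMostTwo
  two = at-most-two M₀ simple₀ bicyclic

  walks : ∀ u v → Star (Joined ends₀ All) u v
  walks = connected M₀ simple₀ conn

  v₀ : Fin n
  v₀ = proj₁ (ends₀ e₀)

  n<k : suc n ℕ.≤ k
  n<k = let C , D , differ = two-cycles M₀ simple₀ bicyclic in edge-count v₀ walks C D differ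

  tree : ∀ root → Tree All root
  tree root = Search.tree All (λ _ → yes tt) e₀ root (λ w → walks w root)

  -- Counted with an arbitrary root, because the root of the argument depends on a vector that is
  -- chosen only later.
  k≡ : k ≡ suc n
  k≡ = sym (↔⇒≡ (Numbering.numbering (tree v₀) (chords (tree v₀) two n<k)))

  size≡ : size H ≡ suc n
  size≡ = trans (↔⇒≡ (Model.edges M₀)) k≡

  -- The tree, its chords and the edge numbers all depend on w, through the heaviest core vertex.
  module Rooted (w : Fin (order H) → ℚ) (0<w : ∀ i → 0ℚ ℚ.< w i) {l : ℕ} (n≡ : n ≡ 6 ℕ.+ l) where

    weight-at : Fin n → ℚ
    weight-at v = w (Inverse.from (Model.vertices M₀) (inj₁ v))

    root : Fin n
    root = proj₁ (maximum v₀ weight-at)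

    T : Tree All root
    T = tree root

    Ch : Chords T
    Ch = chords T two n<k

    open InTree T using (parent; up; up-child; up-parent; parent≢; IsUp)
    open Chords Ch
    open Numbering T Ch

    ends : Fin (suc n) → Fin n × Fin n
    ends = rename (↔-id (Fin n)) (↔-sym numbering) ends₀

    simple : Simple ends
    simple = rename-simple (↔-id (Fin n)) (↔-sym numbering) simple₀

    M : Model H r ends
    M = rename-model (↔-id (Fin n)) (↔-sym numbering) M₀

    g : Vertex r → ℚ
    g u = w (Inverse.from (Model.vertices M) u)

    0<g : ∀ u → 0ℚ ℚ.< g u
    0<g u = 0<w (Inverse.from (Model.vertices M) u)

    module S = Sums m M simple

    up-joins : ∀ {w} → w ≢ root → Joins ends (suc w) (parent w) w
    up-joins {w} w≢root = joins (≢-sym (parent≢ w≢root))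
      (subst (On ends₀ (parent w)) (sym (number-up w≢root)) (up-parent w≢root))
      (subst (On ends₀ w) (sym (number-up w≢root)) (up-child w≢root))

    oriented-chord : ∀ {c d} → Oriented c d root → ¬ IsUp (number c) × ¬ IsUp (number d) × number c ≢ number d
    oriented-chord (inj₁ (refl , refl)) = subst (λ e → ¬ IsUp e) (sym number-root) chord₁ , chord₂ , subst (_≢ e₂) (sym number-root) e₁≢e₂
    oriented-chord (inj₂ (refl , refl)) = chord₂ , subst (λ e → ¬ IsUp e) (sym number-root) chord₁ , subst (e₂ ≢_) (sym number-root) (≢-sym e₁≢e₂)

    root-off-chords : ∀ {c d} → Oriented c d root → ¬ On ends root c
    root-off-chords o = chord-root T (proj₁ (oriented-chord o))

    disjoint-chords : ∀ {c d x} → Oriented c d root → On ends x c → On ends x d → ⊥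
    disjoint-chords o = let c , d , c≢d = oriented-chord o in chords-disjoint T two c d c≢d

    chords-apart-at : ∀ {c d w b} → Oriented c d root → w ≢ root → parent w ≢ root → w ≢ b →
                   On ends w c → On ends b c → On ends (parent w) d → parent b ≢ root
    chords-apart-at o = let c , d , c≢d = oriented-chord o in chords-apart T two c d c≢d

    open Comparison r l n≡ simple root parent up-joins root-off-chords disjoint-chords chords-apart-at
      (S.y g) (S.extra g) (λ v → 0<g (inj₁ v)) (λ e → ∑-nonneg (λ j → ℚₚ.<⇒≤ (0<g (inj₂ (e , j))))) (proj₂ (maximum v₀ weight-at))
      public

  module Conclusion (l : ℕ) (n≡ : n ≡ 6 ℕ.+ l) (not-BC : ¬ (H ≅ B₂C m (suc l) 0)) {ρ ρ′ : ℝ}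
    (isρ : IsSpectralRadius (adjacency m H) ρ) (isρ′ : IsSpectralRadius (adjacency m (B₂C m l 1)) ρ′) where

    B : Hypergraph
    B = B₂C m l 1

    module AH = Adjacency m H
    module AB = Adjacency m B

    o : Fin (order H)
    o = Inverse.from (Model.vertices M₀) (inj₁ v₀)

    P : PerronVectors AH.A o
    P = AH.perron-of-connected conn o

    P′ : PerronVectors AB.A zero
    P′ = AB.perron-of-connected (B₂C-connected r l 1) zero

    Claim : Set
    Claim = (ρ ≤ ρ′) × (ρ ≈ ρ′ → H ≅ B)

    compare : (w : Fin (order H) → ℚ) → (∀ i → 0ℚ ℚ.< w i) → (Improvement AH.A AB.A (weight m) w → ¬ (ρ′ ≤ ρ)) → Claim
    compare w 0<w separated = by-outcome R.outcome
      where
      module R = Rooted w 0<w n≡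
      by-outcome : R.Outcome → Claim
      by-outcome (R.centred-copy ends′ model same) = ⊥-elim (not-BC (model-≅ R.M model same))
      by-outcome (R.target-copy ends′ model same) =
        radius-permute {B = AB.A} AH.represents AB.represents AH.0≤A AB.0≤A AB.A-sym o P′ (_≅_.onVertices iso) (adjacency-≅ m iso) isρ isρ′ ,
        λ _ → iso
        where
        iso : H ≅ B
        iso = model-≅ R.M model same
      by-outcome (R.improved ends′ simple′ model (form-le , v , j , gain-le)) =
        -- Both claims reduce to refuting ρ′ ≤ ρ, which would follow from the failure of ρ ≤ ρ′ as
        -- well as from equality.
        ≤ʳ-stable {ρ} {ρ′} (λ ρ≰ρ′ → apart (≰ʳ⇒≥ʳ {ρ} {ρ′} ρ≰ρ′)) , λ ρ≈ρ′ → ⊥-elim (apart (≈ʳ⇒≥ʳ {ρ} {ρ′} ρ≈ρ′))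
        where
        apart : ¬ (ρ′ ≤ ρ)
        apart = separated (Compare.improvement m R.M R.simple model simple′ w form-le v j gain-le)

    claim : Claim
    claim = let w , 0<w , separated = separation AH.represents AB.represents AH.0≤A AH.A≤1 AB.0≤A AB.A-sym P P′ AH.0<c
            in compare w 0<w (λ improved → separated improved isρ isρ′)

theorem4p0p2 : (m : ℕ) .{{_ : NonTrivial m}} (H : Hypergraph) →
    Uniform m H → Linear H → IsPowerHypergraph m H → Connected H → Bicyclic H →
    let k = size H in
    k ≥ⁿ 8 → ¬ (H ≅ B₂C m (k ∸ 6) 0) → (k ∸ 12) *ⁿ (m ∸ 1) ≥ⁿ 56 →
    (ρ ρ′ : ℝ) → IsSpectralRadius (adjacency m H) ρ →
    IsSpectralRadius (adjacency m (B₂C m (k ∸ 7) 1)) ρ′ →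
    (ρ ≤ ρ′) × (ρ ≈ ρ′ → H ≅ B₂C m (k ∸ 7) 1)
theorem4p0p2 zero {{nt}} = ⊥-elim (ℕₚ.<⇒≱ (ℕ.nonTrivial⇒n>1 0 {{nt}}) z≤n)
theorem4p0p2 (suc zero) {{nt}} = ⊥-elim (ℕₚ.<-irrefl refl (ℕ.nonTrivial⇒n>1 1 {{nt}}))
theorem4p0p2 (suc (suc r)) H _ _ (G , uniform-G , H≅) conn bicyclic k≥8 not-BC _ ρ ρ′ isρ isρ′ =
  subst Claim (sym l≡) (λ isρ′ → Conclusion.claim (n ∸ 6) n≡ (λ iso → not-BC (subst (λ l → H ≅ B₂C m l 0) (sym l₁≡) iso)) isρ isρ′) isρ′
  where
  open Ends G uniform-G
  n = order G
  m = suc (suc r)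
  M₀ : Model H r ends
  M₀ = model-transport H≅ (power-model m G ends on)
  open Main r H conn bicyclic simple M₀ (Inverse.to (Model.edges M₀) (fromℕ< (ℕₚ.≤-trans (s≤s z≤n) k≥8))) using (size≡; module Conclusion)
  n≥7 : 7 ℕ.≤ n
  n≥7 = ℕₚ.≤-pred (subst (8 ℕ.≤_) size≡ k≥8)
  n≡ : n ≡ 6 ℕ.+ (n ∸ 6)
  n≡ = sym (ℕₚ.m+[n∸m]≡n (ℕₚ.≤-trans (ℕₚ.n≤1+n 6) n≥7))
  -- H has one edge more than its graph has vertices, so l = n - 6 equals k - 7, and l + 1 equals k
  -- - 6.
  l≡ : size H ∸ 7 ≡ n ∸ 6
  l≡ = cong (_∸ 7) size≡
  l₁≡ : size H ∸ 6 ≡ suc (n ∸ 6)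
  l₁≡ = trans (cong (_∸ 6) size≡) (ℕₚ.+-∸-assoc 1 (ℕₚ.≤-trans (ℕₚ.n≤1+n 6) n≥7))
  Claim : ℕ → Set
  Claim l = IsSpectralRadius (adjacency m (B₂C m l 1)) ρ′ → (ρ ≤ ρ′) × (ρ ≈ ρ′ → H ≅ B₂C m l 1)
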